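{- Suppose the following statement (C) holds. (C): Let $q=p^n$ be a power of a prime $p$, $k$ a divisor of $n$, and $v\ge1$ a divisor of $p^k-1$. Let $\mathcal{U}\subseteq\mathbb{F}_q$ be an $\mathbb{F}_{p^k}$-vector space of dimension $m$ such that $1\in\mathcal{U}$ and $\#\mathcal{U}^v>2$. If $\mathcal{U}$ is not a field, then $\mathcal{P}(\mathcal{U}^v,q)=\{f^v : f\in\mathcal{P}(\mathcal{U},q)\}$. Otherwise, $\mathcal{P}(\mathcal{U}^v,q)=\left\{f^{\frac{(p^e-1)v}{p^{mk}-1}} : f\in\mathcal{P}(\mathbb{F}_{p^e},q)\right\}$, where $\mathbb{F}_{p^e}\subseteq\mathbb{F}_q$ is the smallest field containing $\mathcal{U}^v$. Let $q=p^n$ be a prime power, and let $\mathcal{F}: y^d=f(x)$ be an irreducible plane curve defined over the finite field $\mathbb{F}_q$. If $d<q-1$, then $\mathcal{F}$ is $\mathbb{F}_q$-Frobenius nonclassical if and only if $d=\frac{q-1}{p^e-1}$, where $e\mid n$, and $f(x)$ is a minimal value set polynomial (over $\mathbb{F}_q$) whose value set is $\mathbb{F}_{p^e}$.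
   Context: For $F\in\mathbb{F}_q[x]$, $V_F=\{F(\alpha):\alpha\in\mathbb{F}_q\}$ is its value set. A polynomial $F\in\mathbb{F}_q[x]$ of positive degree is a minimal value set polynomial (MVSP) over $\mathbb{F}_q$ if $\#V_F=\lfloor (q-1)/\deg F\rfloor+1$. For a nonempty $S\subseteq\mathbb{F}_q$, $\mathcal{P}(S,q)$ denotes the set of all MVSPs $F\in\mathbb{F}_q[x]$ with $V_F=S$, and $S^v=\{s^v:s\in S\}$ for every integer $v\ge1$. An irreducible plane curve $\mathcal{C}$ defined over $\mathbb{F}_q$ is called $\mathbb{F}_q$-Frobenius nonclassical if the $\mathbb{F}_q$-Frobenius map (raising coordinates to the $q$-th power) takes each nonsingular point $P\in\mathcal{C}$ to the tangent line to $\mathcal{C}$ at $P$. -}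

module Defs where

open import Algebra.Bundles using (CommutativeRing; RawRing)
open import Algebra.Morphism.Structures using (module RingMorphisms)
import Algebra.Definitions.RawSemiring as RawSemiringDefs
open import Data.Fin.Base using (Fin)
open import Data.List.Base using (List; []; _∷_; map)
open import Data.Nat.Base as ℕ using (ℕ; zero; suc; _≤_; _<_; _∸_; _⊔_)
open import Data.Nat.Divisibility using (_∣_)
open import Data.Nat.DivMod using (_/_)
open import Data.Nat.Primality using (Prime)
open import Data.Product.Base using (Σ; ∃; _×_; _,_; proj₁)
open import Function.Bundles using (Inverse)
open import Level using (Level) renaming (_⊔_ to _⊔ˡ_; suc to lsuc)
open import Relation.Binary.Bundles using (Setoid)
import Relation.Binary.Construct.On as On
open import Relation.Binary.Definitions using () renaming (Decidable to Decidable₂)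
open import Relation.Binary.PropositionalEquality.Core using (_≡_)
import Relation.Binary.PropositionalEquality.Properties as ≡
open import Relation.Nullary.Negation.Core using (¬_)
open import Relation.Unary using (Pred; _∈_; _⊆_; _≐_; Decidable)

------------------------------------------------------------------------
-- Fields

-- Equality is decidable, as it is in every finite field and its
-- algebraic closure; hence no apartness relation is carried around.

record Field c ℓ : Set (lsuc (c ⊔ˡ ℓ)) where
  field
    commutativeRing : CommutativeRing c ℓ
  open CommutativeRing commutativeRing public
  field
    _≟_     : Decidable₂ _≈_
    0≉1     : ¬ (0# ≈ 1#)
    inverse : ∀ x → ¬ (x ≈ 0#) → ∃ λ y → x * y ≈ 1#

HasSize : ∀ {a ℓ s} (A : Setoid a ℓ) → Pred (Setoid.Carrier A) s → ℕ → Set (a ⊔ˡ ℓ ⊔ˡ s)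
HasSize A S n = Inverse (On.setoid A (proj₁ {B = S})) (≡.setoid (Fin n))

record FiniteField c ℓ : Set (lsuc (c ⊔ˡ ℓ)) where
  field
    baseField : Field c ℓ
  open Field baseField public
  field
    order       : ℕ
    enumeration : Inverse setoid (≡.setoid (Fin order))

------------------------------------------------------------------------
-- Polynomials in one variable over a ring R: a₀ ∷ a₁ ∷ … ∷ aₙ ∷ []
-- stands for a₀ + a₁ X + … + aₙ Xⁿ.  Trailing zeros are allowed, so
-- equality of polynomials is equality of all coefficients.

module Polynomials {c ℓ} (R : RawRing c ℓ) where
  open RawRing R

  Poly : Set c
  Poly = List Carrier

  coeff : Poly → ℕ → Carrier
  coeff []      _       = 0#
  coeff (a ∷ f) zero    = a
  coeff (a ∷ f) (suc i) = coeff f i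

  _≈ₚ_ : Poly → Poly → Set ℓ
  f ≈ₚ g = ∀ i → coeff f i ≈ coeff g i

  HasDegree : Poly → ℕ → Set ℓ
  HasDegree f n = ¬ (coeff f n ≈ 0#) × (∀ i → n < i → coeff f i ≈ 0#)

  _+ₚ_ : Poly → Poly → Poly
  []      +ₚ g       = g
  (a ∷ f) +ₚ []      = a ∷ f
  (a ∷ f) +ₚ (b ∷ g) = (a + b) ∷ (f +ₚ g)

  _*ₚ_ : Poly → Poly → Poly
  []      *ₚ g = []
  (a ∷ f) *ₚ g = map (a *_) g +ₚ (0# ∷ (f *ₚ g))

  const : Carrier → Poly
  const a = a ∷ []

  X : Poly
  X = 0# ∷ 1# ∷ []

  eval : Poly → Carrier → Carrier
  eval []      x = 0#
  eval (a ∷ f) x = a + x * eval f x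

  -- (a + X f)′ = f + X f′
  derivative : Poly → Poly
  derivative []      = []
  derivative (a ∷ f) = f +ₚ (0# ∷ derivative f)

  rawRing : RawRing c ℓ
  rawRing = record
    { Carrier = Poly
    ; _≈_     = _≈ₚ_
    ; _+_     = _+ₚ_
    ; _*_     = _*ₚ_
    ; -_      = map (-_)
    ; 0#      = []
    ; 1#      = const 1#
    }

module _ {c ℓ} (R : RawRing c ℓ) where
  open RawRing R
  open RawSemiringDefs rawSemiring using (_^_)

  Powers : ∀ {s} → Pred Carrier s → ℕ → Pred Carrier (c ⊔ˡ ℓ ⊔ˡ s)
  Powers S v b = ∃ λ s → s ∈ S × b ≈ s ^ v

------------------------------------------------------------------------
-- Subfields and subspaces

module _ {c ℓ} (F : Field c ℓ) where
  open Field F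
  open RawSemiringDefs (RawRing.rawSemiring rawRing) using (sum)

  record IsSubfield {s} (L : Pred Carrier s) : Set (c ⊔ˡ ℓ ⊔ˡ s) where
    field
      resp   : ∀ {x y} → x ≈ y → x ∈ L → y ∈ L
      0∈     : 0# ∈ L
      1∈     : 1# ∈ L
      +-clos : ∀ {x y} → x ∈ L → y ∈ L → x + y ∈ L
      neg    : ∀ {x} → x ∈ L → - x ∈ L
      *-clos : ∀ {x y} → x ∈ L → y ∈ L → x * y ∈ L
      inv    : ∀ {x y} → x ∈ L → x * y ≈ 1# → y ∈ L

  IsSubfieldOfOrder : ∀ {s} → Pred Carrier s → ℕ → Set (c ⊔ˡ ℓ ⊔ˡ s)
  IsSubfieldOfOrder L r = IsSubfield L × HasSize setoid L r

  record IsSubspace {s t} (L : Pred Carrier s) (U : Pred Carrier t) : Set (c ⊔ˡ ℓ ⊔ˡ s ⊔ˡ t) where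
    field
      resp   : ∀ {x y} → x ≈ y → x ∈ U → y ∈ U
      0∈     : 0# ∈ U
      +-clos : ∀ {x y} → x ∈ U → y ∈ U → x + y ∈ U
      scale  : ∀ {a x} → a ∈ L → x ∈ U → a * x ∈ U

  record IsBasis {s t} (L : Pred Carrier s) (U : Pred Carrier t) {m} (b : Fin m → Carrier) :
                 Set (c ⊔ˡ ℓ ⊔ˡ s ⊔ˡ t) where
    field
      basis∈      : ∀ i → b i ∈ U
      spanning    : ∀ {u} → u ∈ U → Σ (Fin m → Carrier) λ a →
                    (∀ i → a i ∈ L) × u ≈ sum (λ i → a i * b i)
      independent : (a : Fin m → Carrier) → (∀ i → a i ∈ L) →
                    sum (λ i → a i * b i) ≈ 0# → ∀ i → a i ≈ 0#

  HasDimension : ∀ {s t} → Pred Carrier s → Pred Carrier t → ℕ → Set (c ⊔ˡ ℓ ⊔ˡ s ⊔ˡ t)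
  HasDimension L U m = Σ (Fin m → Carrier) (IsBasis L U)

  -- E is the smallest subfield containing S.  Only decidable subfields
  -- compete: classically this is no restriction.
  IsSmallestSubfieldContaining : ∀ {s} → Pred Carrier s → Pred Carrier s → Set (c ⊔ˡ ℓ ⊔ˡ lsuc s)
  IsSmallestSubfieldContaining {s} S E =
    IsSubfield E × S ⊆ E ×
    ((E′ : Pred Carrier s) → Decidable E′ → IsSubfield E′ → S ⊆ E′ → E ⊆ E′)

------------------------------------------------------------------------
-- Minimal value set polynomials

module _ {c ℓ} (F : FiniteField c ℓ) where
  open FiniteField F
  open Polynomials rawRing using (Poly; HasDegree; eval)

  ValueSet : Poly → Pred Carrier (c ⊔ˡ ℓ)
  ValueSet f b = ∃ λ α → eval f α ≈ b

  IsMVSP : Poly → Set (c ⊔ˡ ℓ)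
  IsMVSP f = ∃ λ D → HasDegree f (suc D) ×
    HasSize setoid (ValueSet f) ((order ∸ 1) / suc D ℕ.+ 1)

  𝒫 : ∀ {s} → Pred Carrier s → Pred Poly (c ⊔ˡ ℓ ⊔ˡ s)
  𝒫 S f = IsMVSP f × ValueSet f ≐ S

-- The smallest subfield containing 𝒰ᵛ has p ^ e elements, and w is the
-- exponent (pᵉ - 1) v / (pᵐᵏ - 1), a natural number determined by the
-- equation imposed on it.
StatementC : ∀ c ℓ → Set (lsuc (c ⊔ˡ ℓ))
StatementC c ℓ =
  (F : FiniteField c ℓ) → let open FiniteField F; open Polynomials rawRing using () renaming (rawRing to F[X]) in
  ∀ p n → Prime p → order ≡ p ℕ.^ n →
  ∀ k → k ∣ n →
  ∀ v → 1 ≤ v → v ∣ p ℕ.^ k ∸ 1 →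
  (𝔽ₚₖ : Pred Carrier (c ⊔ˡ ℓ)) → IsSubfieldOfOrder baseField 𝔽ₚₖ (p ℕ.^ k) →
  ∀ m (𝒰 : Pred Carrier (c ⊔ˡ ℓ)) → IsSubspace baseField 𝔽ₚₖ 𝒰 → HasDimension baseField 𝔽ₚₖ 𝒰 m →
  1# ∈ 𝒰 →
  (∃ λ N → HasSize setoid (Powers rawRing 𝒰 v) N × 2 < N) →
  (¬ IsSubfield baseField 𝒰 →
    𝒫 F (Powers rawRing 𝒰 v) ≐ Powers F[X] (𝒫 F 𝒰) v)
  ×
  (IsSubfield baseField 𝒰 →
    ∀ e (𝔽ₚₑ : Pred Carrier (c ⊔ˡ ℓ)) →
    HasSize setoid 𝔽ₚₑ (p ℕ.^ e) →
    IsSmallestSubfieldContaining baseField (Powers rawRing 𝒰 v) 𝔽ₚₑ →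
    ∀ w → w ℕ.* (p ℕ.^ (m ℕ.* k) ∸ 1) ≡ (p ℕ.^ e ∸ 1) ℕ.* v →
    𝒫 F (Powers rawRing 𝒰 v) ≐ Powers F[X] (𝒫 F 𝔽ₚₑ) w)

------------------------------------------------------------------------
-- Algebraic closures

record AlgebraicClosure {c ℓ} (F : Field c ℓ) c′ ℓ′ : Set (c ⊔ˡ ℓ ⊔ˡ lsuc (c′ ⊔ˡ ℓ′)) where
  private module F = Field F
  field
    closure : Field c′ ℓ′
  open Field closure public
  private
    module F[X] = Polynomials F.rawRing
    module K[X] = Polynomials rawRing
  field
    embed          : F.Carrier → Carrier
    embed-isHom    : RingMorphisms.IsRingHomomorphism F.rawRing rawRing embed
    algebraic      : ∀ x → ∃ λ f → ¬ (f F[X].≈ₚ []) × K[X].eval (map embed f) x ≈ 0#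
    algClosed      : ∀ f n → K[X].HasDegree f (suc n) → ∃ λ x → K[X].eval f x ≈ 0#

------------------------------------------------------------------------
-- Plane curves over a field K

module PlaneCurves {c ℓ} (K : Field c ℓ) where
  open Field K
  module K[x]       = Polynomials rawRing
  module K[x][y]    = Polynomials K[x].rawRing
  module K[x][y][z] = Polynomials K[x][y].rawRing

  open RawSemiringDefs (RawRing.rawSemiring rawRing) using (_^_)

  Form : Set c
  Form = K[x][y][z].Poly

  eval₃ : Form → Carrier → Carrier → Carrier → Carrier
  eval₃ H x y z =
    K[x].eval (K[x][y].eval (K[x][y][z].eval H (K[x][y].const (K[x].const z))) (K[x].const y)) x

  ∂X ∂Y ∂Z : Form → Form
  ∂X = map (map K[x].derivative)
  ∂Y = map K[x][y].derivative
  ∂Z = K[x][y][z].derivative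

  -- The projective curve H = 0, given by homogeneous coordinates; the
  -- tangent line at (x : y : z) is ∂X H(x,y,z) X + ∂Y H(x,y,z) Y + ∂Z H(x,y,z) Z = 0.
  FrobeniusNonclassical : ℕ → Form → Set (c ⊔ˡ ℓ)
  FrobeniusNonclassical q H = ∀ x y z →
    let Hx = eval₃ (∂X H) x y z
        Hy = eval₃ (∂Y H) x y z
        Hz = eval₃ (∂Z H) x y z
    in
    ¬ (x ≈ 0# × y ≈ 0# × z ≈ 0#) →
    eval₃ H x y z ≈ 0# →
    ¬ (Hx ≈ 0# × Hy ≈ 0# × Hz ≈ 0#) →
    Hx * x ^ q + Hy * y ^ q + Hz * z ^ q ≈ 0#

  -- y ^ d - f(x)
  affineEquation : ℕ → K[x].Poly → K[x][y].Poly
  affineEquation d f = K[x][y].X ^₂ d +₂ (-₂ K[x][y].const f)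
    where
    open RawRing K[x][y].rawRing using () renaming (_+_ to _+₂_; -_ to -₂_)
    open RawSemiringDefs (RawRing.rawSemiring K[x][y].rawRing) using () renaming (_^_ to _^₂_)

  module _ where
    open RawRing K[x][y][z].rawRing using () renaming (_+_ to _+₃_; _*_ to _*₃_; -_ to -₃_; 0# to 0₃)
    open RawSemiringDefs (RawRing.rawSemiring K[x][y][z].rawRing) using () renaming (_^_ to _^₃_)

    varX varY varZ : Form
    varX = K[x][y][z].const (K[x][y].const K[x].X)
    varY = K[x][y][z].const K[x][y].X
    varZ = K[x][y][z].X

    -- Σᵢ aᵢ Xⁱ Z^(M - i) for f = Σᵢ aᵢ xⁱ of degree at most M
    homogenise : ℕ → K[x].Poly → Form
    homogenise M []      = 0₃
    homogenise M (a ∷ f) =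
      K[x][y][z].const (K[x][y].const (K[x].const a)) *₃ varZ ^₃ M +₃ varX *₃ homogenise (M ∸ 1) f

    -- The homogenisation of y ^ d - f(x), where D is the degree of f.
    projectiveEquation : (d D : ℕ) → K[x].Poly → Form
    projectiveEquation d D f =
      varY ^₃ d *₃ varZ ^₃ ((d ⊔ D) ∸ d) +₃ (-₃ homogenise (d ⊔ D) f)

  IsIrreducibleCurve : ℕ → K[x].Poly → Set (c ⊔ˡ ℓ)
  IsIrreducibleCurve d f =
    RawSemiringDefs.Irreducible (RawRing.rawSemiring K[x][y].rawRing) (affineEquation d f)

-- On the curve yᵈ = f(x), Frobenius nonclassicality says d yᵈ⁻¹ (y^q - y) = f′(x) (x^q - x).  If it
-- holds then p does not divide d, since otherwise f′ = 0 and f is a p-th power; the condition is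
-- invariant under y ↦ ζ y only if every d-th root of unity ζ is a (q-1)-th one, so q - 1 = m d; and
-- eliminating y leaves d (f^(m+1) - f) = f′ (x^q - x).  Comparing degrees and counting roots, f is a
-- minimal value set polynomial with the same values as x^d.  Statement (C) with 𝒰 = 𝔽_q makes f a
-- w-th power with w ∣ d, and irreducibility of yᵈ - f forces w = 1.  Conversely, x^q - x divides
-- f^(p^e) - f, and differentiating shows that the quotient is f′, which is the condition above.

module Submission where

open import Defs
open import Algebra.Bundles using (CommutativeRing; RawRing; AbelianGroup)
import Algebra.Definitions.RawSemiring as SemiringRaw
open import Algebra.Morphism.Structures using (module RingMorphisms)
import Algebra.Properties.AbelianGroup as AbelianGroupProperties
import Algebra.Properties.CommutativeMonoid.Sum as MonoidSum
import Algebra.Properties.CommutativeSemigroup as CommutativeSemigroupProperties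
import Algebra.Properties.CommutativeSemiring.Binomial as Binomial
import Algebra.Properties.CommutativeSemiring.Exp as CommutativeSemiringExp
import Algebra.Properties.Ring as RingProperties
import Algebra.Properties.Semiring.Exp as SemiringExp
import Algebra.Properties.Semiring.Mult as SemiringMult
import Algebra.Properties.Semiring.Mult.TCOptimised as Mult′
import Algebra.Properties.Semiring.Sum as SemiringSum
import Algebra.Solver.Ring as RingSolver
open import Algebra.Solver.Ring.AlmostCommutativeRing using (fromCommutativeRing; _-Raw-AlmostCommutative⟶_)
open import Data.Empty using (⊥; ⊥-elim)
open import Data.Fin.Base as Fin using (Fin; punchIn; toℕ; fromℕ<; remQuot; combine; fromℕ; inject₁)
open import Data.Fin.Permutation as Perm using (Permutation; _⟨$⟩ʳ_)
import Data.Fin.Properties as Fin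
open import Data.Integer.Base as ℤ using (ℤ; +_; -[1+_]; _⊖_)
import Data.Integer.Properties as ℤ
open import Data.List.Base using ([]; _∷_; map; drop; length)
open import Data.List.Properties using (map-id; map-∘; length-drop)
open import Data.Maybe.Base as Maybe using (Maybe)
open import Data.Nat.Base as ℕ using (ℕ; zero; suc; _≤_; _∸_; _<_; z≤n; s≤s; _!)
open import Data.Nat.Combinatorics using (_C_; nCk≡n!/k![n-k]!; k![n∸k]!∣n!; nCn≡1)
open import Data.Nat.Coprimality using (prime⇒coprime; coprime-Bézout)
open import Data.Nat.DivMod using (_%_; _/_; m≡m%n+[m/n]*n; m%n<n; m/n*n≡m; m/n*n≤m; m<n*o⇒m/o<n; /-monoˡ-≤; m*n/n≡m)
open import Data.Nat.Divisibility as ℕ using (_∣_; _∣?_; divides; m∣m*n; ∣⇒≤)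
open import Data.Nat.GCD using (gcd; gcd[m,n]∣m; gcd[m,n]∣n; gcd-GCD; module Bézout)
open import Data.Nat.Primality using (Prime; prime⇒nonZero; prime⇒nonTrivial; euclidsLemma)
import Data.Nat.Properties as ℕ
open import Data.Product.Base using (_×_; _,_; proj₁; proj₂; ∃; ∃₂; Σ)
open import Data.Sum.Base using (_⊎_; inj₁; inj₂)
open import Data.Unit.Polymorphic.Base using (⊤; tt)
open import Data.Vec.Functional using (replicate)
open import Function.Base using (_∘_; id)
open import Function.Bundles using (Inverse; _⇔_; mk⇔)
open import Level using (_⊔_; Lift; lift) renaming (suc to lsuc)
open import Relation.Binary.Bundles using (Setoid)
open import Relation.Binary.Definitions using (tri<; tri≈; tri>)
open import Relation.Binary.PropositionalEquality.Core as ≡ using (_≡_; _≢_)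
import Relation.Binary.PropositionalEquality.Properties as ≡
import Relation.Binary.Reasoning.Setoid as SetoidReasoning
open import Relation.Nullary using (¬_; yes; no; Dec)
open import Relation.Nullary.Decidable using (map′)
open import Relation.Nullary.Decidable.Core using (dec⇒maybe)
open import Relation.Unary using (Pred; _∈_; _⊆_; _≐_; Decidable; _∩_)

-- Commutative rings

-- Three obstacles shape the proof. (C) speaks of the smallest field containing the d-th powers and
-- of its number of elements, so this field has to be built together with a count. The d-th powers
-- are closed under multiplication, hence their additive span is a finite ring, hence a field, and
-- each new generator multiplies the size of a span by p; this yields p^e elements at once. Next,
-- nonclassicality concerns partial derivatives of a homogenised equation in nested polynomials. The
-- tangent line evaluated at the Frobenius image is the derivative of the equation in the direction
-- (x^q, y^q, z^q), and that is computed from the Leibniz rule. Finally, divisibilities such as m |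
-- p^e - 1 come from counting the roots of X^(m+1) - X, and a factorisation is recognised as proper
-- because both factors vanish at a common point, which no unit does. In the converse the points at
-- infinity require a fact of their own: the coefficient a of x^d in f satisfies a^(p^e) = a.

module IntegerSolver {c ℓ} (R : CommutativeRing c ℓ) where
  open CommutativeRing R
  open RingProperties ring
  open AbelianGroupProperties +-abelianGroup using (⁻¹-∙-comm; ε⁻¹≈ε; ⁻¹-involutive)
  open Mult′ semiring using (1+×; ×-homo-+; ×1-homo-*) renaming (_×_ to _·_)
  open SetoidReasoning setoid

  -- The multiple is the optimised one, for which `1 · 1#` reduces to `1#`. Hence `con (+ 0)` and
  -- `con (+ 1)` in a solver equation denote `0#` and `1#` definitionally.
  ⟦_⟧ℤ : ℤ → Carrier
  ⟦ + n ⟧ℤ      = n · 1#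
  ⟦ -[1+ n ] ⟧ℤ = - (suc n · 1#)

  ⊖-homo : ∀ m n → ⟦ m ⊖ n ⟧ℤ ≈ m · 1# - n · 1#
  ⊖-homo m zero = sym (trans (+-congˡ ε⁻¹≈ε) (+-identityʳ _))
  ⊖-homo zero (suc n) = sym (+-identityˡ _)
  ⊖-homo (suc m) (suc n) = begin
    ⟦ suc m ⊖ suc n ⟧ℤ ≡⟨ ≡.cong ⟦_⟧ℤ (ℤ.[1+m]⊖[1+n]≡m⊖n m n) ⟩
    ⟦ m ⊖ n ⟧ℤ ≈⟨ ⊖-homo m n ⟩
    m · 1# - n · 1# ≈⟨ +-congʳ (+-identityʳ _) ⟨
    (m · 1# + 0#) - n · 1# ≈⟨ +-congʳ (+-congˡ (-‿inverseʳ 1#)) ⟨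
    (m · 1# + (1# - 1#)) - n · 1# ≈⟨ +-congʳ (+-assoc _ _ _) ⟨
    ((m · 1# + 1#) - 1#) - n · 1# ≈⟨ +-assoc _ _ _ ⟩
    (m · 1# + 1#) + (- 1# - n · 1#) ≈⟨ +-cong (+-comm _ _) (⁻¹-∙-comm _ _) ⟩
    (1# + m · 1#) - (1# + n · 1#) ≈⟨ +-cong (1+× m 1#) (-‿cong (1+× n 1#)) ⟨
    suc m · 1# - suc n · 1# ∎

  +-homo : ∀ i j → ⟦ i ℤ.+ j ⟧ℤ ≈ ⟦ i ⟧ℤ + ⟦ j ⟧ℤ
  +-homo (+ m)    (+ n)    = ×-homo-+ 1# m n
  +-homo (+ m)    -[1+ n ] = ⊖-homo m (suc n)
  +-homo -[1+ m ] (+ n)    = trans (⊖-homo n (suc m)) (+-comm _ _)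
  +-homo -[1+ m ] -[1+ n ] = begin
    - (suc (suc (m ℕ.+ n)) · 1#) ≡⟨ ≡.cong (λ k → - (suc k · 1#)) (≡.sym (+-suc m n)) ⟩
    - ((suc m ℕ.+ suc n) · 1#) ≈⟨ -‿cong (×-homo-+ 1# (suc m) (suc n)) ⟩
    - (suc m · 1# + suc n · 1#) ≈⟨ ⁻¹-∙-comm _ _ ⟨
    - (suc m · 1#) - (suc n · 1#) ∎
    where open import Data.Nat.Properties using (+-suc)

  -‿homo : ∀ i → ⟦ ℤ.- i ⟧ℤ ≈ - ⟦ i ⟧ℤ
  -‿homo (+ zero)  = sym ε⁻¹≈ε
  -‿homo (+ suc n) = refl
  -‿homo -[1+ n ]  = sym (⁻¹-involutive _)

  +*-homo : ∀ m j → ⟦ + m ℤ.* j ⟧ℤ ≈ m · 1# * ⟦ j ⟧ℤ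
  +*-homo m (+ n) = begin
    ⟦ + m ℤ.* + n ⟧ℤ ≡⟨ ≡.cong ⟦_⟧ℤ (ℤ.pos-* m n) ⟨
    (m ℕ.* n) · 1# ≈⟨ ×1-homo-* m n ⟩
    (m · 1#) * (n · 1#) ∎
  +*-homo m -[1+ n ] = begin
    ⟦ + m ℤ.* ℤ.- + suc n ⟧ℤ ≡⟨ ≡.cong ⟦_⟧ℤ (ℤ.neg-distribʳ-* (+ m) (+ suc n)) ⟨
    ⟦ ℤ.- (+ m ℤ.* + suc n) ⟧ℤ ≈⟨ -‿homo (+ m ℤ.* + suc n) ⟩
    - ⟦ + m ℤ.* + suc n ⟧ℤ ≈⟨ -‿cong (+*-homo m (+ suc n)) ⟩
    - (m · 1# * (suc n · 1#)) ≈⟨ -‿distribʳ-* _ _ ⟩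
    m · 1# * - (suc n · 1#) ∎

  *-homo : ∀ i j → ⟦ i ℤ.* j ⟧ℤ ≈ ⟦ i ⟧ℤ * ⟦ j ⟧ℤ
  *-homo (+ m) j = +*-homo m j
  *-homo -[1+ m ] j = begin
    ⟦ ℤ.- + suc m ℤ.* j ⟧ℤ ≡⟨ ≡.cong ⟦_⟧ℤ (ℤ.neg-distribˡ-* (+ suc m) j) ⟨
    ⟦ ℤ.- (+ suc m ℤ.* j) ⟧ℤ ≈⟨ -‿homo (+ suc m ℤ.* j) ⟩
    - ⟦ + suc m ℤ.* j ⟧ℤ ≈⟨ -‿cong (+*-homo (suc m) j) ⟩
    - (suc m · 1# * ⟦ j ⟧ℤ) ≈⟨ -‿distribˡ-* _ _ ⟩
    - (suc m · 1#) * ⟦ j ⟧ℤ ∎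

  homomorphism : ℤ.+-*-rawRing -Raw-AlmostCommutative⟶ fromCommutativeRing R
  homomorphism = record
    { ⟦_⟧    = ⟦_⟧ℤ
    ; +-homo = +-homo
    ; *-homo = *-homo
    ; -‿homo = -‿homo
    ; 0-homo = refl
    ; 1-homo = refl
    }

  decide : ∀ i j → Maybe (⟦ i ⟧ℤ ≈ ⟦ j ⟧ℤ)
  decide i j = Maybe.map (λ i≡j → reflexive (≡.cong ⟦_⟧ℤ i≡j)) (dec⇒maybe (i ℤ.≟ j))

  open RingSolver ℤ.+-*-rawRing (fromCommutativeRing R) homomorphism decide public
    using (solve; _:=_; _:+_; _:*_; :-_; con)

module Multiples {c ℓ} (R : CommutativeRing c ℓ) where
  open CommutativeRing R
  open SemiringMult semiring using (×-assoc-*; ×-congʳ) renaming (_×_ to _·_)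

  n·0≈0 : ∀ n → n · 0# ≈ 0#
  n·0≈0 zero    = refl
  n·0≈0 (suc n) = trans (+-identityˡ _) (n·0≈0 n)

  -- Lets the ring solver treat n · 1# as a variable.
  n·x≈[n·1]*x : ∀ n x → n · x ≈ n · 1# * x
  n·x≈[n·1]*x n x = sym (trans (×-assoc-* n 1# x) (×-congʳ n (*-identityˡ x)))

-- Polynomials

module PolynomialRing {c ℓ} (R : CommutativeRing c ℓ) where
  open CommutativeRing R hiding (_-_)
  open IntegerSolver R using (solve; _:=_; :-_; con)
  open Polynomials rawRing using (Poly; coeff; _≈ₚ_; _+ₚ_; _*ₚ_; const)

  infix 4 _≋_

  -- A record, so that the two polynomials can be inferred from a proof.
  record _≋_ (f g : Poly) : Set ℓ where
    constructor coeffwise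
    field
      at : f ≈ₚ g
  open _≋_ public

  -- A strict degree bound that also covers the zero polynomial. The length of the list would not
  -- do, because trailing zeros are allowed.
  Below : ℕ → Poly → Set ℓ
  Below n f = ∀ i → n ≤ i → coeff f i ≈ 0#

  coeff-+ : ∀ f g i → coeff (f +ₚ g) i ≈ coeff f i + coeff g i
  coeff-+ []      g       i       = sym (+-identityˡ _)
  coeff-+ (a ∷ f) []      i       = sym (+-identityʳ _)
  coeff-+ (a ∷ f) (b ∷ g) zero    = refl
  coeff-+ (a ∷ f) (b ∷ g) (suc i) = coeff-+ f g i

  coeff-scale : ∀ a f i → coeff (map (a *_) f) i ≈ a * coeff f i
  coeff-scale a []      i       = sym (zeroʳ a)
  coeff-scale a (b ∷ f) zero    = refl
  coeff-scale a (b ∷ f) (suc i) = coeff-scale a f i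

  coeff-neg : ∀ f i → coeff (map -_ f) i ≈ - coeff f i
  coeff-neg []      i       = solve 0 (con (ℤ.+ 0) := :- con (ℤ.+ 0)) refl

  coeff-neg (b ∷ f) zero    = refl
  coeff-neg (b ∷ f) (suc i) = coeff-neg f i

  ∷-cong : ∀ {a b f g} → a ≈ b → f ≋ g → (a ∷ f) ≋ (b ∷ g)
  ∷-cong p q .at zero    = p
  ∷-cong p q .at (suc i) = at q i

  tail-≋ : ∀ {a b f g} → (a ∷ f) ≋ (b ∷ g) → f ≋ g
  tail-≋ p .at i = at p (suc i)

  tail-≋[] : ∀ {a f} → (a ∷ f) ≋ [] → f ≋ []
  tail-≋[] p .at i = at p (suc i)

  0∷[]≋[] : (0# ∷ []) ≋ []
  0∷[]≋[] .at zero    = refl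
  0∷[]≋[] .at (suc i) = refl

  +ₚ-cong : ∀ {f f′ g g′} → f ≋ f′ → g ≋ g′ → (f +ₚ g) ≋ (f′ +ₚ g′)
  +ₚ-cong {f} {f′} {g} {g′} p q .at i =
    trans (coeff-+ f g i) (trans (+-cong (at p i) (at q i)) (sym (coeff-+ f′ g′ i)))

  +ₚ-assoc : ∀ f g h → ((f +ₚ g) +ₚ h) ≋ (f +ₚ (g +ₚ h))
  +ₚ-assoc f g h .at i =
    trans (trans (coeff-+ (f +ₚ g) h i) (+-congʳ (coeff-+ f g i)))
    (trans (+-assoc _ _ _)
    (sym (trans (coeff-+ f (g +ₚ h) i) (+-congˡ (coeff-+ g h i)))))

  +ₚ-comm : ∀ f g → (f +ₚ g) ≋ (g +ₚ f)
  +ₚ-comm f g .at i = trans (coeff-+ f g i) (trans (+-comm _ _) (sym (coeff-+ g f i)))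

  +ₚ-identityʳ : ∀ f → (f +ₚ []) ≋ f
  +ₚ-identityʳ f .at i = trans (coeff-+ f [] i) (+-identityʳ _)

  -ₚ-cong : ∀ {f g} → f ≋ g → map -_ f ≋ map -_ g
  -ₚ-cong {f} {g} p .at i = trans (coeff-neg f i) (trans (-‿cong (at p i)) (sym (coeff-neg g i)))

  -ₚ-inverseʳ : ∀ f → (f +ₚ map -_ f) ≋ []
  -ₚ-inverseʳ f .at i = trans (coeff-+ f _ i) (trans (+-congˡ (coeff-neg f i)) (-‿inverseʳ _))

  +ₚ-abelianGroup : AbelianGroup c ℓ
  +ₚ-abelianGroup = record
    { Carrier = Poly
    ; _≈_ = _≋_
    ; _∙_ = _+ₚ_
    ; ε   = []
    ; _⁻¹ = map -_
    ; isAbelianGroup = record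
      { isGroup = record
        { isMonoid = record
          { isSemigroup = record
            { isMagma = record
              { isEquivalence = record
                { refl  = coeffwise λ i → refl
                ; sym   = λ p → coeffwise λ i → sym (at p i)
                ; trans = λ p q → coeffwise λ i → trans (at p i) (at q i)
                }
              ; ∙-cong = +ₚ-cong
              }
            ; assoc = +ₚ-assoc
            }
          ; identity = (λ f → coeffwise λ i → refl) , +ₚ-identityʳ
          }
        ; inverse = (λ f → coeffwise λ i → trans (at (+ₚ-comm (map -_ f) f) i) (at (-ₚ-inverseʳ f) i)) , -ₚ-inverseʳ
        ; ⁻¹-cong = -ₚ-cong
        }
      ; comm = +ₚ-comm
      }
    }

  private module A = AbelianGroup +ₚ-abelianGroup
  open CommutativeSemigroupProperties A.commutativeSemigroup using (x∙yz≈y∙xz)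
  open CommutativeSemigroupProperties A.commutativeSemigroup using () renaming (interchange to +ₚ-interchange) public
  open SetoidReasoning A.setoid

  scale-cong : ∀ {a b f g} → a ≈ b → f ≋ g → map (a *_) f ≋ map (b *_) g
  scale-cong {a} {b} {f} {g} p q .at i =
    trans (coeff-scale a f i) (trans (*-cong p (at q i)) (sym (coeff-scale b g i)))

  scale-zero : ∀ {a} g → a ≈ 0# → map (a *_) g ≋ []
  scale-zero {a} g p .at i = trans (coeff-scale a g i) (trans (*-congʳ p) (zeroˡ _))

  scale-+ : ∀ a f g → map (a *_) (f +ₚ g) ≋ (map (a *_) f +ₚ map (a *_) g)
  scale-+ a f g .at i =
    trans (trans (coeff-scale a (f +ₚ g) i) (trans (*-congˡ (coeff-+ f g i)) (distribˡ _ _ _)))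
    (sym (trans (coeff-+ (map (a *_) f) _ i) (+-cong (coeff-scale a f i) (coeff-scale a g i))))

  +-scale : ∀ a b f → map ((a + b) *_) f ≋ (map (a *_) f +ₚ map (b *_) f)
  +-scale a b f .at i =
    trans (trans (coeff-scale (a + b) f i) (distribʳ _ _ _))
    (sym (trans (coeff-+ (map (a *_) f) _ i) (+-cong (coeff-scale a f i) (coeff-scale b f i))))

  scale-scale : ∀ a b f → map ((a * b) *_) f ≋ map (a *_) (map (b *_) f)
  scale-scale a b f .at i =
    trans (trans (coeff-scale (a * b) f i) (*-assoc _ _ _))
    (sym (trans (coeff-scale a (map (b *_) f) i) (*-congˡ (coeff-scale b f i))))

  shift-+ : ∀ f g → (0# ∷ (f +ₚ g)) ≋ ((0# ∷ f) +ₚ (0# ∷ g))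
  shift-+ f g = ∷-cong (sym (+-identityˡ 0#)) A.refl

  *ₚ-zeroʳ : ∀ f → (f *ₚ []) ≋ []
  *ₚ-zeroʳ []      = A.refl
  *ₚ-zeroʳ (a ∷ f) = A.trans (∷-cong refl (*ₚ-zeroʳ f)) 0∷[]≋[]

  ≋[]-*ₚ : ∀ f g → f ≋ [] → (f *ₚ g) ≋ []
  ≋[]-*ₚ []      g p = A.refl
  ≋[]-*ₚ (a ∷ f) g p = begin
    map (a *_) g +ₚ (0# ∷ (f *ₚ g))
      ≈⟨ +ₚ-cong (scale-zero g (at p 0)) (∷-cong refl (≋[]-*ₚ f g (tail-≋[] p))) ⟩
    [] +ₚ (0# ∷ []) ≈⟨ 0∷[]≋[] ⟩
    [] ∎

  *ₚ-congˡ : ∀ f {g g′} → g ≋ g′ → (f *ₚ g) ≋ (f *ₚ g′)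
  *ₚ-congˡ []      p = A.refl
  *ₚ-congˡ (a ∷ f) p = +ₚ-cong (scale-cong refl p) (∷-cong refl (*ₚ-congˡ f p))

  *ₚ-congʳ : ∀ f f′ g → f ≋ f′ → (f *ₚ g) ≋ (f′ *ₚ g)
  *ₚ-congʳ []      f′       g p = A.sym (≋[]-*ₚ f′ g (A.sym p))
  *ₚ-congʳ (a ∷ f) []       g p = ≋[]-*ₚ (a ∷ f) g p
  *ₚ-congʳ (a ∷ f) (b ∷ f′) g p =
    +ₚ-cong (scale-cong (at p 0) A.refl) (∷-cong refl (*ₚ-congʳ f f′ g (tail-≋ p)))

  *ₚ-cong : ∀ {f f′ g g′} → f ≋ f′ → g ≋ g′ → (f *ₚ g) ≋ (f′ *ₚ g′)
  *ₚ-cong {f} {f′} {g} p q = A.trans (*ₚ-congʳ f f′ g p) (*ₚ-congˡ f′ q)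

  *ₚ-distribʳ : ∀ h f g → ((f +ₚ g) *ₚ h) ≋ ((f *ₚ h) +ₚ (g *ₚ h))
  *ₚ-distribʳ h []      g       = A.refl
  *ₚ-distribʳ h (a ∷ f) []      = A.sym (+ₚ-identityʳ _)
  *ₚ-distribʳ h (a ∷ f) (b ∷ g) = begin
    map ((a + b) *_) h +ₚ (0# ∷ ((f +ₚ g) *ₚ h))
      ≈⟨ +ₚ-cong (+-scale a b h) (A.trans (∷-cong refl (*ₚ-distribʳ h f g)) (shift-+ (f *ₚ h) (g *ₚ h))) ⟩
    (map (a *_) h +ₚ map (b *_) h) +ₚ ((0# ∷ (f *ₚ h)) +ₚ (0# ∷ (g *ₚ h)))
      ≈⟨ +ₚ-interchange (map (a *_) h) (map (b *_) h) (0# ∷ (f *ₚ h)) (0# ∷ (g *ₚ h)) ⟩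
    (map (a *_) h +ₚ (0# ∷ (f *ₚ h))) +ₚ (map (b *_) h +ₚ (0# ∷ (g *ₚ h))) ∎

  -- The product recurses on its left factor; this is the mirrored recursion on the right factor,
  -- and the two together give commutativity by induction.
  *ₚ-∷ʳ : ∀ f b g → (f *ₚ (b ∷ g)) ≋ (map (b *_) f +ₚ (0# ∷ (f *ₚ g)))
  *ₚ-∷ʳ []      b g = A.sym 0∷[]≋[]
  *ₚ-∷ʳ (a ∷ f) b g = ∷-cong (+-congʳ (*-comm a b)) (begin
    map (a *_) g +ₚ (f *ₚ (b ∷ g)) ≈⟨ A.∙-congˡ (*ₚ-∷ʳ f b g) ⟩
    map (a *_) g +ₚ (map (b *_) f +ₚ (0# ∷ (f *ₚ g))) ≈⟨ x∙yz≈y∙xz (map (a *_) g) (map (b *_) f) (0# ∷ (f *ₚ g)) ⟩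
    map (b *_) f +ₚ (map (a *_) g +ₚ (0# ∷ (f *ₚ g))) ∎)

  *ₚ-comm : ∀ f g → (f *ₚ g) ≋ (g *ₚ f)
  *ₚ-comm []      g = A.sym (*ₚ-zeroʳ g)
  *ₚ-comm (a ∷ f) g = begin
    map (a *_) g +ₚ (0# ∷ (f *ₚ g)) ≈⟨ A.∙-congˡ (∷-cong refl (*ₚ-comm f g)) ⟩
    map (a *_) g +ₚ (0# ∷ (g *ₚ f)) ≈⟨ *ₚ-∷ʳ g a f ⟨
    g *ₚ (a ∷ f) ∎

  scale-*ₚ : ∀ a g h → (map (a *_) g *ₚ h) ≋ map (a *_) (g *ₚ h)
  scale-*ₚ a []      h = A.refl
  scale-*ₚ a (b ∷ g) h = begin
    map ((a * b) *_) h +ₚ (0# ∷ (map (a *_) g *ₚ h))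
      ≈⟨ +ₚ-cong (scale-scale a b h) (∷-cong (sym (zeroʳ a)) (scale-*ₚ a g h)) ⟩
    map (a *_) (map (b *_) h) +ₚ map (a *_) (0# ∷ (g *ₚ h))
      ≈⟨ scale-+ a (map (b *_) h) (0# ∷ (g *ₚ h)) ⟨
    map (a *_) (map (b *_) h +ₚ (0# ∷ (g *ₚ h))) ∎

  shift-*ₚ : ∀ f g → ((0# ∷ f) *ₚ g) ≋ (0# ∷ (f *ₚ g))
  shift-*ₚ f g = A.∙-congʳ (scale-zero g refl)

  *ₚ-assoc : ∀ f g h → ((f *ₚ g) *ₚ h) ≋ (f *ₚ (g *ₚ h))
  *ₚ-assoc []      g h = A.refl
  *ₚ-assoc (a ∷ f) g h = begin
    (map (a *_) g +ₚ (0# ∷ (f *ₚ g))) *ₚ h ≈⟨ *ₚ-distribʳ h (map (a *_) g) (0# ∷ (f *ₚ g)) ⟩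
    (map (a *_) g *ₚ h) +ₚ ((0# ∷ (f *ₚ g)) *ₚ h)
      ≈⟨ +ₚ-cong (scale-*ₚ a g h) (A.trans (shift-*ₚ (f *ₚ g) h) (∷-cong refl (*ₚ-assoc f g h))) ⟩
    map (a *_) (g *ₚ h) +ₚ (0# ∷ (f *ₚ (g *ₚ h))) ∎

  const-*ₚ : ∀ a f → (const a *ₚ f) ≋ map (a *_) f
  const-*ₚ a f = A.trans (A.∙-congˡ 0∷[]≋[]) (+ₚ-identityʳ _)

  *ₚ-identityˡ : ∀ f → (const 1# *ₚ f) ≋ f
  *ₚ-identityˡ f .at i = trans (at (const-*ₚ 1# f) i) (trans (coeff-scale 1# f i) (*-identityˡ _))

  *ₚ-identityʳ : ∀ f → (f *ₚ const 1#) ≋ f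
  *ₚ-identityʳ f = A.trans (*ₚ-comm f (const 1#)) (*ₚ-identityˡ f)

  *ₚ-distribˡ : ∀ h f g → (h *ₚ (f +ₚ g)) ≋ ((h *ₚ f) +ₚ (h *ₚ g))
  *ₚ-distribˡ h f g =
    A.trans (*ₚ-comm h (f +ₚ g))
    (A.trans (*ₚ-distribʳ h f g) (+ₚ-cong (*ₚ-comm f h) (*ₚ-comm g h)))

  polynomialRing : CommutativeRing c ℓ
  polynomialRing = record
    { Carrier = Poly
    ; _≈_ = _≋_
    ; _+_ = _+ₚ_
    ; _*_ = _*ₚ_
    ; -_  = map -_
    ; 0#  = []
    ; 1#  = const 1#
    ; isCommutativeRing = record
      { isRing = record
        { +-isAbelianGroup = A.isAbelianGroup
        ; *-cong     = *ₚ-cong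
        ; *-assoc    = *ₚ-assoc
        ; *-identity = *ₚ-identityˡ , *ₚ-identityʳ
        ; distrib    = *ₚ-distribˡ , *ₚ-distribʳ
        }
      ; *-comm = *ₚ-comm
      }
    }

  -- The same ring with the equality of Polynomials.rawRing.
  polynomialRing′ : CommutativeRing c ℓ
  polynomialRing′ = record
    { Carrier = Poly
    ; _≈_ = _≈ₚ_
    ; _+_ = _+ₚ_
    ; _*_ = _*ₚ_
    ; -_  = map -_
    ; 0#  = []
    ; 1#  = const 1#
    ; isCommutativeRing = record
      { isRing = record
        { +-isAbelianGroup = record
          { isGroup = record
            { isMonoid = record
              { isSemigroup = record
                { isMagma = record
                  { isEquivalence = record
                    { refl  = λ i → refl
                    ; sym   = λ p i → sym (p i)
                    ; trans = λ p q i → trans (p i) (q i)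
                    }
                  ; ∙-cong = λ {f} {f′} {g} {g′} p q → at (+ₚ-cong {f} {f′} {g} {g′} (coeffwise p) (coeffwise q))
                  }
                ; assoc = λ f g h → at (+ₚ-assoc f g h)
                }
              ; identity = (λ f i → refl) , (λ f → at (+ₚ-identityʳ f))
              }
            ; inverse = (λ f → at (A.inverseˡ f)) , (λ f → at (A.inverseʳ f))
            ; ⁻¹-cong = λ {f} {g} p → at (-ₚ-cong {f} {g} (coeffwise p))
            }
          ; comm = λ f g → at (+ₚ-comm f g)
          }
        ; *-cong     = λ {f} {f′} {g} {g′} p q → at (*ₚ-cong {f} {f′} {g} {g′} (coeffwise p) (coeffwise q))
        ; *-assoc    = λ f g h → at (*ₚ-assoc f g h)
        ; *-identity = (λ f → at (*ₚ-identityˡ f)) , (λ f → at (*ₚ-identityʳ f))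
        ; distrib    = (λ h f g → at (*ₚ-distribˡ h f g)) , (λ h f g → at (*ₚ-distribʳ h f g))
        }
      ; *-comm = λ f g → at (*ₚ-comm f g)
      }
    }

-- Evaluation and formal derivatives; homomorphisms and derivations at a point

module Evaluation {c ℓ} (K : CommutativeRing c ℓ) where
  open CommutativeRing K hiding (_-_)
  open IntegerSolver K using (solve; _:=_; _:+_; _:*_; :-_; con)
  open Polynomials rawRing
  open PolynomialRing K
  open SemiringExp semiring using (_^_)
  private
    module P = CommutativeRing polynomialRing
    module PE = SemiringExp P.semiring
  open SetoidReasoning setoid

  eval-cong : ∀ {f g} x → f ≋ g → eval f x ≈ eval g x
  eval-cong {[]}    {[]}    x p = refl
  eval-cong {[]}    {b ∷ g} x p = begin
    0# ≈⟨ trans (+-identityˡ _) (zeroʳ x) ⟨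
    0# + x * 0# ≈⟨ +-cong (at p 0) (*-congˡ (eval-cong {[]} {g} x (P.sym (tail-≋[] (P.sym p))))) ⟩
    b + x * eval g x ∎
  eval-cong {a ∷ f} {[]}    x p = begin
    a + x * eval f x ≈⟨ +-cong (at p 0) (*-congˡ (eval-cong {f} {[]} x (tail-≋[] p))) ⟩
    0# + x * 0# ≈⟨ trans (+-identityˡ _) (zeroʳ x) ⟩
    0# ∎
  eval-cong {a ∷ f} {b ∷ g} x p = +-cong (at p 0) (*-congˡ (eval-cong x (tail-≋ p)))

  eval-congʳ : ∀ f {x y} → x ≈ y → eval f x ≈ eval f y
  eval-congʳ []      p = refl
  eval-congʳ (a ∷ f) p = +-congˡ (*-cong p (eval-congʳ f p))

  eval-+ : ∀ f g x → eval (f +ₚ g) x ≈ eval f x + eval g x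
  eval-+ []      g       x = sym (+-identityˡ _)
  eval-+ (a ∷ f) []      x = sym (+-identityʳ _)
  eval-+ (a ∷ f) (b ∷ g) x = begin
    (a + b) + x * eval (f +ₚ g) x ≈⟨ +-congˡ (*-congˡ (eval-+ f g x)) ⟩
    (a + b) + x * (eval f x + eval g x) ≈⟨ solve 5 (λ a b x u v → (a :+ b) :+ x :* (u :+ v) := (a :+ x :* u) :+ (b :+ x :* v)) refl a b x (eval f x) (eval g x) ⟩
    (a + x * eval f x) + (b + x * eval g x) ∎

  eval-scale : ∀ a f x → eval (map (a *_) f) x ≈ a * eval f x
  eval-scale a []      x = sym (zeroʳ a)
  eval-scale a (b ∷ f) x = begin
    a * b + x * eval (map (a *_) f) x ≈⟨ +-congˡ (*-congˡ (eval-scale a f x)) ⟩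
    a * b + x * (a * eval f x) ≈⟨ solve 4 (λ a b x u → a :* b :+ x :* (a :* u) := a :* (b :+ x :* u)) refl a b x (eval f x) ⟩
    a * (b + x * eval f x) ∎

  eval-shift : ∀ f x → eval (0# ∷ f) x ≈ x * eval f x
  eval-shift f x = +-identityˡ _

  eval-* : ∀ f g x → eval (f *ₚ g) x ≈ eval f x * eval g x
  eval-* []      g x = sym (zeroˡ _)
  eval-* (a ∷ f) g x = begin
    eval (map (a *_) g +ₚ (0# ∷ (f *ₚ g))) x
      ≈⟨ trans (eval-+ (map (a *_) g) _ x) (+-cong (eval-scale a g x) (trans (eval-shift (f *ₚ g) x) (*-congˡ (eval-* f g x)))) ⟩
    a * eval g x + x * (eval f x * eval g x)
      ≈⟨ solve 4 (λ a x u v → a :* v :+ x :* (u :* v) := (a :+ x :* u) :* v) refl a x (eval f x) (eval g x) ⟩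
    (a + x * eval f x) * eval g x ∎

  eval-neg : ∀ f x → eval (map (-_) f) x ≈ - eval f x
  eval-neg []      x = solve 0 (con (ℤ.+ 0) := :- con (ℤ.+ 0)) refl

  eval-neg (a ∷ f) x = begin
    - a + x * eval (map (-_) f) x ≈⟨ +-congˡ (*-congˡ (eval-neg f x)) ⟩
    - a + x * (- eval f x) ≈⟨ solve 3 (λ a x u → :- a :+ x :* (:- u) := :- (a :+ x :* u)) refl a x (eval f x) ⟩
    - (a + x * eval f x) ∎

  eval-const : ∀ a x → eval (const a) x ≈ a
  eval-const a x = trans (+-congˡ (zeroʳ x)) (+-identityʳ a)

  eval-X : ∀ x → eval X x ≈ x
  eval-X x = trans (+-identityˡ _) (trans (*-congˡ (eval-const 1# x)) (*-identityʳ x))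

  eval-^ : ∀ f n x → eval (f PE.^ n) x ≈ eval f x ^ n
  eval-^ f zero    x = eval-const 1# x
  eval-^ f (suc n) x = trans (eval-* f (f PE.^ n) x) (*-congˡ (eval-^ f n x))

  derivative-+ : ∀ f g → derivative (f +ₚ g) ≋ (derivative f +ₚ derivative g)
  derivative-+ []      g       = P.refl
  derivative-+ (a ∷ f) []      = P.sym (P.+-identityʳ _)
  derivative-+ (a ∷ f) (b ∷ g) = P.trans
    (P.+-congˡ {f +ₚ g} (P.trans (∷-cong refl (derivative-+ f g)) (shift-+ (derivative f) (derivative g))))
    (+ₚ-interchange f g (0# ∷ derivative f) (0# ∷ derivative g))

  derivative-≋[] : ∀ f → f ≋ [] → derivative f ≋ []
  derivative-≋[] []      p = P.refl
  derivative-≋[] (a ∷ f) p = P.trans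
    (P.+-cong {f} {[]} (tail-≋[] p) (∷-cong refl (derivative-≋[] f (tail-≋[] p))))
    0∷[]≋[]

  derivative-cong : ∀ {f g} → f ≋ g → derivative f ≋ derivative g
  derivative-cong {[]}    {g}     p = P.sym (derivative-≋[] g (P.sym p))
  derivative-cong {a ∷ f} {[]}    p = derivative-≋[] (a ∷ f) p
  derivative-cong {a ∷ f} {b ∷ g} p =
    P.+-cong (tail-≋ p) (∷-cong refl (derivative-cong (tail-≋ p)))

  derivative-scale : ∀ a f → derivative (map (a *_) f) ≋ map (a *_) (derivative f)
  derivative-scale a []      = P.refl
  derivative-scale a (b ∷ f) = P.trans
    (P.+-congˡ {map (a *_) f} (∷-cong (sym (zeroʳ a)) (derivative-scale a f)))
    (P.sym (scale-+ a f (0# ∷ derivative f)))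

  derivative-neg : ∀ f → derivative (map (-_) f) ≋ map (-_) (derivative f)
  derivative-neg f = inverseʳ-unique (derivative f) (derivative (map (-_) f))
    (P.trans (P.sym (derivative-+ f (map (-_) f))) (derivative-cong (P.-‿inverseʳ f)))
    where open import Algebra.Properties.Group P.+-group using (inverseʳ-unique)

  derivative-* : ∀ f g → derivative (f *ₚ g) ≋ ((derivative f *ₚ g) +ₚ (f *ₚ derivative g))
  derivative-* []      g = P.refl
  derivative-* (a ∷ f) g = PR.begin
    derivative (map (a *_) g +ₚ (0# ∷ (f *ₚ g)))
      PR.≈⟨ derivative-+ (map (a *_) g) (0# ∷ (f *ₚ g)) ⟩
    derivative (map (a *_) g) +ₚ ((f *ₚ g) +ₚ (0# ∷ derivative (f *ₚ g)))
      PR.≈⟨ P.+-cong (derivative-scale a g) (P.+-congˡ {f *ₚ g} (P.trans (∷-cong refl (derivative-* f g)) (shift-+ (derivative f *ₚ g) (f *ₚ derivative g)))) ⟩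
    map (a *_) (derivative g) +ₚ ((f *ₚ g) +ₚ ((0# ∷ (derivative f *ₚ g)) +ₚ (0# ∷ (f *ₚ derivative g))))
      PR.≈⟨ PS.solve 4 (λ u v w t → u PS.:+ (v PS.:+ (w PS.:+ t)) PS.:= (v PS.:+ w) PS.:+ (u PS.:+ t)) P.refl (map (a *_) (derivative g)) (f *ₚ g) (0# ∷ (derivative f *ₚ g)) (0# ∷ (f *ₚ derivative g)) ⟩
    ((f *ₚ g) +ₚ (0# ∷ (derivative f *ₚ g))) +ₚ ((a ∷ f) *ₚ derivative g)
      PR.≈⟨ P.+-congʳ (P.+-congˡ {f *ₚ g} (shift-*ₚ (derivative f) g)) ⟨
    ((f *ₚ g) +ₚ ((0# ∷ derivative f) *ₚ g)) +ₚ ((a ∷ f) *ₚ derivative g)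
      PR.≈⟨ P.+-congʳ (*ₚ-distribʳ g f (0# ∷ derivative f)) ⟨
    ((f +ₚ (0# ∷ derivative f)) *ₚ g) +ₚ ((a ∷ f) *ₚ derivative g) PR.∎
    where
    module PS = IntegerSolver polynomialRing
    module PR = SetoidReasoning P.setoid

-- R is only a raw ring, which allows it to be a ring of polynomials in
-- several variables.
record RawHom {c ℓ c′ ℓ′} (R : RawRing c ℓ) (K : CommutativeRing c′ ℓ′) : Set (c ⊔ ℓ ⊔ c′ ⊔ ℓ′) where
  private
    module R = RawRing R
  open CommutativeRing K hiding (_-_)
  field
    φ      : R.Carrier → Carrier
    φ-0    : φ R.0# ≈ 0#
    φ-1    : φ R.1# ≈ 1#
    φ-+    : ∀ a b → φ (a R.+ b) ≈ φ a + φ b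
    φ-*    : ∀ a b → φ (a R.* b) ≈ φ a * φ b
    φ-neg  : ∀ a → φ (R.- a) ≈ - φ a

module RawHomProperties {c ℓ c′ ℓ′} {R : RawRing c ℓ} (K : CommutativeRing c′ ℓ′) (Φ : RawHom R K) where
  open RawHom Φ
  open CommutativeRing K hiding (_-_)
  open PolynomialRing K
  open Evaluation K
  private
    module R = RawRing R
    module R[X] = Polynomials R
    module K[X] = Polynomials rawRing
    module P = CommutativeRing polynomialRing
  open K[X] using (_+ₚ_; _*ₚ_; eval; derivative)
  open SemiringExp semiring using (_^_)
  import Algebra.Definitions.RawSemiring (RawRing.rawSemiring R) as RD
  import Algebra.Definitions.RawSemiring (RawRing.rawSemiring R[X].rawRing) as R[X]D
  open SemiringExp P.semiring using () renaming (_^_ to _^ₚ_)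

  φ-^ : ∀ a n → φ (a RD.^ n) ≈ φ a ^ n
  φ-^ a zero    = φ-1
  φ-^ a (suc n) = trans (φ-* a _) (*-congˡ (φ-^ a n))

  coeff-map : ∀ f i → K[X].coeff (map φ f) i ≈ φ (R[X].coeff f i)
  coeff-map []      i       = sym φ-0
  coeff-map (a ∷ f) zero    = refl
  coeff-map (a ∷ f) (suc i) = coeff-map f i

  map-+ : ∀ f g → map φ (f R[X].+ₚ g) ≋ (map φ f +ₚ map φ g)
  map-+ []      g       = P.refl
  map-+ (a ∷ f) []      = P.refl
  map-+ (a ∷ f) (b ∷ g) = ∷-cong (φ-+ a b) (map-+ f g)

  map-scale : ∀ a f → map φ (map (a R.*_) f) ≋ map (φ a *_) (map φ f)
  map-scale a []      = P.refl
  map-scale a (b ∷ f) = ∷-cong (φ-* a b) (map-scale a f)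

  map-* : ∀ f g → map φ (f R[X].*ₚ g) ≋ (map φ f *ₚ map φ g)
  map-* []      g = P.refl
  map-* (a ∷ f) g = P.trans (map-+ (map (a R.*_) g) _) (P.+-cong (map-scale a g) (∷-cong φ-0 (map-* f g)))

  map-neg : ∀ f → map φ (map (R.-_) f) ≋ map (-_) (map φ f)
  map-neg []      = P.refl
  map-neg (a ∷ f) = ∷-cong (φ-neg a) (map-neg f)

  map-1 : map φ (R[X].const R.1#) ≋ K[X].const 1#
  map-1 = ∷-cong φ-1 P.refl

  map-^ : ∀ f n → map φ (f R[X]D.^ n) ≋ (map φ f ^ₚ n)
  map-^ f zero    = map-1
  map-^ f (suc n) = P.trans (map-* f (f R[X]D.^ n)) (*ₚ-congˡ (map φ f) (map-^ f n))

  map-derivative : ∀ f → map φ (R[X].derivative f) ≋ derivative (map φ f)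
  map-derivative []      = P.refl
  map-derivative (a ∷ f) = P.trans (map-+ f _) (P.+-congˡ {map φ f} (∷-cong φ-0 (map-derivative f)))

  φ-eval : ∀ f r → φ (R[X].eval f r) ≈ eval (map φ f) (φ r)
  φ-eval []      r = φ-0
  φ-eval (a ∷ f) r = trans (φ-+ a _) (+-congˡ (trans (φ-* r _) (*-congˡ (φ-eval f r))))

  -- Substitution of κ for the variable. Iterated three times from the identity of K, it evaluates a
  -- form in three variables at a point.
  evalHom : Carrier → RawHom R[X].rawRing K
  evalHom κ = record
    { φ     = λ f → eval (map φ f) κ
    ; φ-0   = refl
    ; φ-1   = trans (eval-const _ κ) φ-1
    ; φ-+   = λ f g → trans (eval-cong κ (map-+ f g)) (eval-+ (map φ f) (map φ g) κ)
    ; φ-*   = λ f g → trans (eval-cong κ (map-* f g)) (eval-* (map φ f) (map φ g) κ)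
    ; φ-neg = λ f → trans (eval-cong κ (map-neg f)) (eval-neg (map φ f) κ)
    }

  evalHom-const : ∀ a κ → eval (map φ (R[X].const a)) κ ≈ φ a
  evalHom-const a κ = eval-const (φ a) κ

  evalHom-X : ∀ κ → eval (map φ R[X].X) κ ≈ κ
  evalHom-X κ = trans (eval-cong κ (∷-cong φ-0 map-1)) (eval-X κ)

  -- A derivation along `φ`: the ε-part of a homomorphism a ↦ φ a + ε D a into the dual numbers over
  -- K.
  record PointDerivation : Set (c ⊔ c′ ⊔ ℓ′) where
    field
      D      : R.Carrier → Carrier
      D-0    : D R.0# ≈ 0#
      D-1    : D R.1# ≈ 0#
      D-+    : ∀ a b → D (a R.+ b) ≈ D a + D b
      D-*    : ∀ a b → D (a R.* b) ≈ D a * φ b + φ a * D b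
      D-neg  : ∀ a → D (R.- a) ≈ - D a

module PointDerivationProperties {c ℓ c′ ℓ′} {R : RawRing c ℓ} (K : CommutativeRing c′ ℓ′) (Φ : RawHom R K)
  (Δ : RawHomProperties.PointDerivation K Φ) where
  open RawHom Φ
  open RawHomProperties K Φ
  open PointDerivation Δ
  open CommutativeRing K hiding (_-_)
  open IntegerSolver K using (solve; _:=_; _:+_; _:*_; :-_; con)
  open PolynomialRing K
  open Evaluation K
  private
    module R = RawRing R
    module R[X] = Polynomials R
    module P = CommutativeRing polynomialRing
  open Polynomials rawRing using (_+ₚ_; _*ₚ_; eval; derivative)
  open SemiringExp semiring using (_^_)
  open SemiringMult semiring using () renaming (_×_ to _·_)
  import Algebra.Definitions.RawSemiring (RawRing.rawSemiring R) as RD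
  open SetoidReasoning setoid

  D-^ : ∀ a n → D (a RD.^ suc n) ≈ (suc n · (φ a ^ n)) * D a
  D-^ a zero = begin
    D (a R.* R.1#) ≈⟨ D-* a R.1# ⟩
    D a * φ R.1# + φ a * D R.1# ≈⟨ +-cong (*-congˡ φ-1) (*-congˡ D-1) ⟩
    D a * 1# + φ a * 0# ≈⟨ solve 2 (λ d u → d :* con (ℤ.+ 1) :+ u :* con (ℤ.+ 0) := (con (ℤ.+ 1) :+ con (ℤ.+ 0)) :* d) refl (D a) (φ a) ⟩
    (1# + 0#) * D a ∎

  D-^ a (suc n) = begin
    D (a R.* (a RD.^ suc n))
      ≈⟨ D-* a _ ⟩
    D a * φ (a RD.^ suc n) + φ a * D (a RD.^ suc n)
      ≈⟨ +-cong (*-congˡ (φ-^ a (suc n))) (*-congˡ (D-^ a n)) ⟩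
    D a * φ a ^ suc n + φ a * (suc n · (φ a ^ n) * D a)
      ≈⟨ solve 4 (λ d u v w → d :* v :+ u :* (w :* d) := (v :+ u :* w) :* d) refl (D a) (φ a) (φ a ^ suc n) (suc n · (φ a ^ n)) ⟩
    (φ a ^ suc n + φ a * (suc n · (φ a ^ n))) * D a
      ≈⟨ *-congʳ (+-congˡ (×-comm-* (suc n) (φ a) (φ a ^ n))) ⟩
    (suc (suc n) · (φ a ^ suc n)) * D a ∎
    where open SemiringMult semiring using (×-comm-*)

  mapD-+ : ∀ f g → map D (f R[X].+ₚ g) ≋ (map D f +ₚ map D g)
  mapD-+ []      g       = P.refl
  mapD-+ (a ∷ f) []      = P.refl
  mapD-+ (a ∷ f) (b ∷ g) = ∷-cong (D-+ a b) (mapD-+ f g)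

  mapD-neg : ∀ f → map D (map (R.-_) f) ≋ map (-_) (map D f)
  mapD-neg []      = P.refl
  mapD-neg (a ∷ f) = ∷-cong (D-neg a) (mapD-neg f)

  mapD-scale : ∀ a f → map D (map (a R.*_) f) ≋ (map (D a *_) (map φ f) +ₚ map (φ a *_) (map D f))
  mapD-scale a []      = P.refl
  mapD-scale a (b ∷ f) = ∷-cong (D-* a b) (mapD-scale a f)

  mapD-* : ∀ f g → map D (f R[X].*ₚ g) ≋ ((map D f *ₚ map φ g) +ₚ (map φ f *ₚ map D g))
  mapD-* []      g = P.refl
  mapD-* (a ∷ f) g = P.trans (mapD-+ (map (a R.*_) g) (R.0# ∷ (f R[X].*ₚ g)))
    (P.trans (P.+-cong (mapD-scale a g) (P.trans (∷-cong D-0 (mapD-* f g)) (shift-+ (map D f *ₚ map φ g) (map φ f *ₚ map D g))))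
      (+ₚ-interchange (map (D a *_) (map φ g)) (map (φ a *_) (map D g)) (0# ∷ (map D f *ₚ map φ g)) (0# ∷ (map φ f *ₚ map D g))))

  -- In terms of dual numbers, the variable is sent to κ + ε κ′: the coefficients contribute through
  -- `D`, and the variable contributes κ′ times the formal derivative.
  evalDerivation : ∀ κ → Carrier → RawHomProperties.PointDerivation K (evalHom κ)
  evalDerivation κ κ′ = record
    { D     = D′
    ; D-0   = trans (+-congˡ (zeroʳ κ′)) (+-identityˡ 0#)
    ; D-1   = begin
        eval (D R.1# ∷ []) κ + κ′ * eval (0# ∷ []) κ
          ≈⟨ +-cong (trans (eval-const _ κ) D-1) (*-congˡ (eval-const 0# κ)) ⟩
        0# + κ′ * 0#
          ≈⟨ trans (+-congˡ (zeroʳ κ′)) (+-identityˡ 0#) ⟩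
        0# ∎
    ; D-+   = λ f g → begin
        eval (map D (f R[X].+ₚ g)) κ + κ′ * eval (derivative (map φ (f R[X].+ₚ g))) κ
          ≈⟨ +-cong (trans (eval-cong κ (mapD-+ f g)) (eval-+ (map D f) (map D g) κ))
               (*-congˡ (trans (eval-cong κ (P.trans (derivative-cong (map-+ f g)) (derivative-+ (map φ f) (map φ g))))
                               (eval-+ (derivative (map φ f)) (derivative (map φ g)) κ))) ⟩
        (eval (map D f) κ + eval (map D g) κ) + κ′ * (eval (derivative (map φ f)) κ + eval (derivative (map φ g)) κ)
          ≈⟨ solve 5 (λ a b k u v → (a :+ b) :+ k :* (u :+ v) := (a :+ k :* u) :+ (b :+ k :* v)) refl _ _ _ _ _ ⟩
        D′ f + D′ g ∎
    ; D-*   = λ f g → begin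
        eval (map D (f R[X].*ₚ g)) κ + κ′ * eval (derivative (map φ (f R[X].*ₚ g))) κ
          ≈⟨ +-cong (trans (eval-cong κ (mapD-* f g)) (eval-leibniz (map D f) (map φ g) (map φ f) (map D g)))
               (*-congˡ (trans (eval-cong κ (P.trans (derivative-cong (map-* f g)) (derivative-* (map φ f) (map φ g))))
                               (eval-leibniz (derivative (map φ f)) (map φ g) (map φ f) (derivative (map φ g))))) ⟩
        (eval (map D f) κ * eval (map φ g) κ + eval (map φ f) κ * eval (map D g) κ)
          + κ′ * (eval (derivative (map φ f)) κ * eval (map φ g) κ + eval (map φ f) κ * eval (derivative (map φ g)) κ)
          ≈⟨ solve 7 (λ a b c d k u v → (a :* b :+ c :* d) :+ k :* (u :* b :+ c :* v) := (a :+ k :* u) :* b :+ c :* (d :+ k :* v)) refl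
               (eval (map D f) κ) (eval (map φ g) κ) (eval (map φ f) κ) (eval (map D g) κ) κ′ (eval (derivative (map φ f)) κ) (eval (derivative (map φ g)) κ) ⟩
        D′ f * eval (map φ g) κ + eval (map φ f) κ * D′ g ∎
    ; D-neg = λ f → begin
        eval (map D (map (R.-_) f)) κ + κ′ * eval (derivative (map φ (map (R.-_) f))) κ
          ≈⟨ +-cong (trans (eval-cong κ (mapD-neg f)) (eval-neg (map D f) κ))
               (*-congˡ (trans (eval-cong κ (P.trans (derivative-cong (map-neg f)) (derivative-neg (map φ f))))
                               (eval-neg (derivative (map φ f)) κ))) ⟩
        - eval (map D f) κ + κ′ * (- eval (derivative (map φ f)) κ)
          ≈⟨ solve 3 (λ a k u → :- a :+ k :* (:- u) := :- (a :+ k :* u)) refl _ _ _ ⟩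
        - D′ f ∎
    }
    where
    D′ : R[X].Poly → Carrier
    D′ f = eval (map D f) κ + κ′ * eval (derivative (map φ f)) κ

    eval-leibniz : ∀ f g h k → eval ((f *ₚ g) +ₚ (h *ₚ k)) κ ≈ eval f κ * eval g κ + eval h κ * eval k κ
    eval-leibniz f g h k = trans (eval-+ (f *ₚ g) (h *ₚ k) κ) (+-cong (eval-* f g κ) (eval-* h k κ))

  evalDerivation-const : ∀ a κ κ′ → eval (map D (R[X].const a)) κ + κ′ * eval (derivative (map φ (R[X].const a))) κ ≈ D a
  evalDerivation-const a κ κ′ = trans (+-cong (eval-const _ κ) (trans (*-congˡ (eval-const 0# κ)) (zeroʳ κ′))) (+-identityʳ _)

  evalDerivation-X : ∀ κ κ′ → eval (map D R[X].X) κ + κ′ * eval (derivative (map φ R[X].X)) κ ≈ κ′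
  evalDerivation-X κ κ′ = begin
    eval (map D R[X].X) κ + κ′ * eval (derivative (map φ R[X].X)) κ
      ≈⟨ +-cong (eval-cong κ (P.trans (∷-cong D-0 (P.trans (∷-cong D-1 P.refl) 0∷[]≋[])) 0∷[]≋[]))
           (*-congˡ (eval-cong κ (derivative-cong (∷-cong φ-0 map-1)))) ⟩
    0# + κ′ * ((1# + 0#) + κ * (0# + κ * 0#))
      ≈⟨ solve 2 (λ κ κ′ → con (+ 0) :+ κ′ :* ((con (+ 1) :+ con (+ 0)) :+ κ :* (con (+ 0) :+ κ :* con (+ 0))) := κ′) refl κ κ′ ⟩
    κ′ ∎

-- Derivatives of homogenised equations

module CurveDerivation {c ℓ} (K : Field c ℓ) where
  open Field K hiding (_-_)
  open Multiples commutativeRing using (n·0≈0)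
  open IntegerSolver commutativeRing using (solve; _:=_; _:+_; _:*_; :-_; con)
  open PolynomialRing commutativeRing
  open Evaluation commutativeRing
  open PlaneCurves K
  open K[x] using (eval; derivative; const; coeff)
  open SemiringExp semiring using (_^_; ^-congˡ)
  open SemiringMult semiring using (×-comm-*; ×-assoc-*; ×-congʳ) renaming (_×_ to _·_)
  open SetoidReasoning setoid
  private
    module P = CommutativeRing polynomialRing

  idHom : RawHom rawRing commutativeRing
  idHom = record
    { φ = id ; φ-0 = refl ; φ-1 = refl
    ; φ-+ = λ _ _ → refl ; φ-* = λ _ _ → refl ; φ-neg = λ _ → refl }

  zeroDerivation : RawHomProperties.PointDerivation commutativeRing idHom
  zeroDerivation = record
    { D     = λ _ → 0#
    ; D-0   = refl
    ; D-1   = refl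
    ; D-+   = λ _ _ → sym (+-identityˡ 0#)
    ; D-*   = λ a b → solve 2 (λ a b → con (+ 0) := con (+ 0) :* b :+ a :* con (+ 0)) refl a b
    ; D-neg = λ _ → solve 0 (con (+ 0) := :- con (+ 0)) refl
    }

  eval-map-scale : ∀ {a} {A : Set a} {D α : A → Carrier} u → (∀ a → D a ≈ u * α a) →
                   ∀ l κ → eval (map D l) κ ≈ u * eval (map α l) κ
  eval-map-scale u p []      κ = sym (zeroʳ u)
  eval-map-scale {D = D} {α} u p (a ∷ l) κ = begin
    D a + κ * eval (map D l) κ ≈⟨ +-cong (p a) (*-congˡ (eval-map-scale u p l κ)) ⟩
    u * α a + κ * (u * eval (map α l) κ) ≈⟨ solve 4 (λ u a k e → u :* a :+ k :* (u :* e) := u :* (a :+ k :* e)) refl u (α a) κ _ ⟩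
    u * (α a + κ * eval (map α l) κ) ∎

  eval-map-linear : ∀ {a} {A : Set a} {D α β : A → Carrier} u v → (∀ a → D a ≈ u * α a + v * β a) →
                    ∀ l κ → eval (map D l) κ ≈ u * eval (map α l) κ + v * eval (map β l) κ
  eval-map-linear u v p [] κ = solve 2 (λ u v → con (+ 0) := u :* con (+ 0) :+ v :* con (+ 0)) refl u v
  eval-map-linear {D = D} {α} {β} u v p (a ∷ l) κ = begin
    D a + κ * eval (map D l) κ
      ≈⟨ +-cong (p a) (*-congˡ (eval-map-linear u v p l κ)) ⟩
    (u * α a + v * β a) + κ * (u * eval (map α l) κ + v * eval (map β l) κ)
      ≈⟨ solve 7 (λ u a v b k e f → (u :* a :+ v :* b) :+ k :* (u :* e :+ v :* f) := u :* (a :+ k :* e) :+ v :* (b :+ k :* f)) refl u (α a) v (β a) κ _ _ ⟩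
    u * (α a + κ * eval (map α l) κ) + v * (β a + κ * eval (map β l) κ) ∎

  module AtPoint (x y z dx dy dz : Carrier) where
    module H₀ = RawHomProperties commutativeRing idHom
    Φ₁ : RawHom K[x].rawRing commutativeRing
    Φ₁ = H₀.evalHom x
    module H₁ = RawHomProperties commutativeRing Φ₁
    Φ₂ : RawHom K[x][y].rawRing commutativeRing
    Φ₂ = H₁.evalHom y
    module H₂ = RawHomProperties commutativeRing Φ₂
    Φ₃ : RawHom K[x][y][z].rawRing commutativeRing
    Φ₃ = H₂.evalHom z
    module H₃ = RawHomProperties commutativeRing Φ₃

    Δ₁ : H₁.PointDerivation
    Δ₁ = PointDerivationProperties.evalDerivation commutativeRing idHom zeroDerivation x dx
    Δ₂ : H₂.PointDerivation
    Δ₂ = PointDerivationProperties.evalDerivation commutativeRing Φ₁ Δ₁ y dy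
    Δ₃ : H₃.PointDerivation
    Δ₃ = PointDerivationProperties.evalDerivation commutativeRing Φ₂ Δ₂ z dz

    open RawHom Φ₁ using () renaming (φ to φ₁)
    open RawHom Φ₂ using () renaming (φ to φ₂)
    open RawHom Φ₃ using (φ; φ-0; φ-+; φ-*; φ-neg)
    open H₁.PointDerivation Δ₁ using () renaming (D to D₁)
    open H₂.PointDerivation Δ₂ using () renaming (D to D₂)
    open H₃.PointDerivation Δ₃ using (D; D-0; D-+; D-*; D-neg)

    φ₁≈eval : ∀ f → φ₁ f ≈ eval f x
    φ₁≈eval f = reflexive (≡.cong (λ g → eval g x) (map-id f))

    φ₁-const : ∀ a → φ₁ (const a) ≈ a
    φ₁-const a = eval-const a x

    φ₂≈eval : ∀ f → φ₂ f ≈ eval (K[x][y].eval f (const y)) x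
    φ₂≈eval f = begin
      eval (map φ₁ f) y ≈⟨ eval-congʳ (map φ₁ f) (φ₁-const y) ⟨
      eval (map φ₁ f) (φ₁ (const y)) ≈⟨ H₁.φ-eval f (const y) ⟨
      φ₁ (K[x][y].eval f (const y)) ≈⟨ φ₁≈eval (K[x][y].eval f (const y)) ⟩
      eval (K[x][y].eval f (const y)) x ∎

    φ₂-const : ∀ f → φ₂ (K[x][y].const f) ≈ φ₁ f
    φ₂-const f = eval-const _ y

    φ≈eval₃ : ∀ H → φ H ≈ eval₃ H x y z
    φ≈eval₃ H = begin
      eval (map φ₂ H) z ≈⟨ eval-congʳ (map φ₂ H) (trans (φ₂-const (const z)) (φ₁-const z)) ⟨
      eval (map φ₂ H) (φ₂ (K[x][y].const (const z))) ≈⟨ H₂.φ-eval H _ ⟨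
      φ₂ (K[x][y][z].eval H (K[x][y].const (const z))) ≈⟨ φ₂≈eval (K[x][y][z].eval H (K[x][y].const (const z))) ⟩
      eval₃ H x y z ∎

    D₁≈ : ∀ f → D₁ f ≈ dx * φ₁ (derivative f)
    D₁≈ f = begin
      eval (map (λ _ → 0#) f) x + dx * eval (derivative (map id f)) x
        ≈⟨ +-congʳ (trans (eval-map-scale {α = id} 0# (λ a → sym (zeroˡ a)) f x) (zeroˡ _)) ⟩
      0# + dx * eval (derivative (map id f)) x
        ≈⟨ +-identityˡ _ ⟩
      dx * eval (derivative (map id f)) x
        ≈⟨ *-congˡ (eval-cong x (H₀.map-derivative f)) ⟨
      dx * φ₁ (derivative f) ∎

    D₂≈ : ∀ f → D₂ f ≈ dx * φ₂ (map derivative f) + dy * φ₂ (K[x][y].derivative f)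
    D₂≈ f = begin
      eval (map D₁ f) y + dy * eval (derivative (map φ₁ f)) y
        ≈⟨ +-cong (eval-map-scale dx D₁≈ f y) (*-congˡ (sym (eval-cong y (H₁.map-derivative f)))) ⟩
      dx * eval (map (φ₁ ∘ derivative) f) y + dy * φ₂ (K[x][y].derivative f)
        ≡⟨ ≡.cong (λ g → dx * eval g y + dy * φ₂ (K[x][y].derivative f)) (map-∘ f) ⟩
      dx * φ₂ (map derivative f) + dy * φ₂ (K[x][y].derivative f) ∎

    -- The gradient paired with the direction. For the direction (x^q, y^q, z^q) the right-hand side
    -- is the expression in `FrobeniusNonclassical`, so that the condition at a point becomes D H =
    -- 0.
    D≈ : ∀ H → D H ≈ eval₃ (∂X H) x y z * dx + eval₃ (∂Y H) x y z * dy + eval₃ (∂Z H) x y z * dz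
    D≈ H = begin
      eval (map D₂ H) z + dz * eval (derivative (map φ₂ H)) z
        ≈⟨ +-cong (eval-map-linear dx dy D₂≈ H z) (*-congˡ (sym (eval-cong z (H₂.map-derivative H)))) ⟩
      (dx * eval (map (φ₂ ∘ map derivative) H) z + dy * eval (map (φ₂ ∘ K[x][y].derivative) H) z) + dz * φ (∂Z H)
        ≡⟨ ≡.cong₂ (λ g h → (dx * eval g z + dy * eval h z) + dz * φ (∂Z H)) (map-∘ H) (map-∘ H) ⟩
      (dx * φ (∂X H) + dy * φ (∂Y H)) + dz * φ (∂Z H)
        ≈⟨ +-cong (+-cong (swap (∂X H) dx) (swap (∂Y H) dy)) (swap (∂Z H) dz) ⟩
      eval₃ (∂X H) x y z * dx + eval₃ (∂Y H) x y z * dy + eval₃ (∂Z H) x y z * dz ∎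
      where
      swap : ∀ H t → t * φ H ≈ eval₃ H x y z * t
      swap H t = trans (*-comm t _) (*-congʳ (φ≈eval₃ H))

    φ-varX : φ varX ≈ x
    φ-varX = trans (H₂.evalHom-const (K[x][y].const K[x].X) z) (trans (H₁.evalHom-const K[x].X y) (H₀.evalHom-X x))
    φ-varY : φ varY ≈ y
    φ-varY = trans (H₂.evalHom-const K[x][y].X z) (H₁.evalHom-X y)
    φ-varZ : φ varZ ≈ z
    φ-varZ = H₂.evalHom-X z

    scalar : Carrier → Form
    scalar a = K[x][y][z].const (K[x][y].const (const a))

    φ-scalar : ∀ a → φ (scalar a) ≈ a
    φ-scalar a = trans (H₂.evalHom-const (K[x][y].const (const a)) z) (trans (H₁.evalHom-const (const a) y) (H₀.evalHom-const a x))

    private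
      module D₀ = PointDerivationProperties commutativeRing idHom zeroDerivation
      module D₁ = PointDerivationProperties commutativeRing Φ₁ Δ₁
      module D₂ = PointDerivationProperties commutativeRing Φ₂ Δ₂
      module D₃ = PointDerivationProperties commutativeRing Φ₃ Δ₃

    D-varX : D varX ≈ dx
    D-varX = trans (D₂.evalDerivation-const (K[x][y].const K[x].X) z dz) (trans (D₁.evalDerivation-const K[x].X y dy) (D₀.evalDerivation-X x dx))
    D-varY : D varY ≈ dy
    D-varY = trans (D₂.evalDerivation-const K[x][y].X z dz) (D₁.evalDerivation-X y dy)
    D-varZ : D varZ ≈ dz
    D-varZ = D₂.evalDerivation-X z dz

    D-scalar : ∀ a → D (scalar a) ≈ 0#
    D-scalar a = trans (D₂.evalDerivation-const (K[x][y].const (const a)) z dz) (trans (D₁.evalDerivation-const (const a) y dy) (D₀.evalDerivation-const a x dx))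

    open RawRing K[x][y][z].rawRing using () renaming (_*_ to _*₃_; 1# to 1₃)
    open SemiringRaw (RawRing.rawSemiring K[x][y][z].rawRing) using () renaming (_^_ to _^₃_)

    φ-varY^varZ^ : ∀ d j → φ (varY ^₃ d *₃ varZ ^₃ j) ≈ y ^ d * z ^ j
    φ-varY^varZ^ d j = trans (φ-* (varY ^₃ d) (varZ ^₃ j))
      (*-cong (trans (H₃.φ-^ varY d) (^-congˡ d φ-varY)) (trans (H₃.φ-^ varZ j) (^-congˡ j φ-varZ)))

    φ-homogenise-∷ : ∀ M a f → φ (homogenise M (a ∷ f)) ≈ a * z ^ M + x * φ (homogenise (M ∸ 1) f)
    φ-homogenise-∷ M a f = trans (φ-+ (scalar a *₃ varZ ^₃ M) (varX *₃ homogenise (M ∸ 1) f)) (+-cong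
      (trans (φ-* (scalar a) (varZ ^₃ M)) (*-cong (φ-scalar a) (trans (H₃.φ-^ varZ M) (^-congˡ M φ-varZ))))
      (trans (φ-* varX (homogenise (M ∸ 1) f)) (*-congʳ φ-varX)))

    D-homogenise-∷ : ∀ M a f → D (homogenise M (a ∷ f)) ≈
                     a * D (varZ ^₃ M) + (dx * φ (homogenise (M ∸ 1) f) + x * D (homogenise (M ∸ 1) f))
    D-homogenise-∷ M a f = begin
      D (homogenise M (a ∷ f))
        ≈⟨ D-+ (scalar a *₃ varZ ^₃ M) (varX *₃ homogenise (M ∸ 1) f) ⟩
      D (scalar a *₃ varZ ^₃ M) + D (varX *₃ homogenise (M ∸ 1) f)
        ≈⟨ +-cong (D-* (scalar a) (varZ ^₃ M)) (D-* varX (homogenise (M ∸ 1) f)) ⟩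
      (D (scalar a) * φ (varZ ^₃ M) + φ (scalar a) * D (varZ ^₃ M)) + (D varX * h + φ varX * Dh)
        ≈⟨ +-cong (+-cong (trans (*-congʳ (D-scalar a)) (zeroˡ _)) (*-congʳ (φ-scalar a))) (+-cong (*-congʳ D-varX) (*-congʳ φ-varX)) ⟩
      (0# + a * D (varZ ^₃ M)) + (dx * h + x * Dh)
        ≈⟨ +-congʳ (+-identityˡ _) ⟩
      a * D (varZ ^₃ M) + (dx * h + x * Dh) ∎
      where
      h  = φ (homogenise (M ∸ 1) f)
      Dh = D (homogenise (M ∸ 1) f)

    φ-homogenise-≋[] : ∀ M f → f ≋ [] → φ (homogenise M f) ≈ 0#
    φ-homogenise-≋[] M []      p = refl
    φ-homogenise-≋[] M (a ∷ f) p = begin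
      φ (homogenise M (a ∷ f)) ≈⟨ φ-homogenise-∷ M a f ⟩
      a * z ^ M + x * φ (homogenise (M ∸ 1) f) ≈⟨ +-cong (*-congʳ (at p 0)) (*-congˡ (φ-homogenise-≋[] (M ∸ 1) f (tail-≋[] p))) ⟩
      0# * z ^ M + x * 0# ≈⟨ solve 2 (λ v x → con (+ 0) :* v :+ x :* con (+ 0) := con (+ 0)) refl _ _ ⟩
      0# ∎

    D-homogenise-≋[] : ∀ M f → f ≋ [] → D (homogenise M f) ≈ 0#
    D-homogenise-≋[] M []      p = D-0
    D-homogenise-≋[] M (a ∷ f) p = begin
      D (homogenise M (a ∷ f))
        ≈⟨ D-homogenise-∷ M a f ⟩
      a * D (varZ ^₃ M) + (dx * φ (homogenise (M ∸ 1) f) + x * D (homogenise (M ∸ 1) f))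
        ≈⟨ +-cong (*-congʳ (at p 0)) (+-cong (*-congˡ (φ-homogenise-≋[] (M ∸ 1) f (tail-≋[] p))) (*-congˡ (D-homogenise-≋[] (M ∸ 1) f (tail-≋[] p)))) ⟩
      0# * D (varZ ^₃ M) + (dx * 0# + x * 0#)
        ≈⟨ solve 3 (λ v d x → con (+ 0) :* v :+ (d :* con (+ 0) :+ x :* con (+ 0)) := con (+ 0)) refl _ _ _ ⟩
      0# ∎

    -- The factor z raises the exponent M - 1 of the power rule to M, which gives one formula valid
    -- also for M = 0. This is why the affine computations below are all multiplied by z.
    z*D-varZ^ : ∀ M → z * D (varZ ^₃ M) ≈ z ^ M * (M · dz)
    z*D-varZ^ zero = trans (*-congˡ D-1₃) (trans (zeroʳ z) (sym (zeroʳ _)))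
      where
      D-1₃ : D 1₃ ≈ 0#
      D-1₃ = H₃.PointDerivation.D-1 Δ₃
    z*D-varZ^ (suc m) = begin
      z * D (varZ ^₃ suc m) ≈⟨ *-congˡ (D₃.D-^ varZ m) ⟩
      z * ((suc m · (φ varZ ^ m)) * D varZ) ≈⟨ *-congˡ (*-cong (×-congʳ (suc m) (^-congˡ m φ-varZ)) D-varZ) ⟩
      z * ((suc m · (z ^ m)) * dz) ≈⟨ *-congˡ (trans (×-assoc-* (suc m) _ _) (sym (×-comm-* (suc m) _ _))) ⟩
      z * (z ^ m * (suc m · dz)) ≈⟨ *-assoc _ _ _ ⟨
      z ^ suc m * (suc m · dz) ∎

    open RawRing K[x][y][z].rawRing using () renaming (_+_ to _+₃_; -_ to -₃_)

    equation : ℕ → ℕ → ℕ → K[x].Poly → Form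
    equation d j M f = (varY ^₃ d *₃ varZ ^₃ j) +₃ (-₃ homogenise M f)

    φ-equation : ∀ d j M f → φ (equation d j M f) ≈ y ^ d * z ^ j + - φ (homogenise M f)
    φ-equation d j M f = trans (φ-+ (varY ^₃ d *₃ varZ ^₃ j) (-₃ homogenise M f))
      (+-cong (φ-varY^varZ^ d j) (φ-neg (homogenise M f)))

    D-equation : ∀ d j M f → D (equation (suc d) j M f) ≈
      ((suc d · (y ^ d)) * dy * z ^ j + y ^ suc d * D (varZ ^₃ j)) + - D (homogenise M f)
    D-equation d j M f = trans (D-+ (varY ^₃ suc d *₃ varZ ^₃ j) (-₃ homogenise M f)) (+-cong
      (trans (D-* (varY ^₃ suc d) (varZ ^₃ j)) (+-cong
        (*-cong (trans (D₃.D-^ varY d) (*-cong (×-congʳ (suc d) (^-congˡ d φ-varY)) D-varY))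
                (trans (H₃.φ-^ varZ j) (^-congˡ j φ-varZ)))
        (*-congʳ (trans (H₃.φ-^ varY (suc d)) (^-congˡ (suc d) φ-varY)))))
      (D-neg (homogenise M f)))

    module Finite (u : Carrier) (x≈zu : x ≈ z * u) where

      φ-homogenise : ∀ M f → Below (suc M) f → φ (homogenise M f) ≈ z ^ M * eval f u
      φ-homogenise M       []      b = sym (zeroʳ _)
      -- The bound forces the tail to be zero, so the truncated `0 ∸ 1` inside `homogenise` meets
      -- only the zero polynomial.
      φ-homogenise zero    (a ∷ f) b = begin
        φ (homogenise 0 (a ∷ f)) ≈⟨ φ-homogenise-∷ 0 a f ⟩
        a * 1# + x * φ (homogenise 0 f) ≈⟨ +-congˡ (*-congˡ (φ-homogenise-≋[] 0 f f≋[])) ⟩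
        a * 1# + x * 0# ≈⟨ solve 3 (λ a x u → a :* con (+ 1) :+ x :* con (+ 0) := con (+ 1) :* (a :+ u :* con (+ 0))) refl a x u ⟩
        1# * (a + u * 0#) ≈⟨ *-congˡ (+-congˡ (*-congˡ (eval-cong u f≋[]))) ⟨
        1# * (a + u * eval f u) ∎
        where
        f≋[] : f ≋ []
        f≋[] = coeffwise λ i → b (suc i) (s≤s z≤n)
      φ-homogenise (suc m) (a ∷ f) b = begin
        φ (homogenise (suc m) (a ∷ f)) ≈⟨ φ-homogenise-∷ (suc m) a f ⟩
        a * z ^ suc m + x * φ (homogenise m f) ≈⟨ +-congˡ (*-cong x≈zu (φ-homogenise m f (λ i p → b (suc i) (s≤s p)))) ⟩
        a * (z * z ^ m) + z * u * (z ^ m * eval f u) ≈⟨ solve 5 (λ a z v u e → a :* (z :* v) :+ z :* u :* (v :* e) := (z :* v) :* (a :+ u :* e)) refl a z (z ^ m) u (eval f u) ⟩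
        z ^ suc m * (a + u * eval f u) ∎

      -- The chain rule for homogenise M f = zᴹ f (x / z), multiplied by z.
      D-homogenise : ∀ M f → Below (suc M) f → z * D (homogenise M f) ≈
                     z ^ M * ((M · dz) * eval f u + eval (derivative f) u * (dx + - (u * dz)))
      D-homogenise M       []      b = trans (*-congˡ D-0)
        (solve 4 (λ z v m d → z :* con (+ 0) := v :* (m :* con (+ 0) :+ con (+ 0) :* d)) refl _ _ _ _)
      D-homogenise zero    (a ∷ f) b = begin
        z * D (homogenise 0 (a ∷ f))
          ≈⟨ *-congˡ (D-homogenise-∷ 0 a f) ⟩
        z * (a * D 1₃ + (dx * φ (homogenise 0 f) + x * D (homogenise 0 f)))
          ≈⟨ *-congˡ (+-cong (*-congˡ (H₃.PointDerivation.D-1 Δ₃)) (+-cong (*-congˡ (φ-homogenise-≋[] 0 f f≋[])) (*-congˡ (D-homogenise-≋[] 0 f f≋[])))) ⟩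
        z * (a * 0# + (dx * 0# + x * 0#))
          ≈⟨ solve 6 (λ z a x dx e d → z :* (a :* con (+ 0) :+ (dx :* con (+ 0) :+ x :* con (+ 0))) := con (+ 1) :* (con (+ 0) :* e :+ con (+ 0) :* d)) refl _ _ _ _ _ _ ⟩
        1# * (0# * eval (a ∷ f) u + 0# * (dx + - (u * dz)))
          ≈⟨ *-congˡ (+-congˡ (*-congʳ (eval-cong {derivative (a ∷ f)} {[]} u (P.trans (P.+-cong f≋[] (∷-cong refl (derivative-≋[] f f≋[]))) 0∷[]≋[])))) ⟨
        1# * (0# * eval (a ∷ f) u + eval (derivative (a ∷ f)) u * (dx + - (u * dz))) ∎
        where
        f≋[] : f ≋ []
        f≋[] = coeffwise λ i → b (suc i) (s≤s z≤n)
      D-homogenise (suc m) (a ∷ f) b = begin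
        z * D (homogenise (suc m) (a ∷ f))
          ≈⟨ *-congˡ (D-homogenise-∷ (suc m) a f) ⟩
        z * (a * D (varZ ^₃ suc m) + (dx * h + x * Dh))
          ≈⟨ solve 6 (λ z a v dx h w → z :* (a :* v :+ (dx :* h :+ w)) := a :* (z :* v) :+ (z :* (dx :* h) :+ z :* w)) refl z a (D (varZ ^₃ suc m)) dx h (x * Dh) ⟩
        a * (z * D (varZ ^₃ suc m)) + (z * (dx * h) + z * (x * Dh))
          ≈⟨ +-cong (*-congˡ (z*D-varZ^ (suc m))) (+-cong (*-congˡ (*-congˡ (φ-homogenise m f b′))) z*[x*Dh]) ⟩
        a * (z ^ suc m * (dz + m · dz)) + (z * (dx * (z ^ m * e)) + z * u * (z ^ m * ((m · dz) * e + e′ * (dx + - (u * dz)))))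
          ≈⟨ solve 9 (λ a z v dz n dx e u e′ →
               a :* ((z :* v) :* (dz :+ n)) :+ (z :* (dx :* (v :* e)) :+ z :* u :* (v :* (n :* e :+ e′ :* (dx :+ :- (u :* dz)))))
               := (z :* v) :* ((dz :+ n) :* (a :+ u :* e) :+ (e :+ u :* e′) :* (dx :+ :- (u :* dz)))) refl
               a z (z ^ m) dz (m · dz) dx e u e′ ⟩
        z ^ suc m * ((suc m · dz) * (a + u * e) + (e + u * e′) * (dx + - (u * dz)))
          ≈⟨ *-congˡ (+-congˡ (*-congʳ (trans (eval-+ f (0# ∷ derivative f) u) (+-congˡ (eval-shift (derivative f) u))))) ⟨
        z ^ suc m * ((suc m · dz) * (a + u * e) + eval (derivative (a ∷ f)) u * (dx + - (u * dz))) ∎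
        where
        b′ : Below (suc m) f
        b′ i p = b (suc i) (s≤s p)
        h  = φ (homogenise m f)
        Dh = D (homogenise m f)
        e  = eval f u
        e′ = eval (derivative f) u
        z*[x*Dh] : z * (x * Dh) ≈ z * u * (z ^ m * ((m · dz) * e + e′ * (dx + - (u * dz))))
        z*[x*Dh] = begin
          z * (x * Dh) ≈⟨ *-congˡ (*-congʳ x≈zu) ⟩
          z * (z * u * Dh) ≈⟨ solve 3 (λ z u d → z :* (z :* u :* d) := z :* u :* (z :* d)) refl z u Dh ⟩
          z * u * (z * Dh) ≈⟨ *-congˡ (D-homogenise m f b′) ⟩
          _ ∎

      D-equation-finite : ∀ d j M f → Below (suc M) f → z * D (equation (suc d) j M f) ≈
        (z * ((suc d · (y ^ d)) * dy * z ^ j) + y ^ suc d * (z ^ j * (j · dz)))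
          + - (z ^ M * ((M · dz) * eval f u + eval (derivative f) u * (dx + - (u * dz))))
      D-equation-finite d j M f b = begin
        z * D (equation (suc d) j M f)
          ≈⟨ *-congˡ (D-equation d j M f) ⟩
        z * ((t + y ^ suc d * D (varZ ^₃ j)) + - D (homogenise M f))
          ≈⟨ solve 5 (λ z t v w h → z :* ((t :+ v :* w) :+ :- h) := (z :* t :+ v :* (z :* w)) :+ :- (z :* h)) refl z t (y ^ suc d) _ _ ⟩
        (z * t + y ^ suc d * (z * D (varZ ^₃ j))) + - (z * D (homogenise M f))
          ≈⟨ +-cong (+-congˡ (*-congˡ (z*D-varZ^ j))) (-‿cong (D-homogenise M f b)) ⟩
        _ ∎
        where t = (suc d · (y ^ d)) * dy * z ^ j

    module Infinite (z≈0 : z ≈ 0#) (dz≈0 : dz ≈ 0#) where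

      0^suc : ∀ n → z ^ suc n ≈ 0#
      0^suc n = trans (*-congʳ z≈0) (zeroˡ _)

      D-varZ^ : ∀ M → D (varZ ^₃ M) ≈ 0#
      D-varZ^ zero    = H₃.PointDerivation.D-1 Δ₃
      D-varZ^ (suc m) = trans (D₃.D-^ varZ m) (trans (*-congˡ (trans D-varZ dz≈0)) (zeroʳ _))

      φ-homogenise : ∀ M f → Below (suc M) f → φ (homogenise M f) ≈ coeff f M * x ^ M
      φ-homogenise M       []      b = sym (zeroˡ _)
      φ-homogenise zero    (a ∷ f) b = begin
        φ (homogenise 0 (a ∷ f)) ≈⟨ φ-homogenise-∷ 0 a f ⟩
        a * 1# + x * φ (homogenise 0 f) ≈⟨ +-congˡ (*-congˡ (φ-homogenise-≋[] 0 f (coeffwise λ i → b (suc i) (s≤s z≤n)))) ⟩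
        a * 1# + x * 0# ≈⟨ trans (+-congˡ (zeroʳ x)) (+-identityʳ _) ⟩
        a * 1# ∎
      φ-homogenise (suc m) (a ∷ f) b = begin
        φ (homogenise (suc m) (a ∷ f)) ≈⟨ φ-homogenise-∷ (suc m) a f ⟩
        a * z ^ suc m + x * φ (homogenise m f) ≈⟨ +-cong (*-congˡ (0^suc m)) (*-congˡ (φ-homogenise m f (λ i p → b (suc i) (s≤s p)))) ⟩
        a * 0# + x * (coeff f m * x ^ m) ≈⟨ solve 4 (λ a x c v → a :* con (+ 0) :+ x :* (c :* v) := c :* (x :* v)) refl a x (coeff f m) (x ^ m) ⟩
        coeff f m * x ^ suc m ∎

      -- Along the line z = 0 only the term a X^M of the form is left, where a is the coefficient of
      -- index M. For M = 0 the multiple `M ·` annihilates the default exponent `M ∸ 1`.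
      D-homogenise : ∀ M f → Below (suc M) f → D (homogenise M f) ≈ dx * (M · (coeff f M * x ^ (M ∸ 1)))
      D-homogenise M       []      b = trans D-0 (sym (trans (*-congˡ (trans (×-congʳ M (zeroˡ _)) (n·0≈0 M))) (zeroʳ dx)))
      D-homogenise zero    (a ∷ f) b = begin
        D (homogenise 0 (a ∷ f))
          ≈⟨ D-homogenise-∷ 0 a f ⟩
        a * D 1₃ + (dx * φ (homogenise 0 f) + x * D (homogenise 0 f))
          ≈⟨ +-cong (*-congˡ (D-varZ^ 0)) (+-cong (*-congˡ (φ-homogenise-≋[] 0 f f≋[])) (*-congˡ (D-homogenise-≋[] 0 f f≋[]))) ⟩
        a * 0# + (dx * 0# + x * 0#)
          ≈⟨ solve 3 (λ a dx x → a :* con (+ 0) :+ (dx :* con (+ 0) :+ x :* con (+ 0)) := dx :* con (+ 0)) refl a dx x ⟩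
        dx * 0# ∎
        where
        f≋[] : f ≋ []
        f≋[] = coeffwise λ i → b (suc i) (s≤s z≤n)
      D-homogenise (suc m) (a ∷ f) b = begin
        D (homogenise (suc m) (a ∷ f))
          ≈⟨ D-homogenise-∷ (suc m) a f ⟩
        a * D (varZ ^₃ suc m) + (dx * φ (homogenise m f) + x * D (homogenise m f))
          ≈⟨ +-cong (*-congˡ (D-varZ^ (suc m))) (+-cong (*-congˡ (φ-homogenise m f b′)) (*-congˡ (D-homogenise m f b′))) ⟩
        a * 0# + (dx * w + x * (dx * (m · (coeff f m * x ^ (m ∸ 1)))))
          ≈⟨ solve 5 (λ a dx w x v → a :* con (+ 0) :+ (dx :* w :+ x :* (dx :* v)) := dx :* (w :+ x :* v)) refl a dx w x _ ⟩
        dx * (w + x * (m · (coeff f m * x ^ (m ∸ 1))))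
          ≈⟨ *-congˡ (+-congˡ (raise m)) ⟩
        dx * (suc m · w) ∎
        where
        b′ : Below (suc m) f
        b′ i p = b (suc i) (s≤s p)
        w = coeff f m * x ^ m
        raise : ∀ k → x * (k · (coeff f m * x ^ (k ∸ 1))) ≈ k · (coeff f m * x ^ k)
        raise zero    = zeroʳ x
        raise (suc k) = trans (×-comm-* (suc k) x _)
          (×-congʳ (suc k) (solve 3 (λ x c v → x :* (c :* v) := c :* (x :* v)) refl x (coeff f m) (x ^ k)))

-- Degrees and roots

module Degree {c ℓ} (R : CommutativeRing c ℓ) where
  open CommutativeRing R hiding (_-_)
  open Multiples R using (n·0≈0)
  open IntegerSolver R using (solve; _:=_; _:+_; _:*_; :-_; con)
  open Polynomials rawRing
  open PolynomialRing R
  open Evaluation R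
  open SemiringExp semiring using (_^_)
  open SemiringMult semiring using (×-congʳ) renaming (_×_ to _·_)
  open SetoidReasoning setoid
  module P = CommutativeRing polynomialRing
  open SemiringExp P.semiring using () renaming (_^_ to _^ₚ_) public
  open SemiringMult P.semiring using () renaming (_×_ to _·ₚ_) public

  -- The coefficient a may vanish, so this asserts only degree at most n. The freedom matters for
  -- the coefficient of x^d in f when f has degree less than d.
  record Lead (n : ℕ) (a : Carrier) (f : Poly) : Set ℓ where
    constructor _,_
    field
      lead  : coeff f n ≈ a
      above : Below (suc n) f
  open Lead public

  Below-resp : ∀ {n f g} → f ≋ g → Below n f → Below n g
  Below-resp p b i n≤i = trans (sym (at p i)) (b i n≤i)

  Below-mono : ∀ {m n f} → m ≤ n → Below m f → Below n f
  Below-mono m≤n b i n≤i = b i (ℕ.≤-trans m≤n n≤i)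

  Below-+ : ∀ {n f g} → Below n f → Below n g → Below n (f +ₚ g)
  Below-+ {n} {f} {g} b b′ i n≤i = trans (coeff-+ f g i) (trans (+-cong (b i n≤i) (b′ i n≤i)) (+-identityˡ 0#))

  Below-neg : ∀ {n f} → Below n f → Below n (map (-_) f)
  Below-neg {n} {f} b i n≤i = trans (coeff-neg f i) (trans (-‿cong (b i n≤i)) (solve 0 (:- con (+ 0) := con (+ 0)) refl))

  Below-0 : ∀ {f} → Below 0 f → f ≋ []
  Below-0 b .at i = b i z≤n

  Below-suc : ∀ {n f} → coeff f n ≈ 0# → Below (suc n) f → Below n f
  Below-suc {n} c b i n≤i with ℕ.m≤n⇒m<n∨m≡n n≤i
  ... | inj₁ n<i    = b i n<i
  ... | inj₂ ≡.refl = c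

  Below-tail : ∀ {n a f} → Below (suc n) (a ∷ f) → Below n f
  Below-tail b i n≤i = b (suc i) (s≤s n≤i)

  coeff-derivative : ∀ f i → coeff (derivative f) i ≈ suc i · coeff f (suc i)
  coeff-derivative [] i = sym (n·0≈0 (suc i))
  coeff-derivative (a ∷ f) zero    = coeff-+ f (0# ∷ derivative f) 0
  coeff-derivative (a ∷ f) (suc i) = trans (coeff-+ f (0# ∷ derivative f) (suc i)) (+-congˡ (coeff-derivative f i))

  Below-derivative : ∀ {n} f → Below (suc n) f → Below n (derivative f)
  Below-derivative f b i n≤i = trans (coeff-derivative f i) (trans (×-congʳ (suc i) (b (suc i) (s≤s n≤i))) (n·0≈0 (suc i)))

  Lead-resp : ∀ {n a b f g} → a ≈ b → f ≋ g → Lead n a f → Lead n b g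
  Lead-resp {n} p q (l , u) = trans (sym (at q n)) (trans l p) , Below-resp q u

  Lead-const : ∀ a → Lead 0 a (const a)
  Lead-const a = refl , λ where (suc i) _ → refl

  Lead-X : Lead 1 1# X
  Lead-X = refl , λ where (suc (suc i)) _ → refl
                          (suc zero) (s≤s ())

  Lead-neg : ∀ {n a f} → Lead n a f → Lead n (- a) (map (-_) f)
  Lead-neg {n} {a} {f} (l , u) = trans (coeff-neg f n) (-‿cong l) , Below-neg {f = f} u

  Lead-+ : ∀ {n a b f g} → Lead n a f → Lead n b g → Lead n (a + b) (f +ₚ g)
  Lead-+ {n} {f = f} {g} (l , u) (l′ , u′) = trans (coeff-+ f g n) (+-cong l l′) , Below-+ {f = f} {g} u u′

  Lead-Below : ∀ {n f} → Below n f → Lead n 0# f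
  Lead-Below b = b _ ℕ.≤-refl , λ i p → b i (ℕ.≤-trans (ℕ.n≤1+n _) p)

  Lead-+-Below : ∀ {n a f g} → Lead n a f → Below n g → Lead n a (f +ₚ g)
  Lead-+-Below {f = f} {g} l b = Lead-resp (+-identityʳ _) (P.refl {f +ₚ g}) (Lead-+ l (Lead-Below b))

  Lead-scale : ∀ {n a f} b → Lead n a f → Lead n (b * a) (map (b *_) f)
  Lead-scale {n} {a} {f} b (l , u) = trans (coeff-scale b f n) (*-congˡ l) ,
    λ i n<i → trans (coeff-scale b f i) (trans (*-congˡ (u i n<i)) (zeroʳ b))

  Lead-shift : ∀ {n a f} → Lead n a f → Lead (suc n) a (0# ∷ f)
  Lead-shift (l , u) = l , λ where (suc i) (s≤s n<i) → u i n<i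

  Lead-* : ∀ {m n a b} f g → Lead m a f → Lead n b g → Lead (m ℕ.+ n) (a * b) (f *ₚ g)
  Lead-* {m} {n} {a} {b} [] g (l , u) l′ =
    trans (sym (zeroˡ b)) (*-congʳ l) , λ i _ → refl
  Lead-* {zero} (a′ ∷ f) g (l , u) l′ =
    Lead-resp (*-congʳ l) (P.trans (P.sym (+ₚ-identityʳ _)) (P.+-congˡ {map (a′ *_) g} (P.sym (P.trans (∷-cong refl (≋[]-*ₚ f g (Below-0 (Below-tail u)))) 0∷[]≋[]))))
      (Lead-scale a′ l′)
  Lead-* {suc m} {n} (a′ ∷ f) g (l , u) l′ =
    Lead-resp refl (P.+-comm (0# ∷ (f *ₚ g)) (map (a′ *_) g))
      (Lead-+-Below {g = map (a′ *_) g} (Lead-shift (Lead-* f g (l , Below-tail u) l′))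
        λ i p → above (Lead-scale a′ l′) i (ℕ.≤-trans (s≤s (ℕ.m≤n+m n m)) p))

  Lead-^ : ∀ {m a} f → Lead m a f → ∀ k → Lead (k ℕ.* m) (a ^ k) (f ^ₚ k)
  Lead-^ f l zero    = Lead-const 1#
  Lead-^ f l (suc k) = Lead-* f (f ^ₚ k) l (Lead-^ f l k)

  Lead-X^ : ∀ k → Lead k 1# (X ^ₚ k)
  Lead-X^ k = ≡.subst (λ m → Lead m 1# (X ^ₚ k)) (ℕ.*-identityʳ k) (Lead-resp (1^ k) P.refl (Lead-^ X Lead-X k))
    where
    1^ : ∀ k → 1# ^ k ≈ 1#
    1^ zero    = refl
    1^ (suc k) = trans (*-identityˡ _) (1^ k)

  n·const : ∀ n a → (n ·ₚ const a) ≋ const (n · a)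
  n·const zero    a = P.sym 0∷[]≋[]
  n·const (suc n) a = P.+-congˡ {const a} (n·const n a)

  n·1≈0⇒n·1≋[] : ∀ {n} → n · 1# ≈ 0# → (n ·ₚ const 1#) ≋ []
  n·1≈0⇒n·1≋[] {n} n·1≈0 = P.trans (n·const n 1#) (P.trans (∷-cong n·1≈0 P.refl) 0∷[]≋[])

  Lead-derivative : ∀ {n a} f → Lead (suc n) a f → Lead n (suc n · a) (derivative f)
  Lead-derivative {n} f (l , u) = trans (coeff-derivative f n) (×-congʳ (suc n) l) , Below-derivative f u

  Lead-unique : ∀ {n a b f} → Lead n a f → Lead n b f → a ≈ b
  Lead-unique (l , _) (l′ , _) = trans (sym l) l′

  -- If f = m h + ρ, then a + X f = m (X h) + (a + X ρ), and a + X ρ has degree at most q;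
  -- subtracting a single scalar multiple of the monic m restores the bound on the remainder.
  divide : ∀ {q} m → Lead q 1# m → ∀ f → ∃₂ λ h ρ → f ≋ ((m *ₚ h) +ₚ ρ) × Below q ρ
  divide {q} m l [] = [] , [] , P.sym (P.trans (P.+-identityʳ _) (*ₚ-zeroʳ m)) , λ _ _ → refl
  divide {q} m l (a ∷ f) with divide m l f
  ... | h , ρ , eq , b = (e ∷ h) , ρ′ , eq′ , Below-suc {f = ρ′} top (Below-+ {f = a ∷ ρ} {map (-_) (map (e *_) m)} below (above negm))
    where
    e : Carrier
    e = coeff (a ∷ ρ) q
    ρ′ : Poly
    ρ′ = (a ∷ ρ) +ₚ map (-_) (map (e *_) m)
    negm : Lead q (- (e * 1#)) (map (-_) (map (e *_) m))
    negm = Lead-neg {f = map (e *_) m} (Lead-scale e l)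
    below : Below (suc q) (a ∷ ρ)
    below (suc i) (s≤s p) = b i p
    top : coeff ρ′ q ≈ 0#
    top = trans (coeff-+ (a ∷ ρ) (map (-_) (map (e *_) m)) q) (trans (+-congˡ (lead negm))
      (solve 1 (λ e → e :+ :- (e :* con (+ 1)) := con (+ 0)) refl e))
    module PS = IntegerSolver polynomialRing
    module PR = SetoidReasoning P.setoid
    eq′ : (a ∷ f) ≋ ((m *ₚ (e ∷ h)) +ₚ ρ′)
    eq′ = PR.begin
      a ∷ f
        PR.≈⟨ ∷-cong (sym (+-identityˡ a)) eq ⟩
      (0# ∷ (m *ₚ h)) +ₚ (a ∷ ρ)
        PR.≈⟨ PS.solve 3 (λ u v w → u PS.:+ v PS.:= (w PS.:+ u) PS.:+ (v PS.:+ PS.:- w)) P.refl (0# ∷ (m *ₚ h)) (a ∷ ρ) (map (e *_) m) ⟩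
      (map (e *_) m +ₚ (0# ∷ (m *ₚ h))) +ₚ ρ′
        PR.≈⟨ P.+-congʳ (*ₚ-∷ʳ m e h) ⟨
      (m *ₚ (e ∷ h)) +ₚ ρ′ PR.∎

-- Polynomials over a field: roots and algebraic closedness

module FieldPolynomials {c ℓ} (K : Field c ℓ) where
  open Field K hiding (_-_)
  open IntegerSolver commutativeRing using (solve; _:=_; _:+_; _:*_; :-_; con)
  open Polynomials rawRing
  open PolynomialRing commutativeRing
  open Evaluation commutativeRing
  open Degree commutativeRing
  open SemiringExp semiring using (_^_; ^-congˡ)
  open SetoidReasoning setoid
  open import Algebra.Properties.Group +-group using (x∙y⁻¹≈ε⇒x≈y)

  x*y≈0⇒y≈0 : ∀ {x y} → ¬ (x ≈ 0#) → x * y ≈ 0# → y ≈ 0#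
  x*y≈0⇒y≈0 {x} {y} x≉0 xy≈0 with inverse x x≉0
  ... | x⁻¹ , eq = begin
    y ≈⟨ *-identityˡ y ⟨
    1# * y ≈⟨ *-congʳ eq ⟨
    x * x⁻¹ * y ≈⟨ solve 3 (λ x i y → x :* i :* y := i :* (x :* y)) refl x x⁻¹ y ⟩
    x⁻¹ * (x * y) ≈⟨ *-congˡ xy≈0 ⟩
    x⁻¹ * 0# ≈⟨ zeroʳ x⁻¹ ⟩
    0# ∎

  *-nonzero : ∀ {x y} → ¬ (x ≈ 0#) → ¬ (y ≈ 0#) → ¬ (x * y ≈ 0#)
  *-nonzero x≉0 y≉0 xy≈0 = y≉0 (x*y≈0⇒y≈0 x≉0 xy≈0)

  ^-nonzero : ∀ {x} n → ¬ (x ≈ 0#) → ¬ (x ^ n ≈ 0#)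
  ^-nonzero zero    x≉0 = 0≉1 ∘ sym
  ^-nonzero (suc n) x≉0 = *-nonzero x≉0 (^-nonzero n x≉0)

  x^n≈0⇒x≈0 : ∀ {x} n → x ^ n ≈ 0# → x ≈ 0#
  x^n≈0⇒x≈0 {x} n p with x ≟ 0#
  ... | yes x≈0 = x≈0
  ... | no  x≉0 = ⊥-elim (^-nonzero n x≉0 p)

  *-cancelˡ : ∀ {x y z} → ¬ (x ≈ 0#) → x * y ≈ x * z → y ≈ z
  *-cancelˡ {x} {y} {z} x≉0 eq = x∙y⁻¹≈ε⇒x≈y y z (x*y≈0⇒y≈0 x≉0 (begin
    x * (y + - z) ≈⟨ solve 3 (λ x y z → x :* (y :+ :- z) := x :* y :+ :- (x :* z)) refl x y z ⟩
    x * y + - (x * z) ≈⟨ +-congʳ eq ⟩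
    x * z + - (x * z) ≈⟨ -‿inverseʳ _ ⟩
    0# ∎))

  HasDegree⇒Lead : ∀ {n} f → HasDegree f n → Lead n (coeff f n) f
  HasDegree⇒Lead f (_ , u) = refl , u

  Lead⇒HasDegree : ∀ {n a f} → ¬ (a ≈ 0#) → Lead n a f → HasDegree f n
  Lead⇒HasDegree a≉0 (l , u) = (λ p → a≉0 (trans (sym l) p)) , u

  HasDegree-Below : ∀ {m n} f → HasDegree f m → Below n f → m < n
  HasDegree-Below f (nz , _) b = ℕ.≰⇒> λ n≤m → nz (b _ n≤m)

  HasDegree-Lead : ∀ {m n a} f → HasDegree f m → ¬ (a ≈ 0#) → Lead n a f → m ≡ n
  HasDegree-Lead f d a≉0 l = ℕ.≤-antisym (ℕ.≤-pred (HasDegree-Below f d (above l)))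
    (ℕ.≤-pred (HasDegree-Below f (Lead⇒HasDegree a≉0 l) (proj₂ d)))

  HasDegree-resp : ∀ {n f g} → f ≋ g → HasDegree f n → HasDegree g n
  HasDegree-resp {n} p (nz , u) = (λ q → nz (trans (at p n) q)) , Below-resp p u

  HasDegree-* : ∀ {m n} f g → HasDegree f m → HasDegree g n → HasDegree (f *ₚ g) (m ℕ.+ n)
  HasDegree-* f g d e = Lead⇒HasDegree (*-nonzero (proj₁ d) (proj₁ e)) (Lead-* f g (HasDegree⇒Lead f d) (HasDegree⇒Lead g e))

  degree? : ∀ f → f ≋ [] ⊎ ∃ (HasDegree f)
  degree? [] = inj₁ P.refl
  degree? (a ∷ f) with degree? f
  ... | inj₂ (n , nz , u) = inj₂ (suc n , nz , λ where (suc i) (s≤s p) → u i p)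
  ... | inj₁ f≋[] with a ≟ 0#
  ...   | yes a≈0 = inj₁ (P.trans (∷-cong a≈0 f≋[]) 0∷[]≋[])
  ...   | no  a≉0 = inj₂ (0 , a≉0 , λ where (suc i) p → at f≋[] i)

  *ₚ-≋[]⇒≋[] : ∀ {k} g h → HasDegree h k → (g *ₚ h) ≋ [] → g ≋ []
  *ₚ-≋[]⇒≋[] g h dh gh≋[] with degree? g
  ... | inj₁ g≋[]     = g≋[]
  ... | inj₂ (k , dg) = ⊥-elim (proj₁ (HasDegree-* g h dg dh) (at gh≋[] _))

  -- Horner's scheme: the quotient of f - f(a) by X - a, whose coefficients are the values at a of
  -- the successive tails of f.
  quotient : Carrier → Poly → Poly
  quotient a []      = []
  quotient a (b ∷ f) = eval f a ∷ quotient a f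

  eval-quotient : ∀ a f x → eval f x ≈ eval f a + (x + - a) * eval (quotient a f) x
  eval-quotient a []      x = solve 2 (λ x a → con (+ 0) := con (+ 0) :+ (x :+ :- a) :* con (+ 0)) refl x a
  eval-quotient a (b ∷ f) x = begin
    b + x * eval f x
      ≈⟨ +-congˡ (*-congˡ (eval-quotient a f x)) ⟩
    b + x * (eval f a + (x + - a) * eval (quotient a f) x)
      ≈⟨ solve 5 (λ b x e a q → b :+ x :* (e :+ (x :+ :- a) :* q) := (b :+ a :* e) :+ (x :+ :- a) :* (e :+ x :* q)) refl b x (eval f a) a (eval (quotient a f) x) ⟩
    (b + a * eval f a) + (x + - a) * (eval f a + x * eval (quotient a f) x) ∎

  quotient-≋[] : ∀ a f → f ≋ [] → quotient a f ≋ []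
  quotient-≋[] a []      p = P.refl
  quotient-≋[] a (b ∷ f) p = P.trans (∷-cong (eval-cong a (tail-≋[] p)) (quotient-≋[] a f (tail-≋[] p))) 0∷[]≋[]

  quotient-Below : ∀ {n} a f → Below (suc n) f → Below n (quotient a f)
  quotient-Below a [] u i p = refl
  quotient-Below {zero} a (b ∷ f) u zero    p = eval-cong {f} {[]} a (coeffwise λ i → u (suc i) (s≤s z≤n))
  quotient-Below {zero} a (b ∷ f) u (suc i) p = at (quotient-≋[] a f (coeffwise λ i → u (suc i) (s≤s z≤n))) i
  quotient-Below {suc n} a (b ∷ f) u (suc i) (s≤s p) = quotient-Below a f (Below-tail u) i p

  quotient-≋[]⇒≋[] : ∀ a f → eval f a ≈ 0# → quotient a f ≋ [] → f ≋ []
  quotient-≋[]⇒≋[] a []      e p = P.refl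
  quotient-≋[]⇒≋[] a (b ∷ f) e p = P.trans (∷-cong b≈0 (quotient-≋[]⇒≋[] a f (at p 0) (tail-≋[] p))) 0∷[]≋[]
    where
    b≈0 : b ≈ 0#
    b≈0 = begin
      b ≈⟨ trans (+-congˡ (zeroʳ a)) (+-identityʳ b) ⟨
      b + a * 0# ≈⟨ +-congˡ (*-congˡ (at p 0)) ⟨
      b + a * eval f a ≈⟨ e ⟩
      0# ∎

  roots⇒≋[] : ∀ n f (r : Fin n → Carrier) → (∀ {i j} → r i ≈ r j → i ≡ j) →
              (∀ i → eval f (r i) ≈ 0#) → Below n f → f ≋ []
  roots⇒≋[] zero    f r inj z b = Below-0 b
  roots⇒≋[] (suc n) f r inj z b = quotient-≋[]⇒≋[] a f (z Fin.zero)
    (roots⇒≋[] n (quotient a f) (r ∘ Fin.suc) (λ p → suc-injective (inj p)) z′ (quotient-Below a f b))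
    where
    open import Data.Fin.Properties using (suc-injective)
    a = r Fin.zero
    z′ : ∀ i → eval (quotient a f) (r (Fin.suc i)) ≈ 0#
    z′ i = x*y≈0⇒y≈0 (λ p → case-0≡suc (inj (sym (x∙y⁻¹≈ε⇒x≈y _ _ p)))) (begin
      (x + - a) * eval (quotient a f) x ≈⟨ +-identityˡ _ ⟨
      0# + (x + - a) * eval (quotient a f) x ≈⟨ +-congʳ (z Fin.zero) ⟨
      eval f a + (x + - a) * eval (quotient a f) x ≈⟨ eval-quotient a f x ⟨
      eval f x ≈⟨ z (Fin.suc i) ⟩
      0# ∎)
      where
      x = r (Fin.suc i)
      case-0≡suc : ¬ (Fin.zero ≡ Fin.suc i)
      case-0≡suc ()

  module AlgebraicallyClosed (algClosed : ∀ f n → HasDegree f (suc n) → ∃ λ x → eval f x ≈ 0#) where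

    -- If f has positive degree, then f - 1 has a root, and there f takes the value 1 and not 0.
    vanishing⇒≋[] : ∀ f → (∀ x → eval f x ≈ 0#) → f ≋ []
    vanishing⇒≋[] f z with degree? f
    ... | inj₁ f≋[] = f≋[]
    ... | inj₂ (zero , d) = ⊥-elim (proj₁ d (trans (coeff-0 f) (z 0#)))
      where
      coeff-0 : ∀ f → coeff f 0 ≈ eval f 0#
      coeff-0 []      = refl
      coeff-0 (a ∷ f) = sym (trans (+-congˡ (zeroˡ _)) (+-identityʳ a))
    ... | inj₂ (suc n , d) with algClosed (f +ₚ const (- 1#)) n (Lead⇒HasDegree (proj₁ d) (Lead-+-Below {g = const (- 1#)} (HasDegree⇒Lead f d) λ where (suc i) p → refl))
    ...   | x , fx≈1 = ⊥-elim (0≉1 (x∙y⁻¹≈ε⇒x≈y _ _ (begin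
      0# + - 1# ≈⟨ +-cong (z x) (eval-const (- 1#) x) ⟨
      eval f x + eval (const (- 1#)) x ≈⟨ eval-+ f (const (- 1#)) x ⟨
      eval (f +ₚ const (- 1#)) x ≈⟨ fx≈1 ⟩
      0# ∎)))

    root : ∀ n a → ∃ λ y → y ^ suc n ≈ a
    root n a with algClosed ((X ^ₚ suc n) +ₚ const (- a)) n (Lead⇒HasDegree (0≉1 ∘ sym) (Lead-+-Below {g = const (- a)} (Lead-X^ (suc n)) λ where (suc i) p → refl))
    ... | y , eq = y , x∙y⁻¹≈ε⇒x≈y _ _ (begin
      y ^ suc n + - a ≈⟨ +-cong (trans (eval-^ X (suc n) y) (^-congˡ (suc n) (eval-X y))) (eval-const (- a) y) ⟨
      eval (X ^ₚ suc n) y + eval (const (- a)) y ≈⟨ eval-+ (X ^ₚ suc n) (const (- a)) y ⟨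
      eval ((X ^ₚ suc n) +ₚ const (- a)) y ≈⟨ eq ⟩
      0# ∎)

-- Finite sets and finite fields

module Enumerations {a ℓ} (A : Setoid a ℓ) where
  open Setoid A

  -- `HasSize` with the pairs unpacked. That `index` depends only on the element follows from
  -- `elt-inj` and `elt-index`.
  record Enumeration {s} (S : Pred Carrier s) (n : ℕ) : Set (a ⊔ ℓ ⊔ s) where
    field
      elt       : Fin n → Carrier
      elt∈      : ∀ i → elt i ∈ S
      elt-inj   : ∀ {i j} → elt i ≈ elt j → i ≡ j
      index     : ∀ {x} → x ∈ S → Fin n
      elt-index : ∀ {x} (x∈ : x ∈ S) → elt (index x∈) ≈ x

  open Enumeration

  Enumeration⇒HasSize : ∀ {s n} {S : Pred Carrier s} → Enumeration S n → HasSize A S n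
  Enumeration⇒HasSize E = record
    { to        = λ (x , x∈) → index E x∈
    ; from      = λ i → elt E i , elt∈ E i
    ; to-cong   = λ {(x , x∈)} {(y , y∈)} x≈y → elt-inj E (trans (elt-index E x∈) (trans x≈y (sym (elt-index E y∈))))
    ; from-cong = λ { ≡.refl → refl }
    ; inverse   = (λ {i} {(x , x∈)} x≈ → elt-inj E (trans (elt-index E x∈) x≈)) ,
                  (λ { {(x , x∈)} ≡.refl → elt-index E x∈ })
    }

  HasSize⇒Enumeration : ∀ {s n} {S : Pred Carrier s} → HasSize A S n → Enumeration S n
  HasSize⇒Enumeration I = record
    { elt       = λ i → proj₁ (from i)
    ; elt∈      = λ i → proj₂ (from i)
    ; elt-inj   = λ {i} {j} p → ≡.trans (≡.sym (inverseˡ refl)) (≡.trans (to-cong {from i} {from j} p) (inverseˡ refl))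
    ; index     = λ x∈ → to (_ , x∈)
    ; elt-index = λ x∈ → inverseʳ {_ , x∈} ≡.refl
    }
    where open Inverse I

  size-mono : ∀ {s t m n} {S : Pred Carrier s} {T : Pred Carrier t} →
              S ⊆ T → Enumeration S m → Enumeration T n → m ≤ n
  size-mono S⊆T E E′ = Fin.injective⇒≤ {f = λ i → index E′ (S⊆T (elt∈ E i))}
    λ {i} {j} p → elt-inj E (trans (sym (elt-index E′ (S⊆T (elt∈ E i)))) (trans (reflexive (≡.cong (elt E′) p)) (elt-index E′ (S⊆T (elt∈ E j)))))

  transfer : ∀ {s t n} {S : Pred Carrier s} {T : Pred Carrier t} → S ≐ T → Enumeration S n → Enumeration T n
  transfer (S⊆T , T⊆S) E = record
    { elt = elt E ; elt∈ = λ i → S⊆T (elt∈ E i) ; elt-inj = elt-inj E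
    ; index = λ x∈ → index E (T⊆S x∈) ; elt-index = λ x∈ → elt-index E (T⊆S x∈) }

  Image : ∀ {n} → (Fin n → Carrier) → Pred Carrier ℓ
  Image g x = ∃ λ i → g i ≈ x

  -- Runs through g and keeps what lies in S; by injectivity of g, each element kept is new.
  enumerate-image : ∀ {s} {S : Pred Carrier s} → Decidable S → (∀ {x y} → x ≈ y → x ∈ S → y ∈ S) →
                    ∀ n (g : Fin n → Carrier) → (∀ {i j} → g i ≈ g j → i ≡ j) →
                    ∃ (Enumeration (S ∩ Image g))
  enumerate-image S? resp zero g inj = 0 , record
    { elt = λ () ; elt∈ = λ () ; elt-inj = λ { {()} } ; index = λ { (_ , () , _) } ; elt-index = λ { (_ , () , _) } }
  enumerate-image {S = S} S? resp (suc n) g inj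
    with enumerate-image {S = S} S? resp n (g ∘ Fin.suc) (λ p → Fin.suc-injective (inj p)) | S? (g Fin.zero)
  ... | m , E | no g0∉S = m , record
    { elt       = elt E
    ; elt∈      = λ i → let (∈S , j , eq) = elt∈ E i in ∈S , Fin.suc j , eq
    ; elt-inj   = elt-inj E
    ; index     = λ x∈ → index E (shift x∈)
    ; elt-index = λ x∈ → elt-index E (shift x∈)
    }
    where
    shift : S ∩ Image g ⊆ S ∩ Image (g ∘ Fin.suc)
    shift (∈S , Fin.zero  , eq) = ⊥-elim (g0∉S (resp (sym eq) ∈S))
    shift (∈S , Fin.suc i , eq) = ∈S , i , eq
  ... | m , E | yes g0∈S = suc m , record
    { elt       = elt′
    ; elt∈      = λ { Fin.zero → g0∈S , Fin.zero , refl ; (Fin.suc i) → let (∈S , j , eq) = elt∈ E i in ∈S , Fin.suc j , eq }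
    ; elt-inj   = λ {i} {j} → inj′ i j
    ; index     = index′
    ; elt-index = elt-index′
    }
    where
    elt′ : Fin (suc m) → Carrier
    elt′ Fin.zero    = g Fin.zero
    elt′ (Fin.suc i) = elt E i
    fresh : ∀ i → ¬ (g Fin.zero ≈ elt E i)
    fresh i p with elt∈ E i
    ... | _ , j , eq with inj (trans p (sym eq))
    ... | ()
    inj′ : ∀ i j → elt′ i ≈ elt′ j → i ≡ j
    inj′ Fin.zero    Fin.zero    p = ≡.refl
    inj′ Fin.zero    (Fin.suc j) p = ⊥-elim (fresh j p)
    inj′ (Fin.suc i) Fin.zero    p = ⊥-elim (fresh i (sym p))
    inj′ (Fin.suc i) (Fin.suc j) p = ≡.cong Fin.suc (elt-inj E p)
    index′ : ∀ {x} → x ∈ S ∩ Image g → Fin (suc m)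
    index′ (∈S , Fin.zero  , eq) = Fin.zero
    index′ (∈S , Fin.suc i , eq) = Fin.suc (index E (∈S , i , eq))
    elt-index′ : ∀ {x} (x∈ : x ∈ S ∩ Image g) → elt′ (index′ x∈) ≈ x
    elt-index′ (∈S , Fin.zero  , eq) = eq
    elt-index′ (∈S , Fin.suc i , eq) = elt-index E (∈S , i , eq)

module SubfieldFermat {c ℓ} (K : Field c ℓ) where
  open Field K hiding (_-_)
  open Enumerations setoid
  open FieldPolynomials K using (*-cancelˡ; *-nonzero)
  open SemiringExp semiring using (_^_)
  open SetoidReasoning setoid
  private module Σ* = MonoidSum *-commutativeMonoid

  module _ {s} {L : Pred Carrier s} (isSubfield : IsSubfield K L) where
    open IsSubfield isSubfield

    -- Multiplication by x ≠ 0 permutes L and fixes 0, hence permutes the non-zero elements, listed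
    -- by `unit` as the enumeration with the position `o` of 0 punched out. Their product is
    -- non-zero and unchanged, while each factor is multiplied by x; cancelling it leaves x to the
    -- power #L - 1 equal to 1.
    fermat : ∀ {r} → Enumeration L r → ∀ {x} → x ∈ L → x ^ r ≈ x
    fermat {zero}  E {x} x∈ = ⊥-elim (Fin.¬Fin0 (Enumeration.index E x∈))
    fermat {suc r} E {x} x∈ with x ≟ 0#
    ... | yes x≈0 = trans (trans (*-congʳ x≈0) (zeroˡ _)) (sym x≈0)
    ... | no  x≉0 = trans (*-congˡ x^r≈1) (*-identityʳ x)
      where
      open Enumeration E
      x⁻¹ : Carrier
      x⁻¹ = proj₁ (inverse x x≉0)
      x⁻¹∈ : x⁻¹ ∈ L
      x⁻¹∈ = inv x∈ (proj₂ (inverse x x≉0))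
      multiply : ∀ {y} → y ∈ L → Fin (suc r) → Fin (suc r)
      multiply y∈ i = index (*-clos y∈ (elt∈ i))
      elt-multiply : ∀ {y} (y∈ : y ∈ L) i → elt (multiply y∈ i) ≈ y * elt i
      elt-multiply y∈ i = elt-index (*-clos y∈ (elt∈ i))
      cancel : ∀ {y z} (y∈ : y ∈ L) (z∈ : z ∈ L) → y * z ≈ 1# → ∀ {i j} → i ≡ multiply z∈ j → multiply y∈ i ≡ j
      cancel {y} {z} y∈ z∈ yz≈1 {i} {j} ≡.refl = elt-inj (begin
        elt (multiply y∈ i) ≈⟨ elt-multiply y∈ i ⟩
        y * elt i ≈⟨ *-congˡ (elt-multiply z∈ j) ⟩
        y * (z * elt j) ≈⟨ *-assoc y z _ ⟨
        y * z * elt j ≈⟨ *-congʳ yz≈1 ⟩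
        1# * elt j ≈⟨ *-identityˡ _ ⟩
        elt j ∎)
      π : Permutation (suc r) (suc r)
      π = record
        { to = multiply x∈ ; from = multiply x⁻¹∈ ; to-cong = ≡.cong _ ; from-cong = ≡.cong _
        ; inverse = cancel x∈ x⁻¹∈ (proj₂ (inverse x x≉0)) , cancel x⁻¹∈ x∈ (trans (*-comm _ _) (proj₂ (inverse x x≉0))) }
      o : Fin (suc r)
      o = index 0∈
      π-o : π ⟨$⟩ʳ o ≡ o
      π-o = elt-inj (trans (elt-multiply x∈ o) (trans (*-congˡ (elt-index 0∈)) (trans (zeroʳ x) (sym (elt-index 0∈)))))
      unit : Fin r → Carrier
      unit = elt ∘ punchIn o
      unit-nonzero : ∀ i → ¬ (unit i ≈ 0#)
      unit-nonzero i p = Fin.punchInᵢ≢i o i (elt-inj (trans p (sym (elt-index 0∈))))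
      product-nonzero : ∀ {n} (g : Fin n → Carrier) → (∀ i → ¬ (g i ≈ 0#)) → ¬ (Σ*.sum g ≈ 0#)
      product-nonzero {zero}  g nz = 0≉1 ∘ sym
      product-nonzero {suc n} g nz = *-nonzero (nz Fin.zero) (product-nonzero (g ∘ Fin.suc) (nz ∘ Fin.suc))
      unit-π : ∀ i → unit (Perm.remove o π ⟨$⟩ʳ i) ≈ x * unit i
      unit-π i = begin
        elt (punchIn o (Perm.remove o π ⟨$⟩ʳ i)) ≡⟨ ≡.cong (λ j → elt (punchIn j (Perm.remove o π ⟨$⟩ʳ i))) π-o ⟨
        elt (punchIn (π ⟨$⟩ʳ o) (Perm.remove o π ⟨$⟩ʳ i)) ≡⟨ ≡.cong elt (Perm.punchIn-permute π o i) ⟨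
        elt (multiply x∈ (punchIn o i)) ≈⟨ elt-multiply x∈ _ ⟩
        x * unit i ∎
      x^r≈1 : x ^ r ≈ 1#
      x^r≈1 = *-cancelˡ (product-nonzero unit unit-nonzero) (begin
        Σ*.sum unit * x ^ r ≈⟨ *-congˡ (Σ*.sum-replicate r) ⟨
        Σ*.sum unit * Σ*.sum (replicate r x) ≈⟨ *-comm _ _ ⟩
        Σ*.sum (replicate r x) * Σ*.sum unit ≈⟨ Σ*.∑-distrib-+ (replicate r x) unit ⟨
        Σ*.sum (λ i → x * unit i) ≈⟨ Σ*.sum-cong-≋ unit-π ⟨
        Σ*.sum (λ i → unit (Perm.remove o π ⟨$⟩ʳ i)) ≈⟨ Σ*.sum-permute unit (Perm.remove o π) ⟨
        Σ*.sum unit ≈⟨ *-identityʳ _ ⟨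
        Σ*.sum unit * 1# ∎)

module FiniteFieldProperties {c ℓ} (F : FiniteField c ℓ) where
  open FiniteField F hiding (_-_)
  open Enumerations setoid public
  open SubfieldFermat baseField public
  open FieldPolynomials baseField
  open SemiringExp semiring using (_^_)
  open SemiringMult semiring using (×1-homo-*) renaming (_×_ to _·_)
  open SetoidReasoning setoid
  open import Algebra.Properties.Group +-group using (∙-cancelʳ)
  private module Σ+ = MonoidSum +-commutativeMonoid

  everything : Enumeration {s = c ⊔ ℓ} (λ _ → ⊤) order
  everything = record
    { elt       = from
    ; elt∈      = λ _ → tt
    ; elt-inj   = λ {i} {j} p → ≡.trans (≡.sym (inverseˡ refl)) (≡.trans (to-cong p) (inverseˡ refl))
    ; index     = λ {x} _ → to x
    ; elt-index = λ {x} _ → inverseʳ {x} ≡.refl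
    }
    where open Inverse enumeration

  everything-isSubfield : IsSubfield baseField {c ⊔ ℓ} (λ _ → ⊤)
  everything-isSubfield = _

  open Enumeration everything

  x^q≈x : ∀ x → x ^ order ≈ x
  x^q≈x x = fermat everything-isSubfield everything {x} tt

  any? : ∀ {s} {S : Pred Carrier s} → Decidable S → (∀ {x y} → x ≈ y → x ∈ S → y ∈ S) → Dec (∃ S)
  any? S? resp = map′ (λ (i , p) → elt i , p) (λ (x , p) → index {x} tt , resp (sym (elt-index {x} tt)) p)
    (Fin.any? (S? ∘ elt))

  enumerate : ∀ {s} {S : Pred Carrier s} → Decidable S → (∀ {x y} → x ≈ y → x ∈ S → y ∈ S) → ∃ (Enumeration S)
  enumerate {S = S} S? resp with enumerate-image {S = S} S? resp order elt elt-inj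
  ... | n , E = n , transfer (proj₁ , λ {x} x∈ → x∈ , index {x} tt , elt-index {x} tt) E

  2≤order : 2 ≤ order
  2≤order = Fin.injective⇒≤ {f = f} inj
    where
    f : Fin 2 → Fin order
    f Fin.zero           = index {0#} tt
    f (Fin.suc Fin.zero) = index {1#} tt
    0≢1 : ¬ (index {0#} tt ≡ index {1#} tt)
    0≢1 eq = 0≉1 (trans (sym (elt-index {0#} tt)) (trans (reflexive (≡.cong (elt) eq)) (elt-index {1#} tt)))
    inj : ∀ {i j} → f i ≡ f j → i ≡ j
    inj {Fin.zero}         {Fin.zero}         _  = ≡.refl
    inj {Fin.zero}         {Fin.suc Fin.zero} eq = ⊥-elim (0≢1 eq)
    inj {Fin.suc Fin.zero} {Fin.zero}         eq = ⊥-elim (0≢1 (≡.sym eq))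
    inj {Fin.suc Fin.zero} {Fin.suc Fin.zero} _  = ≡.refl

  -- Translation by 1 permutes the field, so the sum of all elements equals itself plus `order`
  -- times 1.
  order·1≈0 : order · 1# ≈ 0#
  order·1≈0 = ∙-cancelʳ (Σ+.sum elt) _ _ (begin
    order · 1# + Σ+.sum elt ≈⟨ +-congʳ (Σ+.sum-replicate order) ⟨
    Σ+.sum (replicate order 1#) + Σ+.sum elt ≈⟨ Σ+.∑-distrib-+ (replicate order 1#) elt ⟨
    Σ+.sum (λ i → 1# + elt i) ≈⟨ Σ+.sum-cong-≋ (λ i → elt-index {1# + elt i} tt) ⟨
    Σ+.sum (λ i → elt (π ⟨$⟩ʳ i)) ≈⟨ Σ+.sum-permute elt π ⟨
    Σ+.sum elt ≈⟨ +-identityˡ _ ⟨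
    0# + Σ+.sum elt ∎)
    where
    translate : Carrier → Fin order → Fin order
    translate a i = index {a + elt i} tt
    cancel : ∀ a b → a + b ≈ 0# → ∀ {i j} → i ≡ translate b j → translate a i ≡ j
    cancel a b ab {i} {j} ≡.refl = elt-inj (begin
      elt (translate a i) ≈⟨ elt-index {a + elt i} tt ⟩
      a + elt i ≈⟨ +-congˡ (elt-index {b + elt j} tt) ⟩
      a + (b + elt j) ≈⟨ +-assoc a b _ ⟨
      a + b + elt j ≈⟨ +-congʳ ab ⟩
      0# + elt j ≈⟨ +-identityˡ _ ⟩
      elt j ∎)
    π : Permutation order order
    π = record
      { to = translate 1# ; from = translate (- 1#) ; to-cong = ≡.cong _ ; from-cong = ≡.cong _
      ; inverse = cancel 1# (- 1#) (-‿inverseʳ 1#) , cancel (- 1#) 1# (-‿inverseˡ 1#) }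

  [p^n]·1 : ∀ p n → (p ℕ.^ n) · 1# ≈ (p · 1#) ^ n
  [p^n]·1 p zero    = +-identityʳ 1#
  [p^n]·1 p (suc n) = trans (×1-homo-* p (p ℕ.^ n)) (*-congˡ ([p^n]·1 p n))

  p·1≈0 : ∀ p n → order ≡ p ℕ.^ n → p · 1# ≈ 0#
  p·1≈0 p n eq = x^n≈0⇒x≈0 n (begin
    (p · 1#) ^ n ≈⟨ [p^n]·1 p n ⟨
    (p ℕ.^ n) · 1# ≡⟨ ≡.cong (_· 1#) eq ⟨
    order · 1# ≈⟨ order·1≈0 ⟩
    0# ∎)

-- Powers equal to 1, root counting and value sets

module PowerLaws {c ℓ} (R : CommutativeRing c ℓ) where
  open CommutativeRing R
  open SemiringExp semiring using (_^_; ^-congˡ; ^-congʳ; ^-homo-*; ^-assocʳ)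
  open SetoidReasoning setoid

  1^n≈1 : ∀ n → 1# ^ n ≈ 1#
  1^n≈1 zero    = refl
  1^n≈1 (suc n) = trans (*-identityˡ _) (1^n≈1 n)

  x^m≈1⇒x^[k*m]≈1 : ∀ {x m} k → x ^ m ≈ 1# → x ^ (k ℕ.* m) ≈ 1#
  x^m≈1⇒x^[k*m]≈1 {x} {m} k p = begin
    x ^ (k ℕ.* m) ≈⟨ ^-congʳ x (ℕ.*-comm k m) ⟩
    x ^ (m ℕ.* k) ≈⟨ ^-assocʳ x m k ⟨
    (x ^ m) ^ k ≈⟨ ^-congˡ k p ⟩
    1# ^ k ≈⟨ 1^n≈1 k ⟩
    1# ∎

  -- Bézout's identity in the natural numbers puts the gcd on the side of one multiple, so x^gcd is
  -- first multiplied by a power that equals 1.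
  x^gcd≈1 : ∀ {x} m n → x ^ m ≈ 1# → x ^ n ≈ 1# → x ^ gcd m n ≈ 1#
  x^gcd≈1 {x} m n p q with Bézout.identity (gcd-GCD m n)
  ... | Bézout.+- a b eq = begin
    x ^ gcd m n ≈⟨ *-identityʳ _ ⟨
    x ^ gcd m n * 1# ≈⟨ *-congˡ (x^m≈1⇒x^[k*m]≈1 b q) ⟨
    x ^ gcd m n * x ^ (b ℕ.* n) ≈⟨ ^-homo-* x (gcd m n) (b ℕ.* n) ⟨
    x ^ (gcd m n ℕ.+ b ℕ.* n) ≈⟨ ^-congʳ x eq ⟩
    x ^ (a ℕ.* m) ≈⟨ x^m≈1⇒x^[k*m]≈1 a p ⟩
    1# ∎
  ... | Bézout.-+ a b eq = begin
    x ^ gcd m n ≈⟨ *-identityʳ _ ⟨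
    x ^ gcd m n * 1# ≈⟨ *-congˡ (x^m≈1⇒x^[k*m]≈1 a p) ⟨
    x ^ gcd m n * x ^ (a ℕ.* m) ≈⟨ ^-homo-* x (gcd m n) (a ℕ.* m) ⟨
    x ^ (gcd m n ℕ.+ a ℕ.* m) ≈⟨ ^-congʳ x eq ⟩
    x ^ (b ℕ.* n) ≈⟨ x^m≈1⇒x^[k*m]≈1 b q ⟩
    1# ∎

module RootCounting {c ℓ} (K : Field c ℓ) where
  open Field K hiding (_-_)
  open Polynomials rawRing
  open PolynomialRing commutativeRing
  open Evaluation commutativeRing
  open Degree commutativeRing
  open FieldPolynomials K
  open PowerLaws commutativeRing
  open SemiringExp semiring using (_^_; ^-congˡ)
  open SetoidReasoning setoid

  roots≤degree : ∀ {n D} f → HasDegree f D → (r : Fin n → Carrier) → (∀ {i j} → r i ≈ r j → i ≡ j) →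
                 (∀ i → eval f (r i) ≈ 0#) → n ≤ D
  roots≤degree {n} {D} f d r inj z = ℕ.≮⇒≥ λ D<n →
    proj₁ d (at (roots⇒≋[] n f r inj z (Below-mono {f = f} D<n (proj₂ d))) D)

  fixer : ℕ → Poly
  fixer m = (X ^ₚ suc m) +ₚ map (-_) X

  eval-fixer : ∀ m x → eval (fixer m) x ≈ x ^ suc m + - x
  eval-fixer m x = trans (eval-+ (X ^ₚ suc m) (map (-_) X) x)
    (+-cong (trans (eval-^ X (suc m) x) (^-congˡ (suc m) (eval-X x))) (trans (eval-neg X x) (-‿cong (eval-X x))))

  fixer-root : ∀ m {x} → x ^ suc m ≈ x → eval (fixer m) x ≈ 0#
  fixer-root m {x} p = trans (eval-fixer m x) (trans (+-congʳ p) (-‿inverseʳ x))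

  Lead-fixer : ∀ m → Lead (suc (suc m)) 1# (fixer (suc m))
  Lead-fixer m = Lead-+-Below {g = map (-_) X} (Lead-X^ (suc (suc m)))
    (Below-mono {f = map (-_) X} (s≤s (s≤s z≤n)) (above (Lead-neg {f = X} Lead-X)))

  -- The points are roots of X^(m+1) - X; the condition on m keeps this polynomial from being X - X
  -- = 0.
  fixed-count : ∀ {n} m → 1 ≤ m → (r : Fin n → Carrier) → (∀ {i j} → r i ≈ r j → i ≡ j) →
                (∀ i → r i ^ suc m ≈ r i) → n ≤ suc m
  fixed-count (suc m) _ r inj z =
    roots≤degree (fixer (suc m)) (Lead⇒HasDegree (0≉1 ∘ sym) (Lead-fixer m)) r inj (λ i → fixer-root (suc m) (z i))

  x^[1+m]≈x⇒x^m≈1 : ∀ {x} m → ¬ (x ≈ 0#) → x ^ suc m ≈ x → x ^ m ≈ 1#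
  x^[1+m]≈x⇒x^m≈1 m x≉0 p = *-cancelˡ x≉0 (trans p (sym (*-identityʳ _)))

  x^m≈1⇒x^[1+m]≈x : ∀ {x} m → x ^ m ≈ 1# → x ^ suc m ≈ x
  x^m≈1⇒x^[1+m]≈x m p = trans (*-congˡ p) (*-identityʳ _)

  -- With g = gcd(m, b), every point also satisfies t^(g+1) = t. Such points number at most g + 1,
  -- but there are more than m of them, so g ≥ m and therefore m = g divides b.
  fixed-∣ : ∀ {n} m b → 1 ≤ m → m < n → (r : Fin n → Carrier) → (∀ {i j} → r i ≈ r j → i ≡ j) →
            (∀ i → r i ^ suc m ≈ r i) → (∀ i → r i ^ suc b ≈ r i) → m ∣ b
  fixed-∣ {n} m b 1≤m m<n r inj p q = ≡.subst (_∣ b) g≡m (gcd[m,n]∣n m b)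
    where
    g = gcd m b
    1≤g : 1 ≤ g
    1≤g = ℕ.>-nonZero⁻¹ g {{ℕ.≢-nonZero λ g≡0 → ℕ.<⇒≢ 1≤m (≡.sym (ℕ.0∣⇒≡0 (≡.subst (_∣ m) g≡0 (gcd[m,n]∣m m b))))}}
    fixed : ∀ i → r i ^ suc g ≈ r i
    fixed i with r i ≟ 0#
    ... | yes z = trans (trans (*-congʳ z) (zeroˡ _)) (sym z)
    ... | no nz = x^m≈1⇒x^[1+m]≈x g (x^gcd≈1 m b (x^[1+m]≈x⇒x^m≈1 m nz (p i)) (x^[1+m]≈x⇒x^m≈1 b nz (q i)))
    g≡m : g ≡ m
    g≡m = ℕ.≤-antisym (ℕ.∣⇒≤ {{ℕ.>-nonZero 1≤m}} (gcd[m,n]∣m m b)) (ℕ.≤-pred (ℕ.≤-trans m<n (fixed-count g 1≤g r inj fixed)))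

  -- The product of the f - s_i. When the s_i are all the values of f, it vanishes on the whole
  -- field, so q is at most the number of values times deg f.
  shiftedProduct : ∀ {n} → Poly → (Fin n → Carrier) → Poly
  shiftedProduct {zero}  f s = const 1#
  shiftedProduct {suc n} f s = (f +ₚ const (- s Fin.zero)) *ₚ shiftedProduct f (s ∘ Fin.suc)

  HasDegree-shiftedProduct : ∀ {n D} f (s : Fin n → Carrier) → HasDegree f (suc D) → HasDegree (shiftedProduct f s) (n ℕ.* suc D)
  HasDegree-shiftedProduct {zero}  f s d = Lead⇒HasDegree (0≉1 ∘ sym) (Lead-const 1#)
  HasDegree-shiftedProduct {suc n} f s d = HasDegree-* (f +ₚ const (- s Fin.zero)) (shiftedProduct f (s ∘ Fin.suc))
    (Lead⇒HasDegree (proj₁ d) (Lead-+-Below {g = const (- s Fin.zero)} (HasDegree⇒Lead f d) (λ where (suc i) _ → refl)))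
    (HasDegree-shiftedProduct f (s ∘ Fin.suc) d)

  shiftedProduct-root : ∀ {n} f (s : Fin n → Carrier) i {x} → s i ≈ eval f x → eval (shiftedProduct f s) x ≈ 0#
  shiftedProduct-root {suc n} f s i {x} p = trans (eval-* (f +ₚ const (- s Fin.zero)) (shiftedProduct f (s ∘ Fin.suc)) x) (zero-factor i p)
    where
    zero-factor : ∀ i → s i ≈ eval f x → eval (f +ₚ const (- s Fin.zero)) x * eval (shiftedProduct f (s ∘ Fin.suc)) x ≈ 0#
    zero-factor Fin.zero p = trans (*-congʳ (begin
      eval (f +ₚ const (- s Fin.zero)) x ≈⟨ eval-+ f (const (- s Fin.zero)) x ⟩
      eval f x + eval (const (- s Fin.zero)) x ≈⟨ +-cong (sym p) (eval-const _ x) ⟩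
      s Fin.zero + - s Fin.zero ≈⟨ -‿inverseʳ _ ⟩
      0# ∎)) (zeroˡ _)
    zero-factor (Fin.suc i) p = trans (*-congˡ (shiftedProduct-root f (s ∘ Fin.suc) i p)) (zeroʳ _)

module ValueSets {c ℓ} (F : FiniteField c ℓ) where
  open FiniteField F hiding (_-_)
  open Polynomials rawRing
  open PolynomialRing commutativeRing
  open Evaluation commutativeRing
  open Degree commutativeRing
  open FieldPolynomials baseField
  open RootCounting baseField
  open FiniteFieldProperties F
  open Enumeration
  open SemiringExp semiring using (_^_; ^-congˡ)

  q≤size*degree : ∀ {n D} f → HasDegree f (suc D) → Enumeration (ValueSet F f) n → order ≤ n ℕ.* suc D
  q≤size*degree {n} f d E = roots≤degree (shiftedProduct f (elt E)) (HasDegree-shiftedProduct f (elt E) d)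
    (elt everything) (elt-inj everything)
    λ i → shiftedProduct-root f (elt E) (index E (_ , refl)) (elt-index E (_ , refl))

  ValueSet? : ∀ f → Decidable (ValueSet F f)
  ValueSet? f b = any? (λ α → eval f α ≟ b) (λ p → trans (eval-congʳ f (sym p)))

  ValueSet-resp : ∀ f {x y} → x ≈ y → x ∈ ValueSet F f → y ∈ ValueSet F f
  ValueSet-resp f p (α , e) = α , trans e p

  -- The values are roots of X ^ (1 + m) - X and, by degree, there are more than m of them.
  full-ValueSet : ∀ {D m} f → HasDegree f (suc D) → 1 ≤ m → m ℕ.* suc D < order →
                  (∀ α → eval f α ^ suc m ≈ eval f α) →
                  Enumeration (ValueSet F f) (suc m) × ValueSet F f ≐ (λ t → t ^ suc m ≈ t)
  full-ValueSet {D} {m} f d 1≤m mD<q fixed = conclude (enumerate (ValueSet? f) (ValueSet-resp f))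
    where
    V : Pred Carrier _
    V = ValueSet F f
    values-fixed : ∀ {t} → t ∈ V → t ^ suc m ≈ t
    values-fixed (α , p) = trans (^-congˡ (suc m) (sym p)) (trans (fixed α) p)
    size≡1+m : ∀ {N} → Enumeration V N → N ≡ suc m
    size≡1+m E = ℕ.≤-antisym (fixed-count m 1≤m (elt E) (elt-inj E) (values-fixed ∘ elt∈ E))
      (ℕ.≰⇒> λ N≤m → ℕ.<-irrefl ≡.refl (ℕ.≤-trans mD<q (ℕ.≤-trans (q≤size*degree f d E) (ℕ.*-monoˡ-≤ (suc D) N≤m))))
    attained : Enumeration V (suc m) → ∀ t → t ^ suc m ≈ t → t ∈ V
    attained E t t-fixed with ValueSet? f t
    ... | yes t∈ = t∈
    -- A fixed point t outside the value set, joined to the m + 1 values, would give m + 2 roots of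
    -- X^(m+1) - X.
    ... | no  t∉ = ⊥-elim (ℕ.<-irrefl ≡.refl (fixed-count m 1≤m r r-inj r-fixed))
      where
      r : Fin (suc (suc m)) → Carrier
      r Fin.zero    = t
      r (Fin.suc i) = elt E i
      r-inj : ∀ {i j} → r i ≈ r j → i ≡ j
      r-inj {Fin.zero}  {Fin.zero}  p = ≡.refl
      r-inj {Fin.zero}  {Fin.suc j} p = ⊥-elim (t∉ (ValueSet-resp f (sym p) (elt∈ E j)))
      r-inj {Fin.suc i} {Fin.zero}  p = ⊥-elim (t∉ (ValueSet-resp f p (elt∈ E i)))
      r-inj {Fin.suc i} {Fin.suc j} p = ≡.cong Fin.suc (elt-inj E p)
      r-fixed : ∀ i → r i ^ suc m ≈ r i
      r-fixed Fin.zero    = t-fixed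
      r-fixed (Fin.suc i) = values-fixed (elt∈ E i)
    conclude : ∃ (Enumeration V) → Enumeration V (suc m) × V ≐ (λ t → t ^ suc m ≈ t)
    conclude (N , E) = E′ , values-fixed , λ {t} → attained E′ t
      where
      E′ : Enumeration V (suc m)
      E′ = ≡.subst (Enumeration V) (size≡1+m E) E

-- Additive spans in characteristic p and the smallest subfield containing a set

module AdditiveSpan {c ℓ} (F : FiniteField c ℓ) (p n : ℕ) (p-prime : Prime p) (order≡p^n : FiniteField.order F ≡ p ℕ.^ n) where
  open FiniteField F hiding (_-_)
  open IntegerSolver commutativeRing using (solve; _:=_; _:+_; :-_)
  open FieldPolynomials baseField using (*-cancelˡ)
  open FiniteFieldProperties F
  open Enumeration
  open CommutativeSemiringExp commutativeSemiring using (_^_)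
  open SemiringMult semiring using (×-congʳ; ×-congˡ; ×-homo-+; ×-assocˡ; ×-assoc-*) renaming (_×_ to _·_)
  open SetoidReasoning setoid
  open import Algebra.Properties.Group +-group using (∙-cancelˡ; inverseˡ-unique; inverseʳ-unique)

  instance
    p-nonZero : ℕ.NonZero p
    p-nonZero = prime⇒nonZero p-prime

  p·x≈0 : ∀ x → p · x ≈ 0#
  p·x≈0 x = begin
    p · x ≈⟨ ×-congʳ p (*-identityˡ x) ⟨
    p · (1# * x) ≈⟨ ×-assoc-* p 1# x ⟨
    p · 1# * x ≈⟨ *-congʳ (p·1≈0 p n order≡p^n) ⟩
    0# * x ≈⟨ zeroˡ x ⟩
    0# ∎

  [k*p]·x≈0 : ∀ k x → (k ℕ.* p) · x ≈ 0#
  [k*p]·x≈0 zero    x = refl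
  [k*p]·x≈0 (suc k) x = trans (×-homo-+ x p (k ℕ.* p)) (trans (+-cong (p·x≈0 x) ([k*p]·x≈0 k x)) (+-identityˡ 0#))

  ·-mod : ∀ n x → n · x ≈ (n % p) · x
  ·-mod n x = begin
    n · x ≈⟨ ×-congˡ (m≡m%n+[m/n]*n n p) ⟩
    (n % p ℕ.+ n / p ℕ.* p) · x ≈⟨ ×-homo-+ x (n % p) _ ⟩
    (n % p) · x + (n / p ℕ.* p) · x ≈⟨ +-congˡ ([k*p]·x≈0 (n / p) x) ⟩
    (n % p) · x + 0# ≈⟨ +-identityʳ _ ⟩
    (n % p) · x ∎

  record IsAdditive {s} (G : Pred Carrier s) : Set (c ⊔ ℓ ⊔ s) where
    field
      resp   : ∀ {x y} → x ≈ y → x ∈ G → y ∈ G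
      0∈     : 0# ∈ G
      +-clos : ∀ {x y} → x ∈ G → y ∈ G → x + y ∈ G

    ·-clos : ∀ n {x} → x ∈ G → n · x ∈ G
    ·-clos zero    x∈ = 0∈
    ·-clos (suc n) x∈ = +-clos x∈ (·-clos n x∈)

    -- In characteristic p the negative of x is the multiple (p - 1) x.
    neg : ∀ {x} → x ∈ G → - x ∈ G
    neg {x} x∈ = resp (inverseʳ-unique x ((p ∸ 1) · x) (trans (×-congˡ {x} (ℕ.suc-pred p)) (p·x≈0 x))) (·-clos (p ∸ 1) x∈)

    -- k is invertible modulo p: by Bézout some multiple of k x is x or -x.
    divide : ∀ {k x} → 0 < k → k < p → k · x ∈ G → x ∈ G
    divide {k} {x} 0<k k<p kx∈ with coprime-Bézout (prime⇒coprime p-prime {{ℕ.>-nonZero 0<k}} k<p)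
    ... | Bézout.+- a b eq = resp (sym (inverseˡ-unique x (b · (k · x)) (begin
      x + b · (k · x) ≈⟨ +-congˡ (×-assocˡ x b k) ⟩
      (1 ℕ.+ b ℕ.* k) · x ≈⟨ ×-congˡ eq ⟩
      (a ℕ.* p) · x ≈⟨ [k*p]·x≈0 a x ⟩
      0# ∎))) (neg (·-clos b kx∈))
    ... | Bézout.-+ a b eq = resp (begin
      b · (k · x) ≈⟨ ×-assocˡ x b k ⟩
      (b ℕ.* k) · x ≈⟨ ×-congˡ eq ⟨
      x + (a ℕ.* p) · x ≈⟨ +-congˡ ([k*p]·x≈0 a x) ⟩
      x + 0# ≈⟨ +-identityʳ x ⟩
      x ∎) (·-clos b kx∈)

  -- `minimal` is the induction principle of the span: an additive property that holds for the
  -- generators holds on all of `G`. The size is recorded as a power of p because that is the form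
  -- in which (C) asks for it.
  record Span {n} (g : Fin n → Carrier) : Set (lsuc (c ⊔ ℓ)) where
    field
      G          : Pred Carrier (c ⊔ ℓ)
      dim        : ℕ
      basis      : Enumeration G (p ℕ.^ dim)
      isAdditive : IsAdditive G
      contains   : ∀ i → g i ∈ G
      minimal    : (H : Pred Carrier (c ⊔ ℓ)) → IsAdditive H → (∀ i → g i ∈ H) → G ⊆ H

  module Extend {G : Pred Carrier (c ⊔ ℓ)} {N} (E : Enumeration G N) (isAdditive : IsAdditive G)
    (x₀ : Carrier) (x₀∉ : ¬ (x₀ ∈ G)) where
    open IsAdditive isAdditive

    -- G extended by the multiples of x₀. Multiplicities range over `Fin p`, which makes the
    -- representation unique and hence the size p times that of G.
    G′ : Pred Carrier (c ⊔ ℓ)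
    G′ x = ∃₂ λ (j : Fin p) y → y ∈ G × x ≈ toℕ j · x₀ + y

    intro : ∀ n {x y} → y ∈ G → x ≈ n · x₀ + y → x ∈ G′
    intro n {x} {y} y∈ eq = fromℕ< (m%n<n n p) , y , y∈ , (begin
      x ≈⟨ eq ⟩
      n · x₀ + y ≈⟨ +-congʳ (·-mod n x₀) ⟩
      (n % p) · x₀ + y ≈⟨ +-congʳ (×-congˡ (Fin.toℕ-fromℕ< (m%n<n n p))) ⟨
      toℕ (fromℕ< (m%n<n n p)) · x₀ + y ∎)

    isAdditive′ : IsAdditive G′
    isAdditive′ = record
      { resp   = λ p (j , y , y∈ , eq) → j , y , y∈ , trans (sym p) eq
      ; 0∈     = intro 0 0∈ (sym (+-identityˡ 0#))
      ; +-clos = λ {x} {x′} (j , y , y∈ , eq) (j′ , y′ , y′∈ , eq′) → intro (toℕ j ℕ.+ toℕ j′) (+-clos y∈ y′∈) (begin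
          x + x′ ≈⟨ +-cong eq eq′ ⟩
          (toℕ j · x₀ + y) + (toℕ j′ · x₀ + y′) ≈⟨ solve 4 (λ a b c d → (a :+ b) :+ (c :+ d) := (a :+ c) :+ (b :+ d)) refl _ _ _ _ ⟩
          (toℕ j · x₀ + toℕ j′ · x₀) + (y + y′) ≈⟨ +-congʳ (×-homo-+ x₀ (toℕ j) (toℕ j′)) ⟨
          (toℕ j ℕ.+ toℕ j′) · x₀ + (y + y′) ∎)
      }

    -- Equality would put (b - a) x₀ into G with 0 < b - a < p, and `divide` would then put x₀
    -- itself there.
    separate : ∀ {a b y y′} → a < b → b < p → y ∈ G → y′ ∈ G → ¬ (a · x₀ + y ≈ b · x₀ + y′)
    separate {a} {b} {y} {y′} a<b b<p y∈ y′∈ eq =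
      x₀∉ (divide (ℕ.m<n⇒0<n∸m a<b) (ℕ.≤-<-trans (ℕ.m∸n≤m b a) b<p) (resp (begin
        y + - y′ ≈⟨ +-congʳ (∙-cancelˡ (a · x₀) _ _ (begin
            a · x₀ + y ≈⟨ eq ⟩
            b · x₀ + y′ ≈⟨ +-congʳ (×-congˡ (ℕ.m+[n∸m]≡n (ℕ.<⇒≤ a<b))) ⟨
            (a ℕ.+ (b ∸ a)) · x₀ + y′ ≈⟨ +-congʳ (×-homo-+ x₀ a (b ∸ a)) ⟩
            (a · x₀ + (b ∸ a) · x₀) + y′ ≈⟨ +-assoc _ _ _ ⟩
            a · x₀ + ((b ∸ a) · x₀ + y′) ∎)) ⟩
        ((b ∸ a) · x₀ + y′) + - y′ ≈⟨ solve 2 (λ u v → (u :+ v) :+ :- v := u) refl _ _ ⟩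
        (b ∸ a) · x₀ ∎) (+-clos y∈ (neg y′∈))))

    unique : ∀ {y y′} (j j′ : Fin p) → y ∈ G → y′ ∈ G → toℕ j · x₀ + y ≈ toℕ j′ · x₀ + y′ → j ≡ j′
    unique j j′ y∈ y′∈ eq with ℕ.<-cmp (toℕ j) (toℕ j′)
    ... | tri< j<j′ _ _ = ⊥-elim (separate j<j′ (Fin.toℕ<n j′) y∈ y′∈ eq)
    ... | tri≈ _ j≡j′ _ = Fin.toℕ-injective j≡j′
    ... | tri> _ _ j′<j = ⊥-elim (separate j′<j (Fin.toℕ<n j) y′∈ y∈ (sym eq))

    pair : Fin p × Fin N → Carrier
    pair (j , k) = toℕ j · x₀ + elt E k

    pair-inj : ∀ u v → pair u ≈ pair v → u ≡ v
    pair-inj (j , k) (j′ , k′) eq with unique j j′ (elt∈ E k) (elt∈ E k′) eq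
    ... | ≡.refl = ≡.cong (j ,_) (elt-inj E (∙-cancelˡ _ _ _ eq))

    E′ : Enumeration G′ (p ℕ.* N)
    E′ = record
      { elt       = pair ∘ remQuot N
      ; elt∈      = λ i → let (j , k) = remQuot N i in j , elt E k , elt∈ E k , refl
      ; elt-inj   = λ {i} {i′} eq → ≡.trans (≡.sym (Fin.combine-remQuot {p} N i))
                      (≡.trans (≡.cong (λ (j , k) → combine j k) (pair-inj (remQuot N i) (remQuot N i′) eq)) (Fin.combine-remQuot {p} N i′))
      ; index     = λ (j , y , y∈ , _) → combine j (index E y∈)
      ; elt-index = λ {x} (j , y , y∈ , eq) → begin
          pair (remQuot N (combine j (index E y∈))) ≡⟨ ≡.cong pair (Fin.remQuot-combine j (index E y∈)) ⟩
          toℕ j · x₀ + elt E (index E y∈) ≈⟨ +-congˡ (elt-index E y∈) ⟩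
          toℕ j · x₀ + y ≈⟨ eq ⟨
          x ∎
      }

  member? : ∀ {s n} {S : Pred Carrier s} → Enumeration S n → (∀ {x y} → x ≈ y → x ∈ S → y ∈ S) → Decidable S
  member? E resp x = map′ (λ (i , eq) → resp eq (elt∈ E i)) (λ x∈ → index E x∈ , elt-index E x∈)
    (Fin.any? λ i → elt E i ≟ x)

  -- A generator that already lies in the span adds nothing, any other one extends it by a factor p.
  -- The case distinction is decidable because the span built so far is enumerated.
  span : ∀ {n} (g : Fin n → Carrier) → Span g
  span {zero} g = record
    { G          = λ x → Lift c (x ≈ 0#)
    ; dim        = 0
    ; basis      = record
      { elt = λ _ → 0# ; elt∈ = λ _ → lift refl ; elt-inj = λ { {Fin.zero} {Fin.zero} _ → ≡.refl }
      ; index = λ _ → Fin.zero ; elt-index = λ (lift x≈0) → sym x≈0 }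
    ; isAdditive = record
      { resp = λ x≈y (lift x≈0) → lift (trans (sym x≈y) x≈0)
      ; 0∈ = lift refl
      ; +-clos = λ (lift x≈0) (lift y≈0) → lift (trans (+-cong x≈0 y≈0) (+-identityˡ 0#)) }
    ; contains   = λ ()
    ; minimal    = λ H H-additive _ (lift x≈0) → IsAdditive.resp H-additive (sym x≈0) (IsAdditive.0∈ H-additive)
    }
  span {suc n} g with span (g ∘ Fin.suc)
  ... | S with member? (Span.basis S) (IsAdditive.resp (Span.isAdditive S)) (g Fin.zero)
  ...   | yes g₀∈ = record
    { G          = Span.G S
    ; dim        = Span.dim S
    ; basis      = Span.basis S
    ; isAdditive = Span.isAdditive S
    ; contains   = λ { Fin.zero → g₀∈ ; (Fin.suc i) → Span.contains S i }
    ; minimal    = λ H H-additive g∈ → Span.minimal S H H-additive (g∈ ∘ Fin.suc)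
    }
  ...   | no g₀∉ = record
    { G          = G′
    ; dim        = suc (Span.dim S)
    ; basis      = E′
    ; isAdditive = isAdditive′
    ; contains   = λ { Fin.zero    → intro 1 (IsAdditive.0∈ (Span.isAdditive S)) (sym (trans (+-identityʳ _) (+-identityʳ _)))
                     ; (Fin.suc i) → intro 0 (Span.contains S i) (sym (+-identityˡ _)) }
    ; minimal    = λ H H-additive g∈ (j , y , y∈ , eq) → let open IsAdditive H-additive in
        resp (sym eq) (+-clos (·-clos (toℕ j) (g∈ Fin.zero)) (Span.minimal S H H-additive (g∈ ∘ Fin.suc) y∈))
    }
    where open Extend (Span.basis S) (Span.isAdditive S) (g Fin.zero) g₀∉

  module SubfieldSpan {n} {S : Pred Carrier (c ⊔ ℓ)} (E : Enumeration S n)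
    (S-resp : ∀ {x y} → x ≈ y → x ∈ S → y ∈ S) (1∈S : 1# ∈ S) (S-* : ∀ {x y} → x ∈ S → y ∈ S → x * y ∈ S)
    (S-span : Span (elt E)) where
    open Span S-span
    open IsAdditive isAdditive

    S⊆G : S ⊆ G
    S⊆G x∈ = resp (elt-index E x∈) (contains (index E x∈))

    -- The elements x with x T ⊆ G. Minimality of G is applied to this set twice: with T = S, where
    -- S is closed under products, and then with T = G, which makes G a ring.
    multiplier : (T : Pred Carrier (c ⊔ ℓ)) → IsAdditive (λ x → ∀ {y} → y ∈ T → x * y ∈ G)
    multiplier T = record
      { resp   = λ p x∈ y∈ → resp (*-congʳ p) (x∈ y∈)
      ; 0∈     = λ y∈ → resp (sym (zeroˡ _)) 0∈
      ; +-clos = λ x∈ x′∈ y∈ → resp (sym (distribʳ _ _ _)) (+-clos (x∈ y∈) (x′∈ y∈))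
      }

    G*S : ∀ {x} → x ∈ G → ∀ {y} → y ∈ S → x * y ∈ G
    G*S = minimal (λ x → ∀ {y} → y ∈ S → x * y ∈ G) (multiplier S) λ i y∈ → S⊆G (S-* (elt∈ E i) y∈)

    G*G : ∀ {x} → x ∈ G → ∀ {y} → y ∈ G → x * y ∈ G
    G*G = minimal (λ x → ∀ {y} → y ∈ G → x * y ∈ G) (multiplier G) λ i y∈ → resp (*-comm _ _) (G*S y∈ (elt∈ E i))

    ^-clos : ∀ k {x} → x ∈ G → x ^ k ∈ G
    ^-clos zero    x∈ = S⊆G 1∈S
    ^-clos (suc k) x∈ = G*G x∈ (^-clos k x∈)

    -- From x^q = x the inverse of x is x^(q-2), so a subring of the finite field contains the
    -- inverses of its elements.
    inverse≈power : ∀ {x y} → x * y ≈ 1# → y ≈ x ^ (order ∸ 2)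
    inverse≈power {x} {y} xy≈1 = *-cancelˡ x≉0 (*-cancelˡ x≉0 (begin
      x * (x * y) ≈⟨ *-congˡ xy≈1 ⟩
      x * 1# ≈⟨ *-identityʳ x ⟩
      x ≈⟨ x^q≈x x ⟨
      x ^ order ≡⟨ ≡.cong (x ^_) (ℕ.m+[n∸m]≡n 2≤order) ⟨
      x * (x * x ^ (order ∸ 2)) ∎))
      where
      x≉0 : ¬ (x ≈ 0#)
      x≉0 x≈0 = 0≉1 (trans (sym (zeroˡ y)) (trans (*-congʳ (sym x≈0)) xy≈1))

    isSubfield : IsSubfield baseField G
    isSubfield = record
      { resp = resp ; 0∈ = 0∈ ; 1∈ = S⊆G 1∈S ; +-clos = +-clos ; neg = neg
      ; *-clos = λ x∈ y∈ → G*G x∈ y∈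
      ; inv = λ x∈ xy≈1 → resp (sym (inverse≈power xy≈1)) (^-clos (order ∸ 2) x∈) }

    isSmallest : IsSmallestSubfieldContaining baseField S G
    isSmallest = isSubfield , S⊆G , λ E′ _ E′-subfield S⊆E′ → minimal E′
      (record { resp = IsSubfield.resp E′-subfield ; 0∈ = IsSubfield.0∈ E′-subfield ; +-clos = IsSubfield.+-clos E′-subfield })
      (λ i → S⊆E′ (elt∈ E i))

-- Positive characteristic

m∣m^n : ∀ m n → n ≢ 0 → m ∣ m ℕ.^ n
m∣m^n m zero    n≢0 = ⊥-elim (n≢0 ≡.refl)
m∣m^n m (suc n) _   = m∣m*n (m ℕ.^ n)

prime∣n!⇒p≤n : ∀ {p} → Prime p → ∀ n → p ∣ n ! → p ≤ n
prime∣n!⇒p≤n p-prime zero    p∣1 = ⊥-elim (ℕ.<⇒≱ (ℕ.nonTrivial⇒n>1 _ {{prime⇒nonTrivial p-prime}}) (∣⇒≤ p∣1))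
prime∣n!⇒p≤n p-prime (suc n) p∣ with euclidsLemma (suc n) (n !) p-prime p∣
... | inj₁ p∣1+n = ∣⇒≤ p∣1+n
... | inj₂ p∣n!  = ℕ.m≤n⇒m≤1+n (prime∣n!⇒p≤n p-prime n p∣n!)

-- p divides p! = C(p,k) k! (p-k)!, but neither of the two factorials of smaller numbers.
prime∣pCk : ∀ {p k} → Prime p → 0 < k → k < p → p ∣ p C k
prime∣pCk {p@(suc p′)} {k} p-prime 0<k k<p with euclidsLemma (p C k) (k ! ℕ.* (p ∸ k) !) p-prime
  (≡.subst (p ∣_) (≡.sym factorials) (m∣m*n (p′ !)))
  where
  instance
    _ : ℕ.NonZero (k ! ℕ.* (p ∸ k) !)
    _ = k ℕ.!* (p ∸ k) !≢0
  factorials : (p C k) ℕ.* (k ! ℕ.* (p ∸ k) !) ≡ p !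
  factorials = ≡.trans (≡.cong (ℕ._* (k ! ℕ.* (p ∸ k) !)) (nCk≡n!/k![n-k]! (ℕ.<⇒≤ k<p))) (m/n*n≡m (k![n∸k]!∣n! (ℕ.<⇒≤ k<p)))
... | inj₁ p∣C = p∣C
... | inj₂ p∣d with euclidsLemma (k !) ((p ∸ k) !) p-prime p∣d
...   | inj₁ p∣k!     = ⊥-elim (ℕ.<⇒≱ k<p (prime∣n!⇒p≤n p-prime k p∣k!))
...   | inj₂ p∣[p-k]! = ⊥-elim (ℕ.<⇒≱ (ℕ.∸-monoʳ-< 0<k (ℕ.<⇒≤ k<p)) (prime∣n!⇒p≤n p-prime (p ∸ k) p∣[p-k]!))

module Characteristic {c ℓ} (R : CommutativeRing c ℓ) (p : ℕ) (p-prime : Prime p) where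
  open CommutativeRing R hiding (_-_)
  open CommutativeSemiringExp commutativeSemiring using (_^_)
  open SemiringMult semiring using (×-congʳ; ×-congˡ; ×-homo-+; ×-assoc-*; ×1-homo-*) renaming (_×_ to _·_)
  open SemiringSum semiring using (sum; sum-cong-≋; sum-init-last; sum-replicate-zero)
  open SetoidReasoning setoid

  private instance
    p-nonZero : ℕ.NonZero p
    p-nonZero = prime⇒nonZero p-prime

  module _ (p·1≈0 : p · 1# ≈ 0#) where

    p∣n⇒n·1≈0 : ∀ {n} → p ∣ n → n · 1# ≈ 0#
    p∣n⇒n·1≈0 (divides k ≡.refl) = trans (×1-homo-* k p) (trans (*-congˡ p·1≈0) (zeroʳ _))

    p∣n⇒n·x≈0 : ∀ {n} x → p ∣ n → n · x ≈ 0#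
    p∣n⇒n·x≈0 {n} x p∣n = begin
      n · x ≈⟨ ×-congʳ n (*-identityˡ x) ⟨
      n · (1# * x) ≈⟨ ×-assoc-* n 1# x ⟨
      n · 1# * x ≈⟨ *-congʳ (p∣n⇒n·1≈0 p∣n) ⟩
      0# * x ≈⟨ zeroˡ x ⟩
      0# ∎

    -- The remainder r of n modulo p also satisfies r · 1 = 0. If r were non-zero, Bézout's identity
    -- for p and r would give 1 = 0.
    n·1≈0⇒p∣n : ¬ (0# ≈ 1#) → ∀ n → n · 1# ≈ 0# → p ∣ n
    n·1≈0⇒p∣n 0≉1 n n·1≈0 with p ∣? n
    ... | yes p∣n = p∣n
    ... | no  p∤n = ⊥-elim (0≉1 (absurd (coprime-Bézout (prime⇒coprime p-prime {{r-nonZero}} (m%n<n n p)))))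
      where
      r = n % p
      r-nonZero : ℕ.NonZero r
      r-nonZero = ℕ.≢-nonZero (p∤n ∘ ℕ.m%n≡0⇒n∣m n p)
      r·1≈0 : r · 1# ≈ 0#
      r·1≈0 = begin
        r · 1# ≈⟨ +-identityʳ _ ⟨
        r · 1# + 0# ≈⟨ +-congˡ (p∣n⇒n·1≈0 (divides (n / p) ≡.refl)) ⟨
        r · 1# + (n / p ℕ.* p) · 1# ≈⟨ ×-homo-+ 1# r _ ⟨
        (r ℕ.+ n / p ℕ.* p) · 1# ≈⟨ ×-congˡ (m≡m%n+[m/n]*n n p) ⟨
        n · 1# ≈⟨ n·1≈0 ⟩
        0# ∎
      [k*r]·1≈0 : ∀ k → (k ℕ.* r) · 1# ≈ 0#
      [k*r]·1≈0 k = trans (×1-homo-* k r) (trans (*-congˡ r·1≈0) (zeroʳ _))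
      absurd : Bézout.Identity 1 p r → 0# ≈ 1#
      absurd (Bézout.+- a b eq) = begin
        0# ≈⟨ p∣n⇒n·1≈0 (divides a ≡.refl) ⟨
        (a ℕ.* p) · 1# ≈⟨ ×-congˡ eq ⟨
        1# + (b ℕ.* r) · 1# ≈⟨ +-congˡ ([k*r]·1≈0 b) ⟩
        1# + 0# ≈⟨ +-identityʳ 1# ⟩
        1# ∎
      absurd (Bézout.-+ a b eq) = begin
        0# ≈⟨ [k*r]·1≈0 b ⟨
        (b ℕ.* r) · 1# ≈⟨ ×-congˡ eq ⟨
        1# + (a ℕ.* p) · 1# ≈⟨ +-congˡ (p∣n⇒n·1≈0 (divides a ≡.refl)) ⟩
        1# + 0# ≈⟨ +-identityʳ 1# ⟩
        1# ∎

    private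
      -- All binomial coefficients strictly between the ends are divisible by p. Matching p with a
      -- successor lets the sum over `Fin (suc p)` split into its two ends and p - 1 middle terms.
      frobenius-+′ : ∀ p′ → p ≡ suc p′ → ∀ x y → (x + y) ^ p ≈ x ^ p + y ^ p
      frobenius-+′ p′ ≡.refl x y = begin
        (x + y) ^ p ≈⟨ B.theorem p x y ⟩
        t Fin.zero + sum (t ∘ Fin.suc) ≈⟨ +-congˡ (sum-init-last (t ∘ Fin.suc)) ⟩
        t Fin.zero + (sum (λ i → t (Fin.suc (inject₁ i))) + t (Fin.suc (fromℕ p′)))
          ≈⟨ +-cong t-first (+-cong (trans (sum-cong-≋ t-middle) (sum-replicate-zero p′)) t-last) ⟩
        y ^ p + (0# + x ^ p) ≈⟨ trans (+-congˡ (+-identityˡ _)) (+-comm _ _) ⟩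
        x ^ p + y ^ p ∎
        where
        module B = Binomial commutativeSemiring
        t : Fin (suc p) → Carrier
        t = B.binomialTerm x y p
        t-first : t Fin.zero ≈ y ^ p
        t-first = trans (+-identityʳ _) (*-identityˡ _)
        t-middle : ∀ i → t (Fin.suc (inject₁ i)) ≈ 0#
        t-middle i = p∣n⇒n·x≈0 _ (prime∣pCk p-prime (s≤s z≤n) (s≤s (≡.subst (_< p′) (≡.sym (Fin.toℕ-inject₁ i)) (Fin.toℕ<n i))))
        t-last : t (Fin.suc (fromℕ p′)) ≈ x ^ p
        t-last = begin
          (p C k) · (x ^ k * y ^ (p ∸ k)) ≡⟨ ≡.cong (λ k → (p C k) · (x ^ k * y ^ (p ∸ k))) k≡p ⟩
          (p C p) · (x ^ p * y ^ (p ∸ p)) ≡⟨ ≡.cong₂ (λ a b → a · (x ^ p * y ^ b)) (nCn≡1 p) (ℕ.n∸n≡0 p) ⟩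
          1 · (x ^ p * 1#) ≈⟨ trans (+-identityʳ _) (*-identityʳ _) ⟩
          x ^ p ∎
          where
          k = toℕ (Fin.suc (fromℕ p′))
          k≡p : k ≡ p
          k≡p = ≡.cong suc (Fin.toℕ-fromℕ p′)

    frobenius-+ : ∀ x y → (x + y) ^ p ≈ x ^ p + y ^ p
    frobenius-+ = frobenius-+′ (p ∸ 1) (≡.sym (ℕ.suc-pred p))

-- Reducible curves

module PowerDifference {c ℓ} (R : CommutativeRing c ℓ) where
  open CommutativeRing R hiding (_-_)
  open IntegerSolver R using (solve; _:=_; _:+_; _:*_; :-_)
  open CommutativeSemiringExp commutativeSemiring using (_^_)
  open SetoidReasoning setoid

  -- a^(w-1) + a^(w-2) b + ... + b^(w-1), and 0 for w = 0.
  cofactor : ℕ → Carrier → Carrier → Carrier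
  cofactor zero    a b = 0#
  cofactor (suc w) a b = a ^ w + b * cofactor w a b

  factor : ∀ w a b → a ^ w + - (b ^ w) ≈ (a + - b) * cofactor w a b
  factor zero    a b = trans (-‿inverseʳ 1#) (sym (zeroʳ _))
  factor (suc w) a b = begin
    a * a ^ w + - (b * b ^ w)
      ≈⟨ solve 4 (λ a u b v → a :* u :+ :- (b :* v) := (a :+ :- b) :* u :+ b :* (u :+ :- v)) refl a (a ^ w) b (b ^ w) ⟩
    (a + - b) * a ^ w + b * (a ^ w + - (b ^ w))
      ≈⟨ +-congˡ (*-congˡ (factor w a b)) ⟩
    (a + - b) * a ^ w + b * ((a + - b) * cofactor w a b)
      ≈⟨ solve 4 (λ a u b g → (a :+ :- b) :* u :+ b :* ((a :+ :- b) :* g) := (a :+ :- b) :* (u :+ b :* g)) refl a (a ^ w) b _ ⟩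
    (a + - b) * (a ^ w + b * cofactor w a b) ∎

-- Polynomials with zero derivative are p-th powers

module FrobeniusRoot {c ℓ} (K : Field c ℓ) (p : ℕ) (p-prime : Prime p) where
  open Field K hiding (_-_)
  open Polynomials rawRing
  open PolynomialRing commutativeRing
  open Degree commutativeRing
  open CommutativeSemiringExp commutativeSemiring using (_^_)
  open SemiringMult semiring using () renaming (_×_ to _·_)
  private
    module PE = CommutativeSemiringExp P.commutativeSemiring
  open SetoidReasoning P.setoid

  private instance
    p-nonZero : ℕ.NonZero p
    p-nonZero = prime⇒nonZero p-prime

  shift : ℕ → Poly → Poly
  shift zero    f = f
  shift (suc k) f = 0# ∷ shift k f

  X-*ₚ : ∀ f → (X *ₚ f) ≋ (0# ∷ f)
  X-*ₚ f = P.trans (shift-*ₚ (const 1#) f) (∷-cong refl (*ₚ-identityˡ f))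

  X^-*ₚ : ∀ k f → ((X ^ₚ k) *ₚ f) ≋ shift k f
  X^-*ₚ zero    f = *ₚ-identityˡ f
  X^-*ₚ (suc k) f = begin
    (X *ₚ (X ^ₚ k)) *ₚ f ≈⟨ *ₚ-assoc X (X ^ₚ k) f ⟩
    X *ₚ ((X ^ₚ k) *ₚ f) ≈⟨ X-*ₚ _ ⟩
    0# ∷ ((X ^ₚ k) *ₚ f) ≈⟨ ∷-cong refl (X^-*ₚ k f) ⟩
    shift (suc k) f ∎

  coeff-drop : ∀ k f i → coeff (drop k f) i ≡ coeff f (k ℕ.+ i)
  coeff-drop zero    f       i = ≡.refl
  coeff-drop (suc k) []      i = ≡.refl
  coeff-drop (suc k) (a ∷ f) i = coeff-drop k f i

  split : ∀ k f → (∀ i → i < k → coeff f i ≈ 0#) → f ≋ shift k (drop k f)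
  split zero    f       z = P.refl
  split (suc k) []      z = P.trans (P.sym 0∷[]≋[]) (∷-cong refl (P.trans (split k [] (λ _ _ → refl)) (P.reflexive (≡.cong (shift k) (drop-[] k)))))
    where
    drop-[] : ∀ k → drop k [] ≡ []
    drop-[] zero    = ≡.refl
    drop-[] (suc k) = ≡.refl
  split (suc k) (a ∷ f) z = ∷-cong (z 0 (s≤s z≤n)) (split k f (λ i i<k → z (suc i) (s≤s i<k)))

  const-^ : ∀ a n → (const a ^ₚ n) ≋ const (a ^ n)
  const-^ a zero    = P.refl
  const-^ a (suc n) = P.trans (*ₚ-congˡ (const a) (const-^ a n)) (const-*ₚ a (const (a ^ n)))

  module _ (p·1≈0 : p · 1# ≈ 0#) (root : ∀ n a → ∃ λ y → y ^ suc n ≈ a) where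

    open Characteristic polynomialRing p p-prime

    -- Write the polynomial as a + X^p r. If b^p = a and r = g^p, then additivity of the p-th power
    -- makes it (b + X g)^p. The bound n on the length drives the recursion, since r arises from
    -- `drop` and is not a structural subterm.
    p-root′ : ∀ n p′ → p ≡ suc p′ → ∀ f → length f ≤ n → (∀ i → ¬ (p ∣ i) → coeff f i ≈ 0#) → ∃ λ g → f ≋ (g ^ₚ p)
    p-root′ n       p′ ≡.refl []      len z = [] , P.refl
    p-root′ (suc n) p′ ≡.refl (a ∷ f) (s≤s len) z with p-root′ n p′ ≡.refl rest len-rest z-rest | root p′ a
      where
      rest : Poly
      rest = drop p′ f
      len-rest : length rest ≤ n
      len-rest = ≡.subst (_≤ n) (≡.sym (length-drop p′ f)) (ℕ.≤-trans (ℕ.m∸n≤m (length f) p′) len)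
      z-rest : ∀ i → ¬ (p ∣ i) → coeff rest i ≈ 0#
      z-rest i p∤i = trans (reflexive (coeff-drop p′ f i)) (z (suc (p′ ℕ.+ i)) (λ p∣p+i → p∤i (ℕ.∣m+n∣m⇒∣n p∣p+i ℕ.∣-refl)))
    ... | g , eq | b , b^p≈a = (b ∷ g) , (begin
      a ∷ f
        ≈⟨ ∷-cong (sym (+-identityʳ a)) (split p′ f (λ i i<p′ → z (suc i) (λ p∣1+i → ℕ.<⇒≱ (s≤s i<p′) (ℕ.∣⇒≤ p∣1+i)))) ⟩
      const a +ₚ shift p (drop p′ f)
        ≈⟨ P.+-cong {const a} (∷-cong (sym b^p≈a) P.refl) (P.trans (P.sym (X^-*ₚ p (drop p′ f))) (*ₚ-congˡ (X ^ₚ p) eq)) ⟩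
      const (b ^ p) +ₚ ((X ^ₚ p) *ₚ (g ^ₚ p))
        ≈⟨ P.+-cong (const-^ b p) (PE.^-distrib-* X g p) ⟨
      (const b ^ₚ p) +ₚ ((X *ₚ g) ^ₚ p)
        ≈⟨ frobenius-+ (n·1≈0⇒n·1≋[] {p} p·1≈0) (const b) (X *ₚ g) ⟨
      ((const b +ₚ (X *ₚ g)) ^ₚ p)
        ≈⟨ PE.^-congˡ p (P.trans (P.+-congˡ {const b} (X-*ₚ g)) (∷-cong (+-identityʳ b) P.refl)) ⟩
      ((b ∷ g) ^ₚ p) ∎)

    p-root : ∀ f → (∀ i → ¬ (p ∣ i) → coeff f i ≈ 0#) → ∃ λ g → f ≋ (g ^ₚ p)
    p-root f = p-root′ (length f) (p ∸ 1) (≡.sym (ℕ.suc-pred p)) f ℕ.≤-refl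

    -- The derivative has the coefficients i a_i, and i is invertible in the field unless p divides
    -- it.
    derivative≋[]⇒p-power : ∀ f → derivative f ≋ [] → ∃ λ g → f ≋ (g ^ₚ p)
    derivative≋[]⇒p-power f f′≋[] = p-root f coeff≈0
      where
      module CK = Characteristic commutativeRing p p-prime
      open FieldPolynomials K using (x*y≈0⇒y≈0)
      coeff≈0 : ∀ i → ¬ (p ∣ i) → coeff f i ≈ 0#
      coeff≈0 zero    p∤0 = ⊥-elim (p∤0 (divides 0 ≡.refl))
      coeff≈0 (suc i) p∤i = x*y≈0⇒y≈0 {suc i · 1#} (p∤i ∘ CK.n·1≈0⇒p∣n p·1≈0 0≉1 (suc i))
        (trans (SemiringMult.×-assoc-* semiring (suc i) 1# _)
        (trans (SemiringMult.×-congʳ semiring (suc i) (*-identityˡ _))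
        (trans (sym (coeff-derivative f i)) (at f′≋[] i))))

-- Reducibility of y^d = f(x) when f is a power

module Reducible {c ℓ} (K : Field c ℓ) where
  open Field K hiding (_-_)
  open PlaneCurves K
  open CurveDerivation K using (module AtPoint)
  open Evaluation commutativeRing
  open Degree commutativeRing
  open PolynomialRing commutativeRing
  open FieldPolynomials K using (x^n≈0⇒x≈0)
  private
    R₁ : CommutativeRing c ℓ
    R₁ = polynomialRing′
    module PR₁ = PolynomialRing R₁
    module P₂ = CommutativeRing PR₁.polynomialRing
    module PE₂ = CommutativeSemiringExp P₂.commutativeSemiring
    module PD₂ = PowerDifference PR₁.polynomialRing
  open K[x][y] using () renaming (_*ₚ_ to _*₂_; _+ₚ_ to _+₂_; _≈ₚ_ to _≈₂_; X to Y; const to const₂; Poly to Poly₂)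
  open CommutativeSemiringExp commutativeSemiring using (_^_)

  -- yᵈ - gʷ is divisible by yᴺ - g, and both it and its cofactor vanish at (x₀, 0).
  power-reducible : ∀ d N w f g → d ≡ suc N ℕ.* suc (suc w) → f ≋ (g ^ₚ suc (suc w)) →
                    ∀ x₀ → K[x].eval f x₀ ≈ 0# → ¬ IsIrreducibleCurve d f
  power-reducible d N w f g d≡ f≋ x₀ fx₀≈0 irr = contradict (SemiringRaw.Irreducible.split-∣1 irr {a +₂ map (map (-_)) b} {cof} (PR₁.at factorisation))
    where
    s : ℕ
    s = suc (suc w)
    a b cof : Poly₂
    a = Y PE₂.^ suc N
    b = const₂ g
    cof = PD₂.cofactor s a b

    const₂-^ : ∀ n → (const₂ g PE₂.^ n) PR₁.≋ const₂ (g ^ₚ n)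
    const₂-^ zero    = P₂.refl
    const₂-^ (suc n) = P₂.trans (PR₁.*ₚ-congˡ (const₂ g) (const₂-^ n)) (PR₁.const-*ₚ g (const₂ (g ^ₚ n)))

    -- The two exponentiations differ only in the equality of the underlying raw monoid.
    raw-^ : ∀ n → SemiringRaw._^_ (RawRing.rawSemiring K[x][y].rawRing) Y n ≡ Y PE₂.^ n
    raw-^ zero    = ≡.refl
    raw-^ (suc n) = ≡.cong (Y *₂_) (raw-^ n)

    factorisation : affineEquation d f PR₁.≋ ((a +₂ map (map (-_)) b) *₂ cof)
    factorisation = P₂.trans {affineEquation d f} {(a PE₂.^ s) +₂ map (map (-_)) (b PE₂.^ s)}
      (P₂.trans {affineEquation d f} (P₂.reflexive (≡.cong (_+₂ map (map (-_)) (const₂ f)) (raw-^ d))) (P₂.+-cong {x = Y PE₂.^ d} {y = a PE₂.^ s}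
        (P₂.trans (PE₂.^-congʳ Y d≡) (P₂.sym (PE₂.^-assocʳ Y (suc N) s)))
        (P₂.-‿cong {const₂ f} {b PE₂.^ s} (P₂.trans (PR₁.∷-cong (at f≋) P₂.refl) (P₂.sym (const₂-^ s))))))
      (PD₂.factor s a b)

    module E = AtPoint x₀ 0# 0# 0# 0# 0#
    open RawHom E.Φ₂ renaming (φ to ψ; φ-1 to ψ-1; φ-+ to ψ-+; φ-* to ψ-*; φ-neg to ψ-neg)

    -- A `RawHom` is not assumed to respect equality; for evaluation at a point this is checked on
    -- coefficients.
    ψ-cong : ∀ {u v} → u ≈₂ v → ψ u ≈ ψ v
    ψ-cong {u} {v} p = eval-cong {map (RawHom.φ E.Φ₁) u} {map (RawHom.φ E.Φ₁) v} 0# (coeffwise λ i → trans (E.H₁.coeff-map u i)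
      (trans (trans (E.φ₁≈eval (K[x][y].coeff u i)) (trans (eval-cong {K[x][y].coeff u i} {K[x][y].coeff v i} x₀ (coeffwise (p i))) (sym (E.φ₁≈eval (K[x][y].coeff v i))))) (sym (E.H₁.coeff-map v i))))

    ψ-a : ψ a ≈ 0#
    ψ-a = trans (ψ-* Y (Y PE₂.^ N)) (trans (*-congʳ (E.H₁.evalHom-X 0#)) (zeroˡ _))

    gx₀≈0 : K[x].eval g x₀ ≈ 0#
    gx₀≈0 = x^n≈0⇒x≈0 s (trans (sym (eval-^ g s x₀)) (trans (sym (eval-cong x₀ f≋)) fx₀≈0))

    ψ-b : ψ b ≈ 0#
    ψ-b = trans (E.φ₂-const g) (trans (E.φ₁≈eval g) gx₀≈0)

    ψ-a-b : ψ (a +₂ map (map (-_)) b) ≈ 0#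
    ψ-a-b = trans (ψ-+ a (map (map (-_)) b)) (trans (+-cong ψ-a (trans (ψ-neg b) (-‿cong ψ-b))) (-‿inverseʳ 0#))

    -- The exponent s is at least 2, so every term of the cofactor contains a or b, and both vanish
    -- at the point (x₀, 0).
    ψ-cof : ψ cof ≈ 0#
    ψ-cof = trans (ψ-+ (a PE₂.^ suc w) (b *₂ PD₂.cofactor (suc w) a b)) (trans
      (+-cong (trans (ψ-* a (a PE₂.^ w)) (trans (*-congʳ ψ-a) (zeroˡ _)))
              (trans (ψ-* b (PD₂.cofactor (suc w) a b)) (trans (*-congʳ ψ-b) (zeroˡ _))))
      (+-identityˡ 0#))

    open SemiringRaw (RawRing.rawSemiring K[x][y].rawRing) using () renaming (_∣_ to _∣₂_)
    open import Algebra.Definitions.RawMagma (RawRing.*-rawMagma K[x][y].rawRing) using (_,_)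

    -- Evaluation is multiplicative and sends 1 to 1, so a divisor of 1 has a non-zero value at
    -- every point.
    no-unit : ∀ {u} → ψ u ≈ 0# → ¬ (u ∣₂ RawRing.1# K[x][y].rawRing)
    no-unit {u} ψu≈0 (v , vu≈1) = 0≉1 (begin
      0# ≈⟨ trans (*-congˡ ψu≈0) (zeroʳ (ψ v)) ⟨
      ψ v * ψ u ≈⟨ ψ-* v u ⟨
      ψ (v *₂ u) ≈⟨ ψ-cong {v *₂ u} {RawRing.1# K[x][y].rawRing} vu≈1 ⟩
      ψ (RawRing.1# K[x][y].rawRing) ≈⟨ ψ-1 ⟩
      1# ∎)
      where open SetoidReasoning setoid

    contradict : (a +₂ map (map (-_)) b) ∣₂ RawRing.1# K[x][y].rawRing ⊎ cof ∣₂ RawRing.1# K[x][y].rawRing → ⊥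
    contradict (inj₁ u) = no-unit {a +₂ map (map (-_)) b} ψ-a-b u
    contradict (inj₂ u) = no-unit {cof} ψ-cof u

-- Frobenius nonclassical curves

module Closure {c ℓ c′ ℓ′} (F : FiniteField c ℓ) (F̄ : AlgebraicClosure (FiniteField.baseField F) c′ ℓ′)
  (p n : ℕ) (p-prime : Prime p) (order≡p^n : FiniteField.order F ≡ p ℕ.^ n) where
  module F = FiniteField F
  module F[x] = Polynomials F.rawRing
  open AlgebraicClosure F̄ using (closure; embed; embed-isHom; algClosed) public
  open Field closure hiding (_-_)
  open RingMorphisms F.rawRing rawRing using (module IsRingHomomorphism)
  open IsRingHomomorphism embed-isHom using (⟦⟧-cong) public
  open IsRingHomomorphism embed-isHom using (+-homo; *-homo; -‿homo; 0#-homo; 1#-homo)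
  open Polynomials rawRing using (eval; HasDegree)
  open PolynomialRing commutativeRing
  open Evaluation commutativeRing
  open CommutativeSemiringExp commutativeSemiring using (_^_)
  open SemiringMult semiring renaming (_×_ to _·_)
  private
    module FE = CommutativeSemiringExp F.commutativeSemiring
    module FM = SemiringMult F.semiring
    module FF = FiniteFieldProperties F
  open import Algebra.Properties.Group +-group using (x∙y⁻¹≈ε⇒x≈y)

  embedHom : RawHom F.rawRing commutativeRing
  embedHom = record
    { φ = embed ; φ-0 = 0#-homo ; φ-1 = 1#-homo ; φ-+ = +-homo ; φ-* = *-homo ; φ-neg = -‿homo }

  module Embed = RawHomProperties commutativeRing embedHom

  embed-nonzero : ∀ {a} → ¬ (a F.≈ F.0#) → ¬ (embed a ≈ 0#)
  embed-nonzero {a} a≉0 p with F.inverse a a≉0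
  ... | b , ab≈1 = 0≉1 (begin
    0# ≈⟨ trans (*-congʳ p) (zeroˡ _) ⟨
    embed a * embed b ≈⟨ *-homo a b ⟨
    embed (a F.* b) ≈⟨ ⟦⟧-cong ab≈1 ⟩
    embed F.1# ≈⟨ 1#-homo ⟩
    1# ∎)
    where open SetoidReasoning setoid

  embed-injective : ∀ {a b} → embed a ≈ embed b → a F.≈ b
  embed-injective {a} {b} p with a F.≟ b
  ... | yes a≈b = a≈b
  ... | no  a≉b = ⊥-elim (embed-nonzero (a≉b ∘ F-x∙y⁻¹≈ε⇒x≈y a b) (begin
    embed (a F.+ (F.- b)) ≈⟨ +-homo a (F.- b) ⟩
    embed a + embed (F.- b) ≈⟨ +-cong p (-‿homo b) ⟩
    embed b + - embed b ≈⟨ -‿inverseʳ _ ⟩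
    0# ∎))
    where
    open SetoidReasoning setoid
    open import Algebra.Properties.Group F.+-group using () renaming (x∙y⁻¹≈ε⇒x≈y to F-x∙y⁻¹≈ε⇒x≈y)

  eval-embed : ∀ f α → eval (map embed f) (embed α) ≈ embed (F[x].eval f α)
  eval-embed f α = sym (Embed.φ-eval f α)

  map-embed-cong : ∀ {f g} → f F[x].≈ₚ g → map embed f ≋ map embed g
  map-embed-cong {f} {g} p .at i = trans (Embed.coeff-map f i) (trans (⟦⟧-cong (p i)) (sym (Embed.coeff-map g i)))

  embed-HasDegree : ∀ {f D} → F[x].HasDegree f D → HasDegree (map embed f) D
  embed-HasDegree {f} {D} (nz , u) = (λ q → embed-nonzero nz (trans (sym (Embed.coeff-map f D)) q)) ,
    λ i D<i → trans (Embed.coeff-map f i) (trans (⟦⟧-cong (u i D<i)) 0#-homo)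

  embed-^ : ∀ a k → embed a ^ k ≈ embed (a FE.^ k)
  embed-^ a k = sym (Embed.φ-^ a k)

  embed-^q : ∀ a → embed a ^ F.order ≈ embed a
  embed-^q a = trans (embed-^ a F.order) (⟦⟧-cong (FF.x^q≈x a))

  p·1≈0 : p · 1# ≈ 0#
  p·1≈0 = trans (sym (embed-· p)) (trans (⟦⟧-cong (FF.p·1≈0 p n order≡p^n)) 0#-homo)
    where
    embed-· : ∀ k → embed (k FM.× F.1#) ≈ k · 1#
    embed-· zero    = 0#-homo
    embed-· (suc k) = trans (+-homo F.1# _) (+-cong 1#-homo (embed-· k))

  open FieldPolynomials closure public using (module AlgebraicallyClosed)
  open AlgebraicallyClosed algClosed public

-- Roots of unity

module CofactorPolynomial {c ℓ} (K : Field c ℓ) where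
  open Field K hiding (_-_)
  open Polynomials rawRing
  open PolynomialRing commutativeRing
  open Evaluation commutativeRing
  open Degree commutativeRing
  open FieldPolynomials K
  open CommutativeSemiringExp commutativeSemiring using (_^_; ^-congˡ; ^-assocʳ)
  open SemiringMult semiring using () renaming (_×_ to _·_)
  open PowerLaws commutativeRing
  private
    module C = PowerDifference commutativeRing
    module Cₚ = PowerDifference polynomialRing
  open SetoidReasoning setoid
  open import Algebra.Properties.Group +-group using (x∙y⁻¹≈ε⇒x≈y)

  -- 1 + X ^ g + … + X ^ (g (w - 1))
  repunit : ℕ → ℕ → Poly
  repunit g w = Cₚ.cofactor w (X ^ₚ g) (const 1#)

  cofactor-cong : ∀ w {a a′ b b′} → a ≈ a′ → b ≈ b′ → C.cofactor w a b ≈ C.cofactor w a′ b′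
  cofactor-cong zero    p q = refl
  cofactor-cong (suc w) p q = +-cong (^-congˡ w p) (*-cong q (cofactor-cong w p q))

  cofactor-1-1 : ∀ w → C.cofactor w 1# 1# ≈ w · 1#
  cofactor-1-1 zero    = refl
  cofactor-1-1 (suc w) = +-cong (1^n≈1 w) (trans (*-identityˡ _) (cofactor-1-1 w))

  eval-cofactor : ∀ w f h x → eval (Cₚ.cofactor w f h) x ≈ C.cofactor w (eval f x) (eval h x)
  eval-cofactor zero    f h x = refl
  eval-cofactor (suc w) f h x = trans (eval-+ (f ^ₚ w) (h *ₚ Cₚ.cofactor w f h) x)
    (+-cong (eval-^ f w x) (trans (eval-* h (Cₚ.cofactor w f h) x) (*-congˡ (eval-cofactor w f h x))))

  eval-repunit : ∀ g w x → eval (repunit g w) x ≈ C.cofactor w (x ^ g) 1#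
  eval-repunit g w x = trans (eval-cofactor w (X ^ₚ g) (const 1#) x)
    (cofactor-cong w (trans (eval-^ X g x) (^-congˡ g (eval-X x))) (eval-const 1# x))

  Lead-repunit : ∀ g w → Lead (w ℕ.* suc g) 1# (repunit (suc g) (suc w))
  Lead-repunit g zero = Lead-resp refl (P.sym (P.trans (P.+-congˡ {const 1#} (P.zeroʳ (const 1#))) (P.+-identityʳ (const 1#)))) (Lead-const 1#)
  Lead-repunit g (suc w) = Lead-+-Below {g = const 1# *ₚ repunit (suc g) (suc w)}
    (Lead-resp (1^n≈1 (suc w)) P.refl (Lead-^ (X ^ₚ suc g) (Lead-X^ (suc g)) (suc w)))
    (Below-resp (P.sym (*ₚ-identityˡ (repunit (suc g) (suc w))))
      (Below-mono {f = repunit (suc g) (suc w)} (s≤s (ℕ.m≤n+m (w ℕ.* suc g) g)) (above (Lead-repunit g w))))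

  module _ (algClosed : ∀ f n → HasDegree f (suc n) → ∃ λ x → eval f x ≈ 0#) where

    -- A root of the repunit polynomial is a d-th root of unity; if it is moreover
    -- a q′-th one, the polynomial takes the value d / gcd d q′ there.
    roots-of-unity-∣ : ∀ d q′ → 1 ≤ d → ¬ (d · 1# ≈ 0#) → (∀ ζ → ζ ^ d ≈ 1# → ζ ^ q′ ≈ 1#) → d ∣ q′
    roots-of-unity-∣ d q′ 1≤d d≉0 all = go (gcd d q′) ≡.refl (gcd[m,n]∣m d q′)
      where
      go : ∀ g → gcd d q′ ≡ g → g ∣ d → d ∣ q′
      go g eq (divides zero d≡0) = ⊥-elim (ℕ.<⇒≢ 1≤d (≡.sym d≡0))
      go zero eq (divides (suc s) d≡s0) = ⊥-elim (ℕ.<⇒≢ 1≤d (≡.sym (≡.trans d≡s0 (ℕ.*-zeroʳ (suc s)))))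
      go g@(suc g′) eq (divides 1 d≡g) = ≡.subst (_∣ q′) (≡.trans eq (≡.trans (≡.sym (ℕ.+-identityʳ g)) (≡.sym d≡g))) (gcd[m,n]∣n d q′)
      go g@(suc g′) eq (divides s@(suc (suc w)) d≡sg) =
        ⊥-elim (d≉0 (trans (reflexive (≡.cong (_· 1#) d≡sg)) (trans (SemiringMult.×1-homo-* semiring s g) (trans (*-congʳ s·1≈0) (zeroˡ _)))))
        where
        ζ : Carrier
        ζ = proj₁ (algClosed (repunit g s) _ (Lead⇒HasDegree (0≉1 ∘ sym) (Lead-repunit g′ (suc w))))
        root : C.cofactor s (ζ ^ g) 1# ≈ 0#
        root = trans (sym (eval-repunit g s ζ)) (proj₂ (algClosed (repunit g s) _ (Lead⇒HasDegree (0≉1 ∘ sym) (Lead-repunit g′ (suc w)))))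
        ζ^d≈1 : ζ ^ d ≈ 1#
        ζ^d≈1 = begin
          ζ ^ d ≡⟨ ≡.cong (ζ ^_) (≡.trans d≡sg (ℕ.*-comm s g)) ⟩
          ζ ^ (g ℕ.* s) ≈⟨ ^-assocʳ ζ g s ⟨
          (ζ ^ g) ^ s ≈⟨ x∙y⁻¹≈ε⇒x≈y _ _ (trans (C.factor s (ζ ^ g) 1#) (trans (*-congˡ root) (zeroʳ _))) ⟩
          1# ^ s ≈⟨ 1^n≈1 s ⟩
          1# ∎
        ζ^g≈1 : ζ ^ g ≈ 1#
        ζ^g≈1 = trans (reflexive (≡.cong (ζ ^_) (≡.sym eq))) (x^gcd≈1 d q′ ζ^d≈1 (all ζ ζ^d≈1))
        s·1≈0 : s · 1# ≈ 0#
        s·1≈0 = trans (sym (cofactor-1-1 s)) (trans (sym (cofactor-cong s ζ^g≈1 refl)) root)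

-- Consequences of Frobenius nonclassicality

module Nonclassical {c ℓ c′ ℓ′} (F : FiniteField c ℓ) (F̄ : AlgebraicClosure (FiniteField.baseField F) c′ ℓ′)
  (p n : ℕ) (p-prime : Prime p) (order≡p^n : FiniteField.order F ≡ p ℕ.^ n)
  (d′ : ℕ) (f : Polynomials.Poly (FiniteField.rawRing F)) (D′ : ℕ)
  (f-degree : Polynomials.HasDegree (FiniteField.rawRing F) f (suc D′)) where
  open Closure F F̄ p n p-prime order≡p^n
  open Field closure hiding (_-_)
  open IntegerSolver commutativeRing using (solve; _:=_; _:+_; _:*_; :-_; con)
  open Polynomials rawRing
  open Multiples commutativeRing using (n·x≈[n·1]*x)
  open PolynomialRing commutativeRing
  open Evaluation commutativeRing
  open Degree commutativeRing
  open FieldPolynomials closure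
  open PowerLaws commutativeRing
  open CommutativeSemiringExp commutativeSemiring using (_^_; ^-congˡ; ^-congʳ; ^-assocʳ)
  open SemiringMult semiring using (×-homo-+; ×-congˡ) renaming (_×_ to _·_)
  open Characteristic commutativeRing p p-prime using (n·1≈0⇒p∣n)
  open import Algebra.Properties.Group +-group using (x∙y⁻¹≈ε⇒x≈y; x≈y⇒x∙y⁻¹≈ε)
  open SetoidReasoning setoid

  d D q : ℕ
  d = suc d′
  D = suc D′
  q = F.order

  f̄ : Poly
  f̄ = map embed f

  f̄-degree : HasDegree f̄ D
  f̄-degree = embed-HasDegree {f} f-degree

  f̄-below : ∀ {M} → D ≤ M → Below (suc M) f̄
  f̄-below D≤M = Below-mono {f = f̄} (s≤s D≤M) (proj₂ f̄-degree)

  q-pred : ∃ λ q′ → q ≡ suc (suc q′)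
  q-pred = q ∸ 2 , ≡.sym (ℕ.m+[n∸m]≡n (FiniteFieldProperties.2≤order F))

  d̂ : Carrier
  d̂ = d · 1#

  module C = PlaneCurves closure

  open RootCounting closure using (fixer; eval-fixer; Lead-fixer)

  Q : ℕ
  Q = q ∸ 1

  1+Q≡q : suc Q ≡ q
  1+Q≡q = ℕ.m+[n∸m]≡n (ℕ.≤-trans (s≤s z≤n) (FiniteFieldProperties.2≤order F))

  frobenius : Poly
  frobenius = fixer Q

  eval-frobenius : ∀ x → eval frobenius x ≈ x ^ q + - x
  eval-frobenius x = trans (eval-fixer Q x) (+-congʳ (^-congʳ x 1+Q≡q))

  Lead-frobenius : Lead q 1# frobenius
  Lead-frobenius = ≡.subst (λ k → Lead k 1# (fixer (k ∸ 1))) (≡.sym (proj₂ q-pred)) (Lead-fixer (proj₁ q-pred))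

  frobenius-degree : HasDegree frobenius q
  frobenius-degree = Lead⇒HasDegree (0≉1 ∘ sym) Lead-frobenius

  module Forward (irr : C.IsIrreducibleCurve d f̄) (nonclassical : C.FrobeniusNonclassical q (C.projectiveEquation d D f̄)) where

    -- The equation is y^d z^j - z^M f(x/z) with M = d + j. At z = 1 its derivative along (x^q, y^q,
    -- 1) has, besides the asserted terms, the contributions j y^d and -M f(x) of the powers of z;
    -- since y^d = f(x), they combine to -d y^d.
    tangency : ∀ x y → y ^ d ≈ eval f̄ x → d̂ * (y ^ d′ * y ^ q + - (y ^ d)) ≈ eval (derivative f̄) x * (x ^ q + - x)
    tangency x y y^d≈ = x∙y⁻¹≈ε⇒x≈y _ _ (begin
      d̂ * (y ^ d′ * y ^ q + - (y ^ d)) + - (f′ * (x ^ q + - x))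
        ≈⟨ solve 7 (λ e j a b w f′ g → e :* (a :* b :+ :- w) :+ :- (f′ :* g)
             := (con (+ 1) :* (e :* a :* b :* con (+ 1)) :+ w :* (con (+ 1) :* j)) :+ :- (con (+ 1) :* ((e :+ j) :* w :+ f′ :* g)))
             refl d̂ (j · 1#) (y ^ d′) (y ^ q) (y ^ d) f′ (x ^ q + - x) ⟩
      (1# * (d̂ * y ^ d′ * y ^ q * 1#) + y ^ d * (1# * (j · 1#)))
        + - (1# * ((d̂ + j · 1#) * y ^ d + f′ * (x ^ q + - x)))
        ≈⟨ +-cong
             (+-cong (*-congˡ (*-cong (*-congʳ (n·x≈[n·1]*x d (y ^ d′))) (1^n≈1 j)))
                     (*-congˡ (*-cong (1^n≈1 j) (×-congʳ j (1^n≈1 q)))))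
             (-‿cong (*-cong (1^n≈1 M) (+-cong
               (*-cong (trans (×-congʳ M (1^n≈1 q)) (trans (×-congˡ (≡.sym (ℕ.m+[n∸m]≡n (ℕ.m≤m⊔n d D)))) (×-homo-+ 1# d j))) (sym y^d≈))
               (*-congˡ (+-congˡ (-‿cong (trans (*-congˡ (1^n≈1 q)) (*-identityʳ x)))))))) ⟨
      (1# * ((d · (y ^ d′)) * y ^ q * 1# ^ j) + y ^ d * (1# ^ j * (j · (1# ^ q))))
        + - (1# ^ M * ((M · (1# ^ q)) * eval f̄ x + f′ * (x ^ q + - (x * 1# ^ q))))
        ≈⟨ Affine.D-equation-finite d′ j M f̄ (f̄-below (ℕ.m≤n⊔m d D)) ⟨
      1# * E.H₃.PointDerivation.D E.Δ₃ (E.equation d j M f̄)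
        ≈⟨ trans (*-identityˡ _) (E.D≈ (E.equation d j M f̄)) ⟩
      Hx * x ^ q + Hy * y ^ q + Hz * 1# ^ q
        ≈⟨ on-tangent ⟩
      0# ∎)
      where
      open SemiringMult semiring using (×-congʳ)
      M j : ℕ
      M = d ℕ.⊔ D
      j = M ∸ d
      f′ : Carrier
      f′ = eval (derivative f̄) x
      module E = CurveDerivation.AtPoint closure x y 1# (x ^ q) (y ^ q) (1# ^ q)
      module Affine = E.Finite x (sym (*-identityˡ x))
      H : C.Form
      H = C.projectiveEquation d D f̄
      Hx Hy Hz : Carrier
      Hx = C.eval₃ (C.∂X H) x y 1#
      Hy = C.eval₃ (C.∂Y H) x y 1#
      Hz = C.eval₃ (C.∂Z H) x y 1#
      on-curve : C.eval₃ H x y 1# ≈ 0#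
      on-curve = begin
        C.eval₃ H x y 1# ≈⟨ E.φ≈eval₃ H ⟨
        RawHom.φ E.Φ₃ (E.equation d j M f̄) ≈⟨ E.φ-equation d j M f̄ ⟩
        y ^ d * 1# ^ j + - RawHom.φ E.Φ₃ (C.homogenise M f̄)
          ≈⟨ +-cong (trans (*-congˡ (1^n≈1 j)) (*-identityʳ _)) (-‿cong (trans (Affine.φ-homogenise M f̄ (f̄-below (ℕ.m≤n⊔m d D))) (trans (*-congʳ (1^n≈1 M)) (*-identityˡ _)))) ⟩
        y ^ d + - eval f̄ x ≈⟨ x≈y⇒x∙y⁻¹≈ε y^d≈ ⟩
        0# ∎
      -- Nonclassicality covers the nonsingular points; at a singular point all three partial
      -- derivatives vanish and the equation holds trivially.
      on-tangent : Hx * x ^ q + Hy * y ^ q + Hz * 1# ^ q ≈ 0#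
      on-tangent with Hx ≟ 0# | Hy ≟ 0# | Hz ≟ 0#
      ... | yes a | yes b | yes e = trans (+-cong (+-cong (*-congʳ a) (*-congʳ b)) (*-congʳ e))
        (solve 3 (λ u v w → con (+ 0) :* u :+ con (+ 0) :* v :+ con (+ 0) :* w := con (+ 0)) refl _ _ _)
      ... | no a  | _     | _     = nonclassical x y 1# (λ (_ , _ , 1≈0) → 0≉1 (sym 1≈0)) on-curve (λ (a′ , _) → a a′)
      ... | yes _ | no b  | _     = nonclassical x y 1# (λ (_ , _ , 1≈0) → 0≉1 (sym 1≈0)) on-curve (λ (_ , b′ , _) → b b′)
      ... | yes _ | yes _ | no e  = nonclassical x y 1# (λ (_ , _ , 1≈0) → 0≉1 (sym 1≈0)) on-curve (λ (_ , _ , e′) → e e′)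

    open CofactorPolynomial closure using (roots-of-unity-∣)
    open import Algebra.Properties.Group P.+-group using () renaming (x∙y⁻¹≈ε⇒x≈y to x-y≋[]⇒x≋y)

    x₀-root : ∃ λ x → eval f̄ x ≈ 0#
    x₀-root = algClosed f̄ D′ f̄-degree

    -- Otherwise f′ = 0, so f is a p-th power and y ^ d - f is reducible.
    d̂≉0 : ¬ (d̂ ≈ 0#)
    d̂≉0 d̂≈0 = reducible (n·1≈0⇒p∣n p·1≈0 0≉1 d d̂≈0) (p ∸ 2) (≡.sym (ℕ.m+[n∸m]≡n 2≤p))
      (derivative≋[]⇒p-power p·1≈0 root f̄ f̄′≋[])
      where
      open FrobeniusRoot closure p p-prime
      open Reducible closure
      2≤p : 2 ≤ p
      2≤p = ℕ.nonTrivial⇒n>1 p {{prime⇒nonTrivial p-prime}}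
      f̄′≋[] : derivative f̄ ≋ []
      f̄′≋[] = *ₚ-≋[]⇒≋[] (derivative f̄) frobenius frobenius-degree (vanishing⇒≋[] _ λ x →
        let (y , y^d≈) = root d′ (eval f̄ x) in begin
        eval (derivative f̄ *ₚ frobenius) x ≈⟨ eval-* (derivative f̄) frobenius x ⟩
        eval (derivative f̄) x * eval frobenius x ≈⟨ *-congˡ (eval-frobenius x) ⟩
        eval (derivative f̄) x * (x ^ q + - x) ≈⟨ tangency x y y^d≈ ⟨
        d̂ * (y ^ d′ * y ^ q + - (y ^ d)) ≈⟨ trans (*-congʳ d̂≈0) (zeroˡ _) ⟩
        0# ∎)
      reducible : p ∣ d → ∀ w → p ≡ suc (suc w) → (∃ λ g → f̄ ≋ (g ^ₚ p)) → ⊥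
      reducible (divides zero ()) w p≡ (g , f̄≋)
      reducible (divides (suc N) d≡) w p≡ (g , f̄≋) = power-reducible d N w f̄ g
        (≡.trans d≡ (≡.cong (suc N ℕ.*_) p≡)) (≡.subst (λ k → f̄ ≋ (g ^ₚ k)) p≡ f̄≋) (proj₁ x₀-root) (proj₂ x₀-root) irr

    -- Compare the points (x₁, 1) and (x₁, ζ), where f x₁ = 1.
    ζ^Q≈1 : ∀ ζ → ζ ^ d ≈ 1# → ζ ^ Q ≈ 1#
    ζ^Q≈1 ζ ζ^d≈1 = begin
      ζ ^ Q ≈⟨ *-identityˡ _ ⟨
      1# * ζ ^ Q ≈⟨ *-congʳ ζ^d≈1 ⟨
      ζ * ζ ^ d′ * ζ ^ Q ≈⟨ solve 3 (λ z u v → z :* u :* v := u :* (z :* v)) refl ζ (ζ ^ d′) (ζ ^ Q) ⟩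
      ζ ^ d′ * ζ ^ suc Q ≈⟨ *-congˡ (^-congʳ ζ 1+Q≡q) ⟩
      ζ ^ d′ * ζ ^ q ≈⟨ x∙y⁻¹≈ε⇒x≈y _ _ (*-cancelˡ d̂≉0 (begin
        d̂ * (ζ ^ d′ * ζ ^ q + - 1#) ≈⟨ *-congˡ (+-congˡ (-‿cong ζ^d≈1)) ⟨
        d̂ * (ζ ^ d′ * ζ ^ q + - (ζ ^ d)) ≈⟨ tangency x₁ ζ (trans ζ^d≈1 (sym fx₁≈1)) ⟩
        eval (derivative f̄) x₁ * (x₁ ^ q + - x₁) ≈⟨ tangency x₁ 1# (trans (1^n≈1 d) (sym fx₁≈1)) ⟨
        d̂ * (1# ^ d′ * 1# ^ q + - (1# ^ d)) ≈⟨ *-congˡ (+-cong (trans (*-cong (1^n≈1 d′) (1^n≈1 q)) (*-identityˡ 1#)) (-‿cong (1^n≈1 d))) ⟩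
        d̂ * (1# + - 1#) ≈⟨ *-congˡ (-‿inverseʳ 1#) ⟩
        d̂ * 0# ∎)) ⟩
      1# ∎
      where
      x₁-root : ∃ λ x → eval (f̄ +ₚ const (- 1#)) x ≈ 0#
      x₁-root = algClosed (f̄ +ₚ const (- 1#)) D′ (Lead⇒HasDegree (proj₁ f̄-degree)
        (Lead-+-Below {g = const (- 1#)} (HasDegree⇒Lead f̄ f̄-degree) λ where (suc i) p → refl))
      x₁ : Carrier
      x₁ = proj₁ x₁-root
      fx₁≈1 : eval f̄ x₁ ≈ 1#
      fx₁≈1 = x∙y⁻¹≈ε⇒x≈y _ _ (trans (sym (trans (eval-+ f̄ (const (- 1#)) x₁) (+-congˡ (eval-const (- 1#) x₁)))) (proj₂ x₁-root))

    d∣Q : d ∣ Q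
    d∣Q = roots-of-unity-∣ algClosed d Q (s≤s z≤n) d̂≉0 ζ^Q≈1

    module WithQuotient (m : ℕ) (Q≡m*d : Q ≡ m ℕ.* d) (1≤m : 1 ≤ m) where

      -- Choose y with y^d = f(x). As q - 1 = m d, the product y^(d-1) y^q equals y^d (y^d)^m, so
      -- `tangency` no longer involves y. Such a y exists for every x, and `identityₚ` therefore
      -- holds between polynomials.
      identity : ∀ x → d̂ * (eval f̄ x ^ suc m + - eval f̄ x) ≈ eval (derivative f̄) x * (x ^ q + - x)
      identity x = trans (*-congˡ (+-cong (begin
          eval f̄ x ^ suc m ≈⟨ *-cong (sym y^d≈) (^-congˡ m (sym y^d≈)) ⟩
          y * y ^ d′ * (y ^ d) ^ m ≈⟨ *-congˡ (trans (^-assocʳ y d m) (^-congʳ y (≡.trans (ℕ.*-comm d m) (≡.sym Q≡m*d)))) ⟩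
          y * y ^ d′ * y ^ Q ≈⟨ solve 3 (λ z u v → z :* u :* v := u :* (z :* v)) refl y (y ^ d′) (y ^ Q) ⟩
          y ^ d′ * y ^ suc Q ≈⟨ *-congˡ (^-congʳ y 1+Q≡q) ⟩
          y ^ d′ * y ^ q ∎) (-‿cong (sym y^d≈)))) (tangency x y y^d≈)
        where
        y : Carrier
        y = proj₁ (root d′ (eval f̄ x))
        y^d≈ : y ^ d ≈ eval f̄ x
        y^d≈ = proj₂ (root d′ (eval f̄ x))

      f̄^[1+m]-f̄ : Poly
      f̄^[1+m]-f̄ = map (d̂ *_) ((f̄ ^ₚ suc m) +ₚ map (-_) f̄)

      identityₚ : f̄^[1+m]-f̄ ≋ (derivative f̄ *ₚ frobenius)
      identityₚ = x-y≋[]⇒x≋y _ _ (vanishing⇒≋[] (f̄^[1+m]-f̄ +ₚ map (-_) (derivative f̄ *ₚ frobenius)) λ x → begin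
        eval (f̄^[1+m]-f̄ +ₚ map (-_) (derivative f̄ *ₚ frobenius)) x
          ≈⟨ trans (eval-+ f̄^[1+m]-f̄ _ x) (+-cong (eval-scale d̂ ((f̄ ^ₚ suc m) +ₚ map (-_) f̄) x) (eval-neg (derivative f̄ *ₚ frobenius) x)) ⟩
        d̂ * eval ((f̄ ^ₚ suc m) +ₚ map (-_) f̄) x + - eval (derivative f̄ *ₚ frobenius) x
          ≈⟨ +-cong (*-congˡ (trans (eval-+ (f̄ ^ₚ suc m) (map (-_) f̄) x) (+-cong (eval-^ f̄ (suc m) x) (eval-neg f̄ x))))
               (-‿cong (trans (eval-* (derivative f̄) frobenius x) (*-congˡ (eval-frobenius x)))) ⟩
        d̂ * (eval f̄ x ^ suc m + - eval f̄ x) + - (eval (derivative f̄) x * (x ^ q + - x))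
          ≈⟨ x≈y⇒x∙y⁻¹≈ε (identity x) ⟩
        0# ∎)

      lhs-degree : HasDegree f̄^[1+m]-f̄ (suc m ℕ.* D)
      lhs-degree = Lead⇒HasDegree (*-nonzero d̂≉0 (^-nonzero (suc m) (proj₁ f̄-degree)))
        (Lead-scale d̂ (Lead-+-Below {g = map (-_) f̄} (Lead-^ f̄ (HasDegree⇒Lead f̄ f̄-degree) (suc m))
          (Below-neg {f = f̄} (f̄-below′))))
        where
        f̄-below′ : Below (suc m ℕ.* D) f̄
        f̄-below′ = Below-mono {f = f̄} (≡.subst (_≤ D ℕ.+ m ℕ.* D) (ℕ.+-comm D 1) (ℕ.+-monoʳ-≤ D (ℕ.≤-trans 1≤m (ℕ.m≤m*n m D)))) (proj₂ f̄-degree)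

      -- The left side of `identityₚ` has degree (m + 1) D, so f′ is non-zero; e is its degree.
      -- Together with e < D this yields m D < q ≤ (m + 1) D, that is, m is the integer part of (q -
      -- 1) / D.
      degrees : ∃ λ e → e < D × e ℕ.+ q ≡ suc m ℕ.* D
      degrees with degree? (derivative f̄)
      ... | inj₁ f̄′≋[] = ⊥-elim (proj₁ lhs-degree (trans (at identityₚ _) (at (≋[]-*ₚ (derivative f̄) frobenius f̄′≋[]) _)))
      ... | inj₂ (e , de) = e , HasDegree-Below (derivative f̄) de (Below-derivative f̄ (proj₂ f̄-degree)) ,
        HasDegree-Lead (derivative f̄ *ₚ frobenius) (HasDegree-* (derivative f̄) frobenius de frobenius-degree) (proj₁ lhs-degree)
          (Lead-resp refl identityₚ (HasDegree⇒Lead f̄^[1+m]-f̄ lhs-degree))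

      m*D<q : m ℕ.* D < q
      m*D<q with degrees
      ... | e , e<D , e+q≡ = ℕ.+-cancelˡ-< D (m ℕ.* D) q (≡.subst (_< D ℕ.+ q) e+q≡ (ℕ.+-monoˡ-< q e<D))

      q≤[1+m]*D : q ≤ suc m ℕ.* D
      q≤[1+m]*D with degrees
      ... | e , _ , e+q≡ = ≡.subst (q ≤_) e+q≡ (ℕ.m≤n+m q e)

      -- On the finite field x^q - x is 0, so `identity` reduces to f^(m+1) = f once the non-zero
      -- factor d is cancelled.
      values-fixed : ∀ α → CommutativeSemiringExp._^_ F.commutativeSemiring (F[x].eval f α) (suc m) F.≈ F[x].eval f α
      values-fixed α = embed-injective (trans (sym (embed-^ (F[x].eval f α) (suc m))) (x∙y⁻¹≈ε⇒x≈y _ _ (*-cancelˡ d̂≉0 (begin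
        d̂ * (embed t ^ suc m + - embed t)
          ≈⟨ *-congˡ (+-cong (^-congˡ (suc m) (eval-embed f α)) (-‿cong (eval-embed f α))) ⟨
        d̂ * (eval f̄ (embed α) ^ suc m + - eval f̄ (embed α))
          ≈⟨ identity (embed α) ⟩
        eval (derivative f̄) (embed α) * (embed α ^ q + - embed α)
          ≈⟨ trans (*-congˡ (x≈y⇒x∙y⁻¹≈ε (embed-^q α))) (trans (zeroʳ _) (sym (zeroʳ d̂))) ⟩
        d̂ * 0# ∎))))
        where
        t : F.Carrier
        t = F[x].eval f α

-- Integer quotients and divisibility between numbers p^e - 1

quotient-unique : ∀ m n o .{{_ : ℕ.NonZero o}} → m ℕ.* o ≤ n → n < suc m ℕ.* o → n / o ≡ m
quotient-unique m n o lower upper = ℕ.≤-antisym (ℕ.≤-pred (m<n*o⇒m/o<n {n} {suc m} {o} upper))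
  (≡.subst (_≤ n / o) (m*n/n≡m m o) (/-monoˡ-≤ o lower))

-- Modulo pᵉ - 1, pⁿ - 1 is congruent to p ^ (n % e) - 1, which is smaller than pᵉ - 1.
p^e-1∣p^n-1⇒e∣n : ∀ p e n → 2 ≤ p → 1 ≤ e → p ℕ.^ e ∸ 1 ∣ p ℕ.^ n ∸ 1 → e ∣ n
p^e-1∣p^n-1⇒e∣n p e@(suc _) n 2≤p 1≤e (divides j eq) = ℕ.m%n≡0⇒n∣m n e b≡0
  where
  instance
    p-nonZero : ℕ.NonZero p
    p-nonZero = ℕ.>-nonZero (ℕ.≤-trans (s≤s z≤n) 2≤p)
  k a b : ℕ
  k = p ℕ.^ e ∸ 1
  a = n / e
  b = n % e
  1≤p^ : ∀ i → 1 ≤ p ℕ.^ i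
  1≤p^ i = ℕ.m^n>0 p i
  1+k≡ : suc k ≡ p ℕ.^ e
  1+k≡ = ℕ.m+[n∸m]≡n (1≤p^ e)
  multiple : ∀ a → ∃ λ t → p ℕ.^ (a ℕ.* e) ≡ suc (t ℕ.* k)
  multiple zero = 0 , ≡.refl
  multiple (suc a) with multiple a
  ... | t , p^ae≡ = suc k ℕ.* t ℕ.+ 1 , (begin
    p ℕ.^ (e ℕ.+ a ℕ.* e) ≡⟨ ℕ.^-distribˡ-+-* p e (a ℕ.* e) ⟩
    p ℕ.^ e ℕ.* p ℕ.^ (a ℕ.* e) ≡⟨ ≡.cong₂ ℕ._*_ (≡.sym 1+k≡) p^ae≡ ⟩
    suc k ℕ.* suc (t ℕ.* k) ≡⟨ solve 2 (λ k t → (con 1 :+ k) :* (con 1 :+ t :* k) := con 1 :+ ((con 1 :+ k) :* t :+ con 1) :* k) ≡.refl k t ⟩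
    suc ((suc k ℕ.* t ℕ.+ 1) ℕ.* k) ∎)
    where
    open ≡.≡-Reasoning
    open import Data.Nat.Solver using (module +-*-Solver)
    open +-*-Solver
  s : ℕ
  s = p ℕ.^ b ∸ 1
  1+s≡ : suc s ≡ p ℕ.^ b
  1+s≡ = ℕ.m+[n∸m]≡n (1≤p^ b)
  k∣s : k ∣ s
  k∣s with multiple a
  ... | t , p^ae≡ = ℕ.∣m+n∣m⇒∣n {m = suc s ℕ.* t ℕ.* k} (divides j (ℕ.suc-injective (begin
    suc (suc s ℕ.* t ℕ.* k ℕ.+ s) ≡⟨ solve 3 (λ k t s → con 1 :+ ((con 1 :+ s) :* t :* k :+ s) := (con 1 :+ s) :* (con 1 :+ t :* k)) ≡.refl k t s ⟩
    suc s ℕ.* suc (t ℕ.* k) ≡⟨ ≡.cong₂ ℕ._*_ 1+s≡ (≡.sym p^ae≡) ⟩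
    p ℕ.^ b ℕ.* p ℕ.^ (a ℕ.* e) ≡⟨ ℕ.^-distribˡ-+-* p b (a ℕ.* e) ⟨
    p ℕ.^ (b ℕ.+ a ℕ.* e) ≡⟨ ≡.cong (p ℕ.^_) (≡.sym (m≡m%n+[m/n]*n n e)) ⟩
    p ℕ.^ n ≡⟨ ≡.sym (ℕ.m+[n∸m]≡n (1≤p^ n)) ⟩
    suc (p ℕ.^ n ∸ 1) ≡⟨ ≡.cong suc eq ⟩
    suc (j ℕ.* k) ∎))) (ℕ.∣n⇒∣m*n (suc s ℕ.* t) ℕ.∣-refl)
    where
    open ≡.≡-Reasoning
    open import Data.Nat.Solver using (module +-*-Solver)
    open +-*-Solver
  s<k : s < k
  s<k = ℕ.≤-pred (≡.subst₂ _<_ (≡.sym 1+s≡) (≡.sym 1+k≡) (ℕ.^-monoʳ-< p 2≤p (m%n<n n e)))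
  s≡0 : s ≡ 0
  s≡0 with s in eq
  ... | zero   = ≡.refl
  ... | suc s′ = ⊥-elim (ℕ.<⇒≱ (≡.subst (_< k) eq s<k) (ℕ.∣⇒≤ (≡.subst (k ∣_) eq k∣s)))
  b≡0 : b ≡ 0
  b≡0 with b in eq
  ... | zero   = ≡.refl
  ... | suc b′ = ⊥-elim (ℕ.<⇒≢ (ℕ.≤-trans (ℕ.^-monoʳ-< p 2≤p {0} {suc b′} (s≤s z≤n)) ℕ.≤-refl)
    (≡.trans (≡.cong suc (≡.sym s≡0)) (≡.trans 1+s≡ (≡.cong (p ℕ.^_) eq))))

-- Application of (C) to the set of d-th powers

module ApplyC {c ℓ} (statementC : StatementC c ℓ) (F : FiniteField c ℓ)
  (p n : ℕ) (p-prime : Prime p) (order≡p^n : FiniteField.order F ≡ p ℕ.^ n)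
  (d′ m : ℕ) (2≤m : 2 ≤ m) (Q≡m*d : FiniteField.order F ∸ 1 ≡ m ℕ.* suc d′) where
  open FiniteField F hiding (_-_)
  open Polynomials rawRing hiding (rawRing)
  open PolynomialRing commutativeRing
  open Evaluation commutativeRing
  open Degree commutativeRing
  open FieldPolynomials baseField
  open RootCounting baseField
  open ValueSets F
  open FiniteFieldProperties F
  open Enumeration
  open CommutativeSemiringExp commutativeSemiring using (_^_; ^-congˡ; ^-congʳ; ^-assocʳ; ^-homo-*; ^-distrib-*)
  open SetoidReasoning setoid

  d Q : ℕ
  d = suc d′
  Q = order ∸ 1

  1≤m : 1 ≤ m
  1≤m = ℕ.≤-trans (s≤s z≤n) 2≤m

  1+Q≡q : suc Q ≡ order
  1+Q≡q = ℕ.m+[n∸m]≡n (ℕ.≤-trans (s≤s z≤n) 2≤order)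

  -- The whole field as a space of dimension 1 over itself: (C) is applied with k = n, m = 1 and v =
  -- d.
  U : Pred Carrier (c ⊔ ℓ)
  U _ = ⊤

  U-size : Enumeration U (p ℕ.^ n)
  U-size = ≡.subst (Enumeration U) order≡p^n everything

  U-subspace : IsSubspace baseField U U
  U-subspace = _

  U-dimension : HasDimension baseField U U 1
  U-dimension = (λ _ → 1#) , record
    { basis∈      = _
    ; spanning    = λ {u} _ → (λ _ → u) , _ , sym (trans (+-identityʳ _) (*-identityʳ u))
    ; independent = λ { a _ eq Fin.zero → trans (sym (trans (+-identityʳ _) (*-identityʳ _))) eq }
    }

  S : Pred Carrier (c ⊔ ℓ)
  S = Powers rawRing U d

  X^d : Poly
  X^d = X ^ₚ d

  eval-X^d : ∀ α → eval X^d α ≈ α ^ d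
  eval-X^d α = trans (eval-^ X d α) (^-congˡ d (eval-X α))

  -- X^d has the properties established for f, with the same m. Both value sets are therefore the
  -- full solution set of t^(m+1) = t, and this is how they are compared.
  X^d-values : Enumeration (ValueSet F X^d) (suc m) × ValueSet F X^d ≐ (λ t → t ^ suc m ≈ t)
  X^d-values = full-ValueSet {d′} {m} X^d (Lead⇒HasDegree (0≉1 ∘ sym) (Lead-X^ d)) 1≤m
    (≡.subst₂ _≤_ (≡.cong suc Q≡m*d) 1+Q≡q ℕ.≤-refl) λ α → begin
      eval X^d α ^ suc m ≈⟨ ^-congˡ (suc m) (eval-X^d α) ⟩
      (α ^ d) ^ suc m ≈⟨ ^-assocʳ α d (suc m) ⟩
      -- From q - 1 = m d it follows that d (m + 1) = q + (d - 1).
      α ^ (d ℕ.* suc m) ≡⟨ ≡.cong (α ^_) (≡.trans (ℕ.*-comm d (suc m)) (≡.trans (≡.cong (d ℕ.+_) (≡.sym Q≡m*d)) (≡.trans (≡.cong suc (ℕ.+-comm d′ Q)) (≡.cong (ℕ._+ d′) 1+Q≡q)))) ⟩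
      α ^ (order ℕ.+ d′) ≈⟨ ^-homo-* α order d′ ⟩
      α ^ order * α ^ d′ ≈⟨ *-congʳ (x^q≈x α) ⟩
      α ^ d ≈⟨ eval-X^d α ⟨
      eval X^d α ∎

  S≐fixed : S ≐ (λ t → t ^ suc m ≈ t)
  S≐fixed = (λ (s , _ , eq) → proj₁ (proj₂ X^d-values) (s , trans (eval-X^d s) (sym eq))) ,
    (λ p → let (s , eq) = proj₂ (proj₂ X^d-values) p in s , tt , trans (sym eq) (eval-X^d s))

  S-size : Enumeration S (suc m)
  S-size = transfer ((λ (s , eq) → s , tt , trans (sym eq) (eval-X^d s)) , (λ (s , _ , eq) → s , trans (eval-X^d s) (sym eq))) (proj₁ X^d-values)

  S-resp : ∀ {x y} → x ≈ y → x ∈ S → y ∈ S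
  S-resp x≈y (s , s∈ , eq) = s , s∈ , trans (sym x≈y) eq

  1∈S : 1# ∈ S
  1∈S = 1# , tt , sym (PowerLaws.1^n≈1 commutativeRing d)

  S-* : ∀ {x y} → x ∈ S → y ∈ S → x * y ∈ S
  S-* (s , _ , x≈) (t , _ , y≈) = s * t , tt , trans (*-cong x≈ y≈) (sym (^-distrib-* s t d))

  module WithSubfield (G : Pred Carrier (c ⊔ ℓ)) (e : ℕ) (basis : Enumeration G (p ℕ.^ e))
    (isSmallest : IsSmallestSubfieldContaining baseField S G) where

    isSubfield : IsSubfield baseField G
    isSubfield = proj₁ isSmallest

    S⊆G : S ⊆ G
    S⊆G = proj₁ (proj₂ isSmallest)

    k : ℕ
    k = p ℕ.^ e ∸ 1

    m<p^e : suc m ≤ p ℕ.^ e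
    m<p^e = size-mono S⊆G S-size basis

    1+k≡p^e : suc k ≡ p ℕ.^ e
    1+k≡p^e = ℕ.m+[n∸m]≡n (ℕ.≤-trans (s≤s z≤n) m<p^e)

    G-fixed : ∀ {x} → x ∈ G → x ^ suc k ≈ x
    G-fixed {x} x∈ = trans (^-congʳ x 1+k≡p^e) (fermat isSubfield basis x∈)

    -- The m + 1 elements of `S` satisfy t^(m+1) = t and, lying in `G`, also t^(p^e) = t.
    m∣k : m ∣ k
    m∣k = fixed-∣ m k 1≤m ℕ.≤-refl (elt S-size) (elt-inj S-size) (proj₁ S≐fixed ∘ elt∈ S-size) (G-fixed ∘ S⊆G ∘ elt∈ S-size)

    m≤k : m ≤ k
    m≤k = ℕ.≤-pred (≡.subst (suc m ≤_) (≡.sym 1+k≡p^e) m<p^e)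

    k∣Q : k ∣ Q
    k∣Q = fixed-∣ k Q (ℕ.≤-trans 1≤m m≤k) (≡.subst (k <_) 1+k≡p^e ℕ.≤-refl) (elt basis) (elt-inj basis) (G-fixed ∘ elt∈ basis)
      λ i → trans (^-congʳ (elt basis i) 1+Q≡q) (x^q≈x (elt basis i))

    e∣n : e ∣ n
    e∣n = p^e-1∣p^n-1⇒e∣n p e n (ℕ.nonTrivial⇒n>1 p {{prime⇒nonTrivial p-prime}}) 1≤e
      (≡.subst (k ∣_) (≡.cong (_∸ 1) order≡p^n) k∣Q)
      where
      1≤e : 1 ≤ e
      1≤e = ℕ.n≢0⇒n>0 λ e≡0 → ℕ.<⇒≱ (ℕ.≤-trans (s≤s 1≤m) m<p^e) (ℕ.≤-reflexive (≡.cong (p ℕ.^_) e≡0))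

    -- w = (p^e - 1) / m is the exponent of (C), because q - 1 = m d; N = (q - 1) / (p^e - 1) is the
    -- value that the theorem asserts for d. Their product is d, so the goal amounts to w = 1.
    w N : ℕ
    w = ℕ.quotient m∣k
    N = ℕ.quotient k∣Q

    k≡w*m : k ≡ w ℕ.* m
    k≡w*m = ℕ.m∣n⇒n≡quotient*m m∣k

    d≡N*w : d ≡ N ℕ.* w
    d≡N*w = ℕ.*-cancelˡ-≡ d (N ℕ.* w) m {{ℕ.>-nonZero 1≤m}} (≡.trans (≡.sym Q≡m*d) (≡.trans (ℕ.m∣n⇒n≡quotient*m k∣Q)
      (≡.trans (≡.cong (N ℕ.*_) k≡w*m) (≡.trans (≡.sym (ℕ.*-assoc N w m)) (ℕ.*-comm (N ℕ.* w) m)))))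

    G-order : IsSubfieldOfOrder baseField G (p ℕ.^ e)
    G-order = isSubfield , Enumeration⇒HasSize basis

    w-equation : w ℕ.* (p ℕ.^ (1 ℕ.* n) ∸ 1) ≡ k ℕ.* d
    w-equation = ≡.trans (≡.cong (w ℕ.*_) (≡.trans (≡.cong (λ i → p ℕ.^ i ∸ 1) (ℕ.*-identityˡ n)) (≡.trans (≡.cong (_∸ 1) (≡.sym order≡p^n)) Q≡m*d)))
      (≡.trans (≡.sym (ℕ.*-assoc w m d)) (≡.cong (ℕ._* d) (≡.sym k≡w*m)))

    module _ (f : Poly) (D′ : ℕ) (f-degree : HasDegree f (suc D′)) (m*D<q : m ℕ.* suc D′ < order) (q≤[1+m]*D : order ≤ suc m ℕ.* suc D′)
      (values-fixed : ∀ α → eval f α ^ suc m ≈ eval f α) where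

      f-values : Enumeration (ValueSet F f) (suc m) × ValueSet F f ≐ (λ t → t ^ suc m ≈ t)
      f-values = full-ValueSet f f-degree 1≤m m*D<q values-fixed

      -- The two degree bounds identify m as the integer part of (q - 1) / D, so m + 1 is exactly
      -- the minimal number of values.
      f∈𝒫S : f ∈ 𝒫 F S
      f∈𝒫S = (D′ , f-degree , ≡.subst (HasSize setoid (ValueSet F f)) (≡.trans (ℕ.+-comm 1 m) (≡.cong (ℕ._+ 1) (≡.sym quotient≡m))) (Enumeration⇒HasSize (proj₁ f-values))) ,
        ((proj₂ S≐fixed ∘ proj₁ (proj₂ f-values)) , (proj₂ (proj₂ f-values) ∘ proj₁ S≐fixed))
        where
        quotient≡m : Q / suc D′ ≡ m
        quotient≡m = quotient-unique m Q (suc D′) (ℕ.≤-pred (≡.subst (m ℕ.* suc D′ <_) (≡.sym 1+Q≡q) m*D<q)) (≡.subst (_≤ suc m ℕ.* suc D′) (≡.sym 1+Q≡q) q≤[1+m]*D)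

      f∈powers : f ∈ Powers (Polynomials.rawRing rawRing) (𝒫 F G) w
      f∈powers = proj₁ (proj₂ (statementC F p n p-prime order≡p^n n ℕ.∣-refl d (s≤s z≤n)
        (divides m (≡.trans (≡.cong (_∸ 1) (≡.sym order≡p^n)) Q≡m*d)) U (everything-isSubfield , Enumeration⇒HasSize U-size)
        -- `S` has m + 1 elements, which exceeds 2 because m ≥ 2.
        1 U U-subspace U-dimension tt (suc m , Enumeration⇒HasSize S-size , s≤s 2≤m))
        everything-isSubfield e G (Enumeration⇒HasSize basis) isSmallest w w-equation) {f} f∈𝒫S

-- The converse: from a minimal value set polynomial to nonclassicality

module DerivativeOfPower {c ℓ} (R : CommutativeRing c ℓ) where
  open CommutativeRing R hiding (_-_)
  open Polynomials rawRing
  open PolynomialRing R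
  open Evaluation R
  open Degree R
  open SemiringMult semiring using () renaming (_×_ to _·_)
  open SemiringMult P.semiring using (×-comm-*; ×-congʳ)
  open SetoidReasoning P.setoid

  derivative-^ : ∀ g n → derivative (g ^ₚ suc n) ≋ (suc n ·ₚ ((g ^ₚ n) *ₚ derivative g))
  derivative-^ g zero = begin
    derivative (g *ₚ const 1#)
      ≈⟨ derivative-* g (const 1#) ⟩
    (derivative g *ₚ const 1#) +ₚ (g *ₚ (0# ∷ []))
      ≈⟨ P.+-cong (*ₚ-comm (derivative g) (const 1#)) (P.trans (*ₚ-congˡ g 0∷[]≋[]) (*ₚ-zeroʳ g)) ⟩
    (const 1# *ₚ derivative g) +ₚ [] ∎
  derivative-^ g (suc n) = begin
    derivative (g *ₚ G)
      ≈⟨ derivative-* g G ⟩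
    (derivative g *ₚ G) +ₚ (g *ₚ derivative G)
      ≈⟨ P.+-cong (*ₚ-comm (derivative g) G) (P.trans (*ₚ-congˡ g (derivative-^ g n)) (×-comm-* (suc n) g _)) ⟩
    (G *ₚ derivative g) +ₚ (suc n ·ₚ (g *ₚ ((g ^ₚ n) *ₚ derivative g)))
      ≈⟨ P.+-congˡ {G *ₚ derivative g} (×-congʳ (suc n) (*ₚ-assoc g (g ^ₚ n) (derivative g))) ⟨
    suc (suc n) ·ₚ (G *ₚ derivative g) ∎
    where
    G : Poly
    G = g ^ₚ suc n

  module _ (p : ℕ) (p-prime : Prime p) (p·1≈0 : p · 1# ≈ 0#) where
    open Characteristic polynomialRing p p-prime

    derivative-p-power : ∀ g n → p ∣ suc n → derivative (g ^ₚ suc n) ≋ []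
    derivative-p-power g n p∣n = P.trans (derivative-^ g n) (p∣n⇒n·x≈0 (n·1≈0⇒n·1≋[] {p} p·1≈0) _ p∣n)

module Converse {c ℓ c′ ℓ′} (F : FiniteField c ℓ) (F̄ : AlgebraicClosure (FiniteField.baseField F) c′ ℓ′)
  (p n : ℕ) (p-prime : Prime p) (order≡p^n : FiniteField.order F ≡ p ℕ.^ n)
  (d′ : ℕ) (f : Polynomials.Poly (FiniteField.rawRing F)) (D′ : ℕ)
  (f-degree : Polynomials.HasDegree (FiniteField.rawRing F) f (suc D′))
  (k : ℕ) (1≤k : 1 ≤ k) (p∣r : p ∣ suc k) (d*k≡Q : suc d′ ℕ.* k ≡ FiniteField.order F ∸ 1) (k*D≤Q : k ℕ.* suc D′ ≤ FiniteField.order F ∸ 1)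
  (values-fixed : ∀ α → FiniteField._≈_ F (CommutativeSemiringExp._^_ (FiniteField.commutativeSemiring F) (Polynomials.eval (FiniteField.rawRing F) f α) (suc k)) (Polynomials.eval (FiniteField.rawRing F) f α)) where
  open Closure F F̄ p n p-prime order≡p^n
  open Nonclassical F F̄ p n p-prime order≡p^n d′ f D′ f-degree hiding (module Forward)
  open Field closure hiding (_-_)
  open IntegerSolver commutativeRing using (solve; _:=_; _:+_; _:*_; :-_; con)
  open Polynomials rawRing
  open Multiples commutativeRing using (n·x≈[n·1]*x)
  open PolynomialRing commutativeRing
  open Evaluation commutativeRing
  open Degree commutativeRing
  open FieldPolynomials closure
  open PowerLaws commutativeRing
  open RootCounting closure using (fixer-root)
  open DerivativeOfPower commutativeRing using (derivative-p-power)
  open CommutativeSemiringExp commutativeSemiring using (_^_; ^-congˡ; ^-congʳ; ^-homo-*; ^-assocʳ; ^-distrib-*)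
  open SemiringMult semiring using (×-congˡ; ×1-homo-*) renaming (_×_ to _·_)
  open Characteristic commutativeRing p p-prime using (p∣n⇒n·1≈0)
  open import Algebra.Properties.Group +-group using (x∙y⁻¹≈ε⇒x≈y; x≈y⇒x∙y⁻¹≈ε)
  open import Algebra.Properties.Group P.+-group using () renaming (x∙y⁻¹≈ε⇒x≈y to x-y≋[]⇒x≋y)
  private
    module FF = FiniteFieldProperties F
    module PS = IntegerSolver polynomialRing
  open SetoidReasoning setoid

  r : ℕ
  r = suc k

  D≤d : D ≤ d
  D≤d = ℕ.*-cancelˡ-≤ k {{ℕ.>-nonZero 1≤k}} (ℕ.≤-trans k*D≤Q (ℕ.≤-reflexive (≡.trans (≡.sym d*k≡Q) (ℕ.*-comm d k))))

  d≤Q : d ≤ Q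
  d≤Q = ≡.subst (d ≤_) d*k≡Q (ℕ.m≤m*n d k {{ℕ.>-nonZero 1≤k}})

  p∣q : p ∣ suc Q
  p∣q = ≡.subst (p ∣_) (≡.sym (≡.trans 1+Q≡q order≡p^n)) (m∣m^n p n (λ n≡0 → ℕ.<⇒≱ (FF.2≤order) (ℕ.≤-reflexive (≡.trans order≡p^n (≡.cong (p ℕ.^_) n≡0)))))

  -- Both 1 + k = p^e and 1 + d k = q are zero in the field, and d - 1 = d (1 + k) - (1 + d k).
  d̂≈1 : d̂ ≈ 1#
  d̂≈1 = x∙y⁻¹≈ε⇒x≈y _ _ (begin
    d̂ + - 1#
      ≈⟨ solve 2 (λ d k → d :+ :- con (+ 1) := d :* (con (+ 1) :+ k) :+ :- (con (+ 1) :+ d :* k)) refl d̂ (k · 1#) ⟩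
    d̂ * (1# + k · 1#) + - (1# + d̂ * (k · 1#))
      ≈⟨ +-cong (*-congˡ (p∣n⇒n·1≈0 p·1≈0 p∣r)) (-‿cong (begin
        1# + d̂ * (k · 1#) ≈⟨ +-congˡ (×1-homo-* d k) ⟨
        1# + (d ℕ.* k) · 1# ≈⟨ ×-congˡ (≡.cong suc d*k≡Q) ⟩
        suc Q · 1# ≈⟨ p∣n⇒n·1≈0 p·1≈0 p∣q ⟩
        0# ∎)) ⟩
    d̂ * 0# + - 0#
      ≈⟨ solve 1 (λ d → d :* con (+ 0) :+ :- con (+ 0) := con (+ 0)) refl d̂ ⟩
    0# ∎)

  d·≈ : ∀ a → d · a ≈ a
  d·≈ a = trans (n·x≈[n·1]*x d a) (trans (*-congʳ d̂≈1) (*-identityˡ a))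

  f̄^r-f̄ : Poly
  f̄^r-f̄ = (f̄ ^ₚ r) +ₚ map (-_) f̄

  eval-f̄^r-f̄ : ∀ x → eval f̄^r-f̄ x ≈ eval f̄ x ^ r + - eval f̄ x
  eval-f̄^r-f̄ x = trans (eval-+ (f̄ ^ₚ r) (map (-_) f̄) x) (+-cong (eval-^ f̄ r x) (eval-neg f̄ x))

  degree : HasDegree f̄^r-f̄ (r ℕ.* D)
  degree = Lead⇒HasDegree (^-nonzero r (proj₁ f̄-degree)) (Lead-+-Below {g = map (-_) f̄} (Lead-^ f̄ (HasDegree⇒Lead f̄ f̄-degree) r)
    (Below-neg {f = f̄} (Below-mono {f = f̄} (≡.subst (_≤ D ℕ.+ k ℕ.* D) (ℕ.+-comm D 1) (ℕ.+-monoʳ-≤ D (ℕ.≤-trans 1≤k (ℕ.m≤m*n k D)))) (proj₂ f̄-degree))))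

  -- The remainder of f^r - f modulo X^q - X has degree less than q and vanishes at the q embedded
  -- elements of the finite field, where f^r = f and x^q = x.
  quotientₚ : ∃ λ h → f̄^r-f̄ ≋ (frobenius *ₚ h)
  quotientₚ with divide frobenius Lead-frobenius f̄^r-f̄
  ... | h , ρ , eq , b = h , P.trans eq (P.trans (P.+-congˡ {frobenius *ₚ h} ρ≋[]) (P.+-identityʳ _))
    where
    open FF.Enumeration FF.everything
    ρ-root : ∀ α → eval ρ (embed α) ≈ 0#
    ρ-root α = begin
      eval ρ x ≈⟨ +-identityˡ _ ⟨
      0# + eval ρ x ≈⟨ +-congʳ (trans (*-congʳ (fixer-root Q (trans (^-congʳ x 1+Q≡q) (embed-^q α)))) (zeroˡ _)) ⟨
      eval frobenius x * eval h x + eval ρ x ≈⟨ trans (eval-+ (frobenius *ₚ h) ρ x) (+-congʳ (eval-* frobenius h x)) ⟨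
      eval ((frobenius *ₚ h) +ₚ ρ) x ≈⟨ eval-cong x eq ⟨
      eval f̄^r-f̄ x ≈⟨ eval-f̄^r-f̄ x ⟩
      eval f̄ x ^ r + - eval f̄ x ≈⟨ x≈y⇒x∙y⁻¹≈ε (begin
        eval f̄ x ^ r ≈⟨ ^-congˡ r (eval-embed f α) ⟩
        embed (F[x].eval f α) ^ r ≈⟨ embed-^ (F[x].eval f α) r ⟩
        embed _ ≈⟨ ⟦⟧-cong (values-fixed α) ⟩
        embed (F[x].eval f α) ≈⟨ eval-embed f α ⟨
        eval f̄ x ∎) ⟩
      0# ∎
      where
      x : Carrier
      x = embed α
    ρ≋[] : ρ ≋ []
    ρ≋[] = roots⇒≋[] q ρ (embed ∘ elt) (λ eq → elt-inj (embed-injective eq)) (ρ-root ∘ elt) b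

  module WithQuotient (h : Poly) (eqₚ : f̄^r-f̄ ≋ (frobenius *ₚ h)) where

    -- A non-zero h has degree r D - q = D + k D - q, and k D ≤ q - 1.
    h-below : Below D h
    h-below with degree? h
    ... | inj₁ h≋[] = λ i _ → at h≋[] i
    ... | inj₂ (j , dj) = Below-mono {f = h} j<D (proj₂ dj)
      where
      q+j≡ : q ℕ.+ j ≡ r ℕ.* D
      q+j≡ = HasDegree-Lead (frobenius *ₚ h) (HasDegree-* frobenius h frobenius-degree dj) (proj₁ degree)
        (Lead-resp refl (eqₚ) (HasDegree⇒Lead f̄^r-f̄ degree))
      j<D : suc j ≤ D
      j<D = ℕ.+-cancelˡ-≤ q (suc j) D (≤R.begin
        q ℕ.+ suc j ≤R.≡⟨ ℕ.+-suc q j ⟩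
        suc (q ℕ.+ j) ≤R.≡⟨ ≡.cong suc q+j≡ ⟩
        suc (D ℕ.+ k ℕ.* D) ≤R.≤⟨ s≤s (ℕ.+-monoʳ-≤ D k*D≤Q) ⟩
        suc (D ℕ.+ Q) ≤R.≡⟨ ≡.trans (≡.sym (ℕ.+-suc D Q)) (≡.cong (D ℕ.+_) 1+Q≡q) ⟩
        D ℕ.+ q ≤R.≡⟨ ℕ.+-comm D q ⟩
        q ℕ.+ D ≤R.∎)
        where module ≤R = ℕ.≤-Reasoning

    derivative-frobenius : derivative frobenius ≋ map (-_) (const 1#)
    derivative-frobenius = P.trans (derivative-+ (X ^ₚ suc Q) (map (-_) X)) (P.+-cong {derivative (X ^ₚ suc Q)} {[]}
      (derivative-p-power p p-prime p·1≈0 X Q p∣q)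
      (P.trans (derivative-neg X) (P.-‿cong {derivative X} {const 1#} (P.trans (∷-cong (+-identityʳ 1#) 0∷[]≋[]) P.refl))))

    -- Differentiate f^r - f = (X^q - X) h. Since p divides r and q, the derivatives of f^r and X^q
    -- - X are 0 and -1.
    h-f̄′ : (frobenius *ₚ derivative h) ≋ (h +ₚ map (-_) (derivative f̄))
    h-f̄′ = PR.begin
      frobenius *ₚ derivative h
        PR.≈⟨ PS.solve 2 (λ h u → u PS.:= h PS.:+ ((PS.:- PS.con (+ 1)) PS.:* h PS.:+ u)) P.refl h (frobenius *ₚ derivative h) ⟩
      h +ₚ ((map (-_) (const 1#) *ₚ h) +ₚ (frobenius *ₚ derivative h))
        PR.≈⟨ P.+-congˡ {h} (P.+-congʳ {frobenius *ₚ derivative h} (*ₚ-congʳ (derivative frobenius) (map (-_) (const 1#)) h derivative-frobenius)) ⟨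
      h +ₚ ((derivative frobenius *ₚ h) +ₚ (frobenius *ₚ derivative h))
        PR.≈⟨ P.+-congˡ {h} (P.trans (derivative-cong (eqₚ)) (derivative-* frobenius h)) ⟨
      h +ₚ derivative f̄^r-f̄
        PR.≈⟨ P.+-congˡ {h} (P.trans (derivative-+ (f̄ ^ₚ r) (map (-_) f̄)) (P.+-cong {derivative (f̄ ^ₚ r)} {[]} (derivative-p-power p p-prime p·1≈0 f̄ k p∣r) (derivative-neg f̄))) ⟩
      h +ₚ map (-_) (derivative f̄) PR.∎
      where module PR = SetoidReasoning P.setoid

    -- By `h-f̄′` the product (X^q - X) h′ equals h - f′, which has degree less than D ≤ d ≤ q - 1,
    -- too small for a non-zero multiple of X^q - X.
    derivative-h : derivative h ≋ []
    derivative-h with degree? (derivative h)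
    ... | inj₁ h′≋[]    = h′≋[]
    ... | inj₂ (j , dj) = ⊥-elim (ℕ.<⇒≱ (HasDegree-Below (h +ₚ map (-_) (derivative f̄))
        (HasDegree-resp h-f̄′ (HasDegree-* frobenius (derivative h) frobenius-degree dj))
        (Below-+ {f = h} {map (-_) (derivative f̄)} h-below (Below-neg {f = derivative f̄} (Below-derivative f̄ (proj₂ f̄-degree)))))
      (ℕ.≤-trans D≤d (ℕ.≤-trans d≤Q (ℕ.≤-trans (ℕ.n≤1+n Q) (ℕ.≤-trans (ℕ.≤-reflexive 1+Q≡q) (ℕ.m≤m+n q j))))))

    h≋f̄′ : h ≋ derivative f̄
    h≋f̄′ = x-y≋[]⇒x≋y h (derivative f̄) (P.trans (P.sym h-f̄′) (P.trans (*ₚ-congˡ frobenius derivative-h) (*ₚ-zeroʳ frobenius)))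

    identityₚ : f̄^r-f̄ ≋ (frobenius *ₚ derivative f̄)
    identityₚ = P.trans eqₚ (*ₚ-congˡ frobenius h≋f̄′)

    identity : ∀ u → eval f̄ u ^ r + - eval f̄ u ≈ eval (derivative f̄) u * (u ^ q + - u)
    identity u = begin
      eval f̄ u ^ r + - eval f̄ u ≈⟨ eval-f̄^r-f̄ u ⟨
      eval f̄^r-f̄ u ≈⟨ trans (eval-cong u identityₚ) (eval-* frobenius (derivative f̄) u) ⟩
      eval frobenius u * eval (derivative f̄) u ≈⟨ trans (*-comm _ _) (*-congˡ (eval-frobenius u)) ⟩
      eval (derivative f̄) u * (u ^ q + - u) ∎

    q+d′≡r*d : q ℕ.+ d′ ≡ r ℕ.* d
    q+d′≡r*d = ≡.trans (≡.cong (ℕ._+ d′) (≡.sym 1+Q≡q)) (≡.trans (≡.cong suc (ℕ.+-comm Q d′))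
      (≡.cong (d ℕ.+_) (≡.trans (≡.sym d*k≡Q) (ℕ.*-comm d k))))

    top : Carrier
    top = coeff f̄ d

    Lead-f̄ : Lead d top f̄
    Lead-f̄ = refl , f̄-below D≤d

    -- Compare the coefficients of degree r d = q + (d - 1) in f^r - f = (X^q - X) f′, using that d
    -- is 1 in the field. If D < d, then `top` is 0.
    top^r≈top : top ^ r ≈ top
    top^r≈top = begin
      top ^ r ≈⟨ Lead-unique (Lead-resp refl identityₚ lhs) rhs ⟩
      1# * (d · top) ≈⟨ trans (*-identityˡ _) (d·≈ top) ⟩
      top ∎
      where
      lhs : Lead (r ℕ.* d) (top ^ r) f̄^r-f̄
      lhs = Lead-+-Below {g = map (-_) f̄} (Lead-^ f̄ Lead-f̄ r) (Below-neg {f = f̄} (Below-mono {f = f̄}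
        (≡.subst (_≤ d ℕ.+ k ℕ.* d) (ℕ.+-comm d 1) (ℕ.+-monoʳ-≤ d (ℕ.≤-trans 1≤k (ℕ.m≤m*n k d)))) (f̄-below D≤d)))
      rhs : Lead (r ℕ.* d) (1# * (d · top)) (frobenius *ₚ derivative f̄)
      rhs = ≡.subst (λ N → Lead N (1# * (d · top)) (frobenius *ₚ derivative f̄)) q+d′≡r*d
        (Lead-* frobenius (derivative f̄) Lead-frobenius (Lead-derivative f̄ Lead-f̄))

    -- This turns y^(d-1) y^q into a power of y^d, which the equation of the curve can then replace.
    x^d′*x^q≈[x^d]^r : ∀ x → x ^ d′ * x ^ q ≈ (x ^ d) ^ r
    x^d′*x^q≈[x^d]^r x = begin
      x ^ d′ * x ^ q ≈⟨ ^-homo-* x d′ q ⟨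
      x ^ (d′ ℕ.+ q) ≡⟨ ≡.cong (x ^_) (≡.trans (ℕ.+-comm d′ q) (≡.trans q+d′≡r*d (ℕ.*-comm r d))) ⟩
      x ^ (d ℕ.* r) ≈⟨ ^-assocʳ x d r ⟨
      (x ^ d) ^ r ∎

    module Point (x y z : Carrier) where
      module E = CurveDerivation.AtPoint closure x y z (x ^ q) (y ^ q) (z ^ q)
      open RawHom E.Φ₃ using (φ)
      open E.H₃.PointDerivation E.Δ₃ using (D-1) renaming (D to δ)

      -- As D ≤ d, the curve has degree d and no factor z accompanies y^d. j and M are variables so
      -- that the expressions `(d ⊔ D) ∸ d` and `d ⊔ D` can be replaced by matching.
      tangent : ∀ j M → j ≡ 0 → M ≡ d → φ (E.equation d j M f̄) ≈ 0# → δ (E.equation d j M f̄) ≈ 0#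
      tangent .0 .(suc d′) ≡.refl ≡.refl on-curve with z ≟ 0#
      ... | no z≉0 = x*y≈0⇒y≈0 z≉0 (begin
        z * δ (E.equation d 0 d f̄)
          ≈⟨ Affine.D-equation-finite d′ 0 d f̄ (f̄-below D≤d) ⟩
        (z * ((d · (y ^ d′)) * y ^ q * 1#) + y ^ d * (1# * 0#)) + - (z ^ d * ((d · (z ^ q)) * fu + f′u * (x ^ q + - (u * z ^ q))))
          ≈⟨ +-cong (+-congʳ (*-congˡ (*-congʳ (*-congʳ (d·≈ (y ^ d′)))))) (-‿cong (*-congˡ (+-cong (*-congʳ (d·≈ (z ^ q))) (*-congˡ (+-congʳ x^q≈))))) ⟩
        (z * (y ^ d′ * y ^ q * 1#) + y ^ d * (1# * 0#)) + - (z ^ d * (z ^ q * fu + f′u * (z ^ q * u ^ q + - (u * z ^ q))))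
          -- Here y is eliminated: y^(d-1) y^q = (y^d)^r with y^d = z^d f(u), where u = x / z. What
          -- is left is `identity` at u, up to powers of z.
          ≈⟨ +-congʳ (+-congʳ (*-congˡ (*-congʳ (trans (x^d′*x^q≈[x^d]^r y) (trans (^-congˡ r y^d≈) z^dr))))) ⟩
        (z * (z ^ d′ * z ^ q * fu ^ r * 1#) + y ^ d * (1# * 0#)) + - (z ^ d * (z ^ q * fu + f′u * (z ^ q * u ^ q + - (u * z ^ q))))
          ≈⟨ solve 7 (λ z a b fr w f f′ → (z :* (a :* b :* fr :* con (+ 1)) :+ w :* (con (+ 1) :* con (+ 0))) :+ :- ((z :* a) :* (b :* f :+ f′ ))
               := (z :* a) :* (b :* (fr :+ :- f) :+ :- f′)) refl z (z ^ d′) (z ^ q) (fu ^ r) (y ^ d) fu (f′u * (z ^ q * u ^ q + - (u * z ^ q))) ⟩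
        z ^ d * (z ^ q * (fu ^ r + - fu) + - (f′u * (z ^ q * u ^ q + - (u * z ^ q))))
          ≈⟨ *-congˡ (+-congʳ (*-congˡ (identity u))) ⟩
        z ^ d * (z ^ q * (f′u * (u ^ q + - u)) + - (f′u * (z ^ q * u ^ q + - (u * z ^ q))))
          ≈⟨ solve 5 (λ a b f′ v u → a :* (b :* (f′ :* (v :+ :- u)) :+ :- (f′ :* (b :* v :+ :- (u :* b)))) := con (+ 0)) refl (z ^ d) (z ^ q) f′u (u ^ q) u ⟩
        0# ∎)
        where
        z⁻¹ u fu f′u : Carrier
        z⁻¹ = proj₁ (inverse z z≉0)
        u = x * z⁻¹
        fu = eval f̄ u
        f′u = eval (derivative f̄) u
        x≈zu : x ≈ z * u
        x≈zu = begin
          x ≈⟨ *-identityʳ x ⟨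
          x * 1# ≈⟨ *-congˡ (proj₂ (inverse z z≉0)) ⟨
          x * (z * z⁻¹) ≈⟨ solve 3 (λ x z i → x :* (z :* i) := z :* (x :* i)) refl x z z⁻¹ ⟩
          z * u ∎
        module Affine = E.Finite u x≈zu
        x^q≈ : x ^ q ≈ z ^ q * u ^ q
        x^q≈ = trans (^-congˡ q x≈zu) (^-distrib-* z u q)
        y^d≈ : y ^ d ≈ z ^ d * fu
        y^d≈ = x∙y⁻¹≈ε⇒x≈y _ _ (begin
          y ^ d + - (z ^ d * fu) ≈⟨ +-cong (*-identityʳ _) (-‿cong (Affine.φ-homogenise d f̄ (f̄-below D≤d))) ⟨
          y ^ d * 1# + - φ (C.homogenise d f̄) ≈⟨ E.φ-equation d 0 d f̄ ⟨
          φ (E.equation d 0 d f̄) ≈⟨ on-curve ⟩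
          0# ∎)
        z^dr : (z ^ d * fu) ^ r ≈ z ^ d′ * z ^ q * fu ^ r
        z^dr = trans (^-distrib-* (z ^ d) fu r) (*-congʳ (sym (x^d′*x^q≈[x^d]^r z)))
      -- At infinity the curve reads y^d = a x^d with a = `top`, and the direction has z-component
      -- z^q = 0; raising to the power r and using a^r = a gives tangency.
      ... | yes z≈0 = begin
        δ (E.equation d 0 d f̄)
          ≈⟨ E.D-equation d′ 0 d f̄ ⟩
        ((d · (y ^ d′)) * y ^ q * 1# + y ^ d * δ (RawRing.1# C.K[x][y][z].rawRing)) + - δ (C.homogenise d f̄)
          ≈⟨ +-cong (+-cong (*-congʳ (*-congʳ (d·≈ (y ^ d′)))) (*-congˡ D-1)) (-‿cong (trans (Infinity.D-homogenise d f̄ (f̄-below D≤d)) (*-congˡ (d·≈ (top * x ^ d′))))) ⟩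
        (y ^ d′ * y ^ q * 1# + y ^ d * 0#) + - (x ^ q * (top * x ^ d′))
          ≈⟨ solve 5 (λ b w c e t → (b :* con (+ 1) :+ w :* con (+ 0)) :+ :- (e :* (t :* c)) := b :+ :- (t :* (c :* e))) refl (y ^ d′ * y ^ q) (y ^ d) (x ^ d′) (x ^ q) top ⟩
        y ^ d′ * y ^ q + - (top * (x ^ d′ * x ^ q))
          ≈⟨ x≈y⇒x∙y⁻¹≈ε (begin
            y ^ d′ * y ^ q ≈⟨ x^d′*x^q≈[x^d]^r y ⟩
            (y ^ d) ^ r ≈⟨ ^-congˡ r y^d≈ ⟩
            (top * x ^ d) ^ r ≈⟨ ^-distrib-* top (x ^ d) r ⟩
            top ^ r * (x ^ d) ^ r ≈⟨ *-cong top^r≈top (sym (x^d′*x^q≈[x^d]^r x)) ⟩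
            top * (x ^ d′ * x ^ q) ∎) ⟩
        0# ∎
        where
        z^q≈0 : z ^ q ≈ 0#
        z^q≈0 = trans (^-congʳ z (≡.sym 1+Q≡q)) (trans (*-congʳ z≈0) (zeroˡ _))
        module Infinity = E.Infinite z≈0 z^q≈0
        y^d≈ : y ^ d ≈ top * x ^ d
        y^d≈ = x∙y⁻¹≈ε⇒x≈y _ _ (begin
          y ^ d + - (top * x ^ d) ≈⟨ +-cong (*-identityʳ _) (-‿cong (Infinity.φ-homogenise d f̄ (f̄-below D≤d))) ⟨
          y ^ d * 1# + - φ (C.homogenise d f̄) ≈⟨ E.φ-equation d 0 d f̄ ⟨
          φ (E.equation d 0 d f̄) ≈⟨ on-curve ⟩
          0# ∎)

    nonclassical′ : C.FrobeniusNonclassical q (C.projectiveEquation d D f̄)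
    nonclassical′ x y z _ on-curve _ = trans (sym (Pt.E.D≈ H))
      (Pt.tangent ((d ℕ.⊔ D) ∸ d) (d ℕ.⊔ D) (≡.trans (≡.cong (_∸ d) d⊔D≡d) (ℕ.n∸n≡0 d)) d⊔D≡d (trans (Pt.E.φ≈eval₃ H) on-curve))
      where
      module Pt = Point x y z
      H : C.Form
      H = C.projectiveEquation d D f̄
      d⊔D≡d : d ℕ.⊔ D ≡ d
      d⊔D≡d = ℕ.m≥n⇒m⊔n≡m D≤d

  nonclassical : C.FrobeniusNonclassical q (C.projectiveEquation d D f̄)
  nonclassical = WithQuotient.nonclassical′ (proj₁ quotientₚ) (proj₂ quotientₚ)

-- The equivalence

open import Data.Nat.Base using (_*_; _^_)

module Equivalence {c ℓ c′ ℓ′} (F : FiniteField c ℓ) (F̄ : AlgebraicClosure (FiniteField.baseField F) c′ ℓ′)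
  (p n : ℕ) (p-prime : Prime p) (order≡p^n : FiniteField.order F ≡ p ^ n)
  (d′ : ℕ) (f : Polynomials.Poly (FiniteField.rawRing F)) (D′ : ℕ)
  (f-degree : Polynomials.HasDegree (FiniteField.rawRing F) f (suc D′)) where
  private
    module F = FiniteField F
    module F[x] = Polynomials F.rawRing
    module FF = FiniteFieldProperties F
    module FP = PolynomialRing F.commutativeRing
    module FE = Evaluation F.commutativeRing
    module FD = FieldPolynomials F.baseField
  open Nonclassical F F̄ p n p-prime order≡p^n d′ f D′ f-degree
  open Closure F F̄ p n p-prime order≡p^n using (closure; embed; module Embed; map-embed-cong)

  Conclusion : Set _
  Conclusion = ∃ λ e → e ∣ n × d * (p ^ e ∸ 1) ≡ F.order ∸ 1 ×
    Σ (Pred F.Carrier (c ⊔ ℓ)) λ 𝔽ₚₑ → IsSubfieldOfOrder F.baseField 𝔽ₚₑ (p ^ e) × f ∈ 𝒫 F 𝔽ₚₑ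

  -- Membership in `Powers` gives f = g^w only up to equality of coefficients, so membership in `𝒫`
  -- must be carried along that equality.
  𝒫-resp : ∀ {s} {S : Pred F.Carrier s} g h → g FP.≋ h → g ∈ 𝒫 F S → h ∈ 𝒫 F S
  𝒫-resp g h g≋h ((E , g-degree , size) , V⊆S , S⊆V) =
    (E , FD.HasDegree-resp g≋h g-degree , FF.Enumeration⇒HasSize (FF.transfer (⊆₁ , ⊆₂) (FF.HasSize⇒Enumeration size))) ,
    (V⊆S ∘ ⊆₂) , (⊆₁ ∘ S⊆V)
    where
    ⊆₁ : ∀ {b} → b ∈ ValueSet F g → b ∈ ValueSet F h
    ⊆₁ (α , eq) = α , F.trans (F.sym (FE.eval-cong α g≋h)) eq
    ⊆₂ : ∀ {b} → b ∈ ValueSet F h → b ∈ ValueSet F g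
    ⊆₂ (α , eq) = α , F.trans (FE.eval-cong α g≋h) eq

  module _ (statementC : StatementC c ℓ) (irr : C.IsIrreducibleCurve d f̄) (d<Q : d < F.order ∸ 1)
    (nonclassical : C.FrobeniusNonclassical F.order (C.projectiveEquation d D f̄)) where
    open Forward irr nonclassical

    module _ (m : ℕ) (Q≡m*d : Q ≡ m * d) (2≤m : 2 ≤ m) where
      open WithQuotient m Q≡m*d (ℕ.≤-trans (s≤s z≤n) 2≤m)
      private
        module A = ApplyC statementC F p n p-prime order≡p^n d′ m 2≤m Q≡m*d
        module Sp = AdditiveSpan F p n p-prime order≡p^n

      module _ (G : Pred F.Carrier (c ⊔ ℓ)) (dim : ℕ) (basis : FF.Enumeration G (p ^ dim))
        (isSmallest : IsSmallestSubfieldContaining F.baseField A.S G) where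
        private module W = A.WithSubfield G dim basis isSmallest

        -- f = g ^ w, so w = 1 by irreducibility.
        conclude : ∀ w N → p ^ dim ∸ 1 ≡ w * m → d ≡ N * w → f ∈ Powers F[x].rawRing (𝒫 F G) w → Conclusion
        conclude zero    N       k≡ d≡ f∈ = ⊥-elim (ℕ.1+n≢0 (≡.trans d≡ (ℕ.*-zeroʳ N)))
        conclude (suc _) zero    k≡ () f∈
        conclude 1       (suc N) k≡ d≡ (g , g∈ , f≈g^1) = dim , W.e∣n ,
          ≡.trans (≡.cong (d *_) (≡.trans k≡ (ℕ.*-identityˡ m))) (≡.trans (ℕ.*-comm d m) (≡.sym Q≡m*d)) ,
          G , W.G-order , 𝒫-resp g f (FP′.sym (FP′.trans (FP.coeffwise f≈g^1) (FP.*ₚ-identityʳ g))) g∈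
          where module FP′ = CommutativeRing FP.polynomialRing
        conclude (suc (suc w)) (suc N) k≡ d≡ (g , g∈ , f≈g^w) = ⊥-elim (Reducible.power-reducible closure d N w f̄ (map embed g)
          d≡ (KP′.trans (map-embed-cong {f} f≈g^w) (Embed.map-^ g (suc (suc w)))) (proj₁ x₀-root) (proj₂ x₀-root) irr)
          where module KP′ = CommutativeRing (PolynomialRing.polynomialRing (Field.commutativeRing closure))

        conclusion′ : Conclusion
        conclusion′ = conclude W.w W.N W.k≡w*m W.d≡N*w (W.f∈powers f D′ f-degree m*D<q q≤[1+m]*D values-fixed)

      conclusion″ : Sp.Span (FF.Enumeration.elt A.S-size) → Conclusion
      conclusion″ span = conclusion′ G dim basis isSmallest
        where
        open Sp.Span span using (G; dim; basis)
        open Sp.SubfieldSpan {S = A.S} A.S-size A.S-resp A.1∈S A.S-* span using (isSmallest)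

    conclusion : d ∣ Q → Conclusion
    -- Here d < q - 1 enters: m ≤ 1 would give q - 1 ≤ d, and (C) needs m ≥ 2.
    conclusion (divides m Q≡m*d) = conclusion″ m Q≡m*d (ℕ.≰⇒> λ m≤1 → ℕ.<⇒≱ d<Q
        (ℕ.≤-trans (ℕ.≤-reflexive Q≡m*d) (ℕ.≤-trans (ℕ.*-monoˡ-≤ d m≤1) (ℕ.≤-reflexive (ℕ.*-identityˡ d)))))
      (AdditiveSpan.span F p n p-prime order≡p^n _)

  module _ (e : ℕ) (d*k≡Q : d * (p ^ e ∸ 1) ≡ F.order ∸ 1)
    (L : Pred F.Carrier (c ⊔ ℓ)) (L-order : IsSubfieldOfOrder F.baseField L (p ^ e)) (f∈𝒫L : f ∈ 𝒫 F L) where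
    open FF using (HasSize⇒Enumeration; transfer; size-mono; fermat)

    k : ℕ
    k = p ^ e ∸ 1

    -- Otherwise q - 1 = d k would be 0.
    k≢0 : k ≢ 0
    k≢0 k≡0 = ℕ.<⇒≢ (ℕ.<-≤-trans (s≤s z≤n) (ℕ.≤-pred (≡.subst (2 ≤_) (≡.sym 1+Q≡q) FF.2≤order)))
      (≡.sym (≡.trans (≡.sym d*k≡Q) (≡.trans (≡.cong (d *_) k≡0) (ℕ.*-zeroʳ d))))

    1+k≡p^e : suc k ≡ p ^ e
    1+k≡p^e = ℕ.m+[n∸m]≡n (ℕ.m^n>0 p {{prime⇒nonZero p-prime}} e)

    p∣1+k : p ∣ suc k
    p∣1+k = ≡.subst (p ∣_) (≡.sym 1+k≡p^e) (m∣m^n p e (λ e≡0 → k≢0 (≡.cong (λ e → p ^ e ∸ 1) e≡0)))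

    -- The p^e elements of L are the values of f, so minimality says that p^e - 1 is the integer
    -- part of (q - 1) / D. The degree hidden in `IsMVSP` agrees with the given one by uniqueness.
    k*D≤Q : k * D ≤ F.order ∸ 1
    k*D≤Q = bound (proj₁ f∈𝒫L)
      where
      bound : IsMVSP F f → k * D ≤ F.order ∸ 1
      bound (E , f-degree′ , size) with FD.HasDegree-Lead f f-degree (proj₁ f-degree′) (FD.HasDegree⇒Lead f f-degree′)
      ... | ≡.refl = ≡.subst (λ t → t * D ≤ F.order ∸ 1) quotient≡k (m/n*n≤m (F.order ∸ 1) D)
        where
        V-enumeration : FF.Enumeration L ((F.order ∸ 1) / D ℕ.+ 1)
        V-enumeration = transfer (proj₂ f∈𝒫L) (HasSize⇒Enumeration size)
        L-enumeration : FF.Enumeration L (p ^ e)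
        L-enumeration = HasSize⇒Enumeration (proj₂ L-order)
        quotient≡k : (F.order ∸ 1) / D ≡ k
        quotient≡k = ℕ.suc-injective (≡.trans (ℕ.+-comm 1 _) (≡.trans
          (ℕ.≤-antisym (size-mono (λ x∈ → x∈) V-enumeration L-enumeration) (size-mono (λ x∈ → x∈) L-enumeration V-enumeration)) (≡.sym 1+k≡p^e)))

    converse : C.FrobeniusNonclassical F.order (C.projectiveEquation d D f̄)
    converse = Converse.nonclassical F F̄ p n p-prime order≡p^n d′ f D′ f-degree k (ℕ.n≢0⇒n>0 k≢0) p∣1+k d*k≡Q k*D≤Q
      λ α → ≡.subst (λ r → F._≈_ (pow (F[x].eval f α) r) (F[x].eval f α)) (≡.sym 1+k≡p^e)
        (fermat (proj₁ L-order) (HasSize⇒Enumeration (proj₂ L-order)) (proj₁ (proj₂ f∈𝒫L) (α , F.refl)))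
      where
      open import Algebra.Properties.Semiring.Exp F.semiring using () renaming (_^_ to pow)

theorem2p8 : ∀ {c ℓ c′ ℓ′} → StatementC c ℓ →
    (F : FiniteField c ℓ) →
    let module F = FiniteField F
        module F[x] = Polynomials F.rawRing in
    (F̄ : AlgebraicClosure F.baseField c′ ℓ′) →
    let module F̄ = AlgebraicClosure F̄
        module Curves = PlaneCurves F̄.closure in
    (p n : ℕ) → Prime p → F.order ≡ p ^ n →
    (d : ℕ) → 1 ≤ d →
    (f : F[x].Poly) (D : ℕ) → F[x].HasDegree f D → 1 ≤ D →
    let f̄ = map F̄.embed f in
    Curves.IsIrreducibleCurve d f̄ →
    d < F.order ∸ 1 →
    Curves.FrobeniusNonclassical F.order (Curves.projectiveEquation d D f̄)
      ⇔
    (∃ λ e → e ∣ n × d * (p ^ e ∸ 1) ≡ F.order ∸ 1 ×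
      Σ (Pred F.Carrier (c ⊔ ℓ)) λ 𝔽ₚₑ →
        IsSubfieldOfOrder F.baseField 𝔽ₚₑ (p ^ e) × f ∈ 𝒫 F 𝔽ₚₑ)
theorem2p8 statementC F F̄ p n p-prime order≡p^n (suc d′) _ f (suc D′) f-degree _ irr d<Q =
  mk⇔ (λ nonclassical → conclusion statementC irr d<Q nonclassical (Forward.d∣Q irr nonclassical))
      (λ (e , _ , d*k≡Q , L , L-order , f∈𝒫L) → converse e d*k≡Q L L-order f∈𝒫L)
  where
  open Equivalence F F̄ p n p-prime order≡p^n d′ f D′ f-degree
  open Nonclassical F F̄ p n p-prime order≡p^n d′ f D′ f-degree using (module Forward)
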